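{- Let $\varepsilon>0$ be fixed. There is $p_0(\varepsilon)$ such that the following holds for every prime $p>p_0(\varepsilon)$. Let $\mathcal{I}$ and $\mathcal{J}$ be nonzero intervals of $\mathbb{F}_p$ such that $$|\mathcal{J}|>p^{5/119},\qquad |\mathcal{I}|\cdot|\mathcal{J}|^{21/20}>p^{3/4+\varepsilon}.$$ Then for every $\lambda\in\mathbb{F}_p$ the equation $$\sum_{i=1}^{12}\frac{x_i}{y_i}=\lambda$$ has a solution with $(x_1,\dots,x_{12})\in\mathcal{I}^{12}$ and $(y_1,\dots,y_{12})\in\mathcal{J}^{12}$ (with all $y_i\neq0$).
   Context: $\mathbb{F}_p$ is the field of residues modulo the prime $p$. An interval of $\mathbb{F}_p$ is a set of the form $\{a,a+1,\dots,a+N-1\}$ (residues mod $p$) for some $a\in\mathbb{F}_p$ and integer $1\le N\le p$; it is called nonzero if it is not equal to $\{0\}$. $|\mathcal{X}|$ denotes cardinality. The fraction $x/y$ means $x\cdot y^{ -1}$ in $\mathbb{F}_p$, so only $y\neq 0$ is allowed. Here $\varepsilon$ is a small fixed positive constant and $p$ is sufficiently large in terms of $\varepsilon$. -}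

module Defs where

open import Data.Nat using (ℕ; zero; suc; _+_; _*_; _<_; _≤_; NonZero)
open import Data.Nat.DivMod using (_%_)
open import Data.Fin using (Fin)
open import Data.List using (map; allFin)
open import Data.Nat.ListAction using (sum)
open import Data.Product using (_×_; ∃)
open import Relation.Binary.PropositionalEquality using (_≡_)
open import Relation.Nullary using (¬_)

-- Elements of F_p are represented by natural numbers x with x < p.

-- The interval {a, a+1, ..., a+N-1} (mod p) with a ∈ F_p and 1 ≤ N ≤ p,
-- which is nonzero, i.e. not equal to {0}.  Its cardinality is N (as N ≤ p).
IsNonzeroInterval : (p a N : ℕ) → Set
IsNonzeroInterval p a N = a < p × 1 ≤ N × N ≤ p × ¬ (a ≡ 0 × N ≡ 1)

InInterval : (p a N : ℕ) .{{_ : NonZero p}} → ℕ → Set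
InInterval p a N x = x < p × ∃ λ k → k < N × x ≡ (a + k) % p

sum12 : (Fin 12 → ℕ) → ℕ
sum12 f = sum (map f (allFin 12))

-- All denominators are taken in a progression y, y + u, y + 2u, … inside J, so that 1/yᵢ = (1/u) / (c + i) with
-- c = y/u.  Write N = |J| and M = |I|.
-- * N ≤ p^(15/47): by Dirichlet's theorem c = r/d with small r and d (after a reflection of J if necessary), chosen so
--   that the integers r + d L i with L = lcm(1,…,11) are pairwise coprime; by the Chinese remainder theorem the sums
--   Σ xᵢ/(r + d L i) take all values.
-- * M^12 > p up to constants: there are ≫ min(N², p) ratios c.  A nonzero rational function Σ αᵢ/(c + i) has few
--   zeros, so that for some c the sums Σ xᵢ/(c + i) take many values already for xᵢ in a shorter interval; the number
--   of values grows with every copy of their difference set until all of F_p is reached.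
-- * M^12 ≤ p up to constants: then N > p^(5/8), and a single numerator x suffices.  If A is the set of sums of four
--   reciprocals coming from one good ratio, a second moment over all ratios and dilations shows that A + B + A = F_p
--   for the set B of sums of four reciprocals coming from some other ratio.
module Submission where

open import Defs
open import Algebra.Bundles using (CommutativeRing; RawRing)
import Algebra.Solver.Ring
open import Algebra.Solver.Ring.AlmostCommutativeRing using (AlmostCommutativeRing; _-Raw-AlmostCommutative⟶_; fromCommutativeRing)
open import Data.Empty using (⊥)
open import Data.Fin using (Fin; toℕ; fromℕ<; zero; suc; #_)
open import Data.Fin.Properties as Finₚ using (toℕ-injective; toℕ-fromℕ<; toℕ<n; pigeonhole; fromℕ<-injective)
open import Data.Integer as ℤ using (ℤ; -[1+_])
import Data.Integer.Properties as ℤₚ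
open import Data.List using (List; []; _∷_; _++_; map; length; tabulate)
open import Data.List.Properties using (length-++; length-map; map-tabulate)
open import Data.List.Relation.Unary.All as All using (All; []; _∷_)
open import Data.List.Relation.Unary.All.Properties using (++⁺)
open import Data.Maybe using (Maybe; just; nothing)
open import Data.Nat
open import Data.Nat.Coprimality as Cop using (Coprime; coprime-Bézout; prime⇒coprime; coprime-divisor; coprime?; gcd≡1⇒coprime)
open import Data.Nat.DivMod
open import Data.Nat.Divisibility using (_∣_; divides; ∣⇒≤; n∣m⇒m%n≡0; m%n≡0⇒n∣m; ∣-trans; ∣-refl; ∣m∣n⇒∣m+n; ∣m+n∣m⇒∣n; ∣m⇒∣m*n; ∣n⇒∣m*n; *-monoʳ-∣; ∣1⇒≡1; 1∣_)
open import Data.Nat.GCD using (module Bézout; gcd; gcd[m,n]∣m; gcd[m,n]∣n; gcd-greatest; gcd[m,n]≢0)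
open import Data.Nat.Induction using (<-rec)
open import Data.Nat.ListAction using (sum)
open import Data.Nat.Primality using (Prime; prime⇒nonZero; prime⇒nonTrivial; euclidsLemma)
open import Data.Nat.Properties
open import Data.Nat.Tactic.RingSolver using (solve-∀)
open import Data.Product using (Σ; _×_; ∃; _,_; proj₁; proj₂; uncurry)
import Data.Product.Properties as Prodₚ
open import Data.Sum using (_⊎_; inj₁; inj₂)
open import Data.Unit using (tt)
open import Data.Vec as Vec using (Vec; []; _∷_; replicate; zipWith; lookup)
import Data.Vec.Properties as Vecₚ
open import Data.Vec.Relation.Unary.All as VAll using ([]; _∷_)
import Data.Vec.Relation.Unary.All.Properties as VAllₚ
open import Function using (_∘_; id; case_of_)
open import Level using (0ℓ)
open import Relation.Binary.Definitions using (DecidableEquality)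
open import Relation.Binary.PropositionalEquality
open import Relation.Nullary using (¬_; Dec; yes; no; contradiction)
open import Relation.Nullary.Decidable using (_×-dec_; ¬?)
open import Relation.Unary using (Decidable)

-- The cuts between the ranges come from balancing exponents, with `M` near p^(3/4)/N^(21/20). In
-- the second range N² ratios allow numerators below m = N^(1/6); filling F_p then takes about p/N²
-- copies of the value set, each lengthening the numerators by O(m). This fits below `M` when M^12
-- N^22 exceeds p^12, that is from N = p^(15/47) on. Once N² exceeds p the ratios are exhausted, and
-- the same condition reads M^12 > p. In the third range there are O(p) bad pairs (dilation, ratio)
-- against N²/p^(1/4) available ones; this is enough when N > p^(5/8). The obstacle in the first
-- range is the size of r: Dirichlet's theorem only gives r up to about p/M, which may exceed `M`,
-- whereas the denominators have to stay below `M` for the Chinese remainder argument. A large r is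
-- therefore divided by an integer u coprime to d, by entering the interval where u divides the
-- numerator and moving in multiples of u. Such a u is needed in a prescribed range although d is
-- arbitrary; hence the elementary bound q³ ≤ 48 d² for the least q ≥ 2 coprime to d.

-- Finite sums, counting by indicators, the Cauchy-Schwarz inequality.

∑ : {A : Set} → List A → (A → ℕ) → ℕ
∑ []       f = 0
∑ (x ∷ xs) f = f x + ∑ xs f

⟦_⟧ : {P : Set} → Dec P → ℕ
⟦ yes _ ⟧ = 1
⟦ no _ ⟧  = 0

⟦⟧≤1 : {P : Set} (d : Dec P) → ⟦ d ⟧ ≤ 1
⟦⟧≤1 (yes _) = ≤-refl
⟦⟧≤1 (no _)  = z≤n

⟦⟧-mono : {P Q : Set} (d : Dec P) (e : Dec Q) → (P → Q) → ⟦ d ⟧ ≤ ⟦ e ⟧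
⟦⟧-mono (no _)  e       f = z≤n
⟦⟧-mono (yes p) (yes _) f = ≤-refl
⟦⟧-mono (yes p) (no ¬q) f = contradiction (f p) ¬q

⟦⟧-true : {P : Set} (d : Dec P) → P → ⟦ d ⟧ ≡ 1
⟦⟧-true (yes _) p = refl
⟦⟧-true (no ¬p) p = contradiction p ¬p

⟦⟧-false : {P : Set} (d : Dec P) → ¬ P → ⟦ d ⟧ ≡ 0
⟦⟧-false (yes p) ¬p = contradiction p ¬p
⟦⟧-false (no _)  ¬p = refl

⟦⟧>0 : {P : Set} (d : Dec P) → 0 < ⟦ d ⟧ → P
⟦⟧>0 (yes p) _ = p

module _ {A : Set} where

  ∑-cong : (xs : List A) {f g : A → ℕ} → (∀ x → f x ≡ g x) → ∑ xs f ≡ ∑ xs g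
  ∑-cong []       h = refl
  ∑-cong (x ∷ xs) h = cong₂ _+_ (h x) (∑-cong xs h)

  ∑-mono : (xs : List A) {f g : A → ℕ} → (∀ x → f x ≤ g x) → ∑ xs f ≤ ∑ xs g
  ∑-mono []       h = z≤n
  ∑-mono (x ∷ xs) h = +-mono-≤ (h x) (∑-mono xs h)

  ∑-const : (xs : List A) (c : ℕ) → ∑ xs (λ _ → c) ≡ length xs * c
  ∑-const []       c = refl
  ∑-const (x ∷ xs) c = cong (c +_) (∑-const xs c)

  ∑-zero : (xs : List A) {f : A → ℕ} → (∀ x → f x ≡ 0) → ∑ xs f ≡ 0
  ∑-zero xs h = trans (∑-cong xs h) (trans (∑-const xs 0) (*-zeroʳ (length xs)))

  ∑-+ : (xs : List A) (f g : A → ℕ) → ∑ xs (λ x → f x + g x) ≡ ∑ xs f + ∑ xs g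
  ∑-+ []       f g = refl
  ∑-+ (x ∷ xs) f g rewrite ∑-+ xs f g = interchange (f x) (g x) (∑ xs f) (∑ xs g)
    where
    interchange : ∀ a b c d → a + b + (c + d) ≡ a + c + (b + d)
    interchange = solve-∀

  ∑-*ˡ : (xs : List A) (c : ℕ) (f : A → ℕ) → ∑ xs (λ x → c * f x) ≡ c * ∑ xs f
  ∑-*ˡ []       c f = sym (*-zeroʳ c)
  ∑-*ˡ (x ∷ xs) c f rewrite ∑-*ˡ xs c f = sym (*-distribˡ-+ c (f x) (∑ xs f))

  ∑-*ʳ : (xs : List A) (c : ℕ) (f : A → ℕ) → ∑ xs (λ x → f x * c) ≡ ∑ xs f * c
  ∑-*ʳ xs c f = trans (∑-cong xs λ x → *-comm (f x) c) (trans (∑-*ˡ xs c f) (*-comm c _))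

  ∑-swap : {B : Set} (xs : List A) (ys : List B) (f : A → B → ℕ) →
           ∑ xs (λ x → ∑ ys (f x)) ≡ ∑ ys (λ y → ∑ xs (λ x → f x y))
  ∑-swap []       ys f = sym (∑-zero′ ys)
    where
    ∑-zero′ : {B : Set} (ys : List B) → ∑ ys (λ _ → 0) ≡ 0
    ∑-zero′ []       = refl
    ∑-zero′ (_ ∷ ys) = ∑-zero′ ys
  ∑-swap {B} (x ∷ xs) ys f rewrite ∑-swap xs ys f = sym (∑-+′ ys)
    where
    ∑-+′ : (ys : List B) → ∑ ys (λ y → f x y + ∑ xs (λ z → f z y)) ≡ ∑ ys (f x) + ∑ ys (λ y → ∑ xs (λ z → f z y))
    ∑-+′ []       = refl
    ∑-+′ (y ∷ ys) rewrite ∑-+′ ys = interchange (f x y) _ (∑ ys (f x)) _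
      where
      interchange : ∀ a b c d → a + b + (c + d) ≡ a + c + (b + d)
      interchange = solve-∀

  ∑-++ : (xs ys : List A) (f : A → ℕ) → ∑ (xs ++ ys) f ≡ ∑ xs f + ∑ ys f
  ∑-++ []       ys f = refl
  ∑-++ (x ∷ xs) ys f rewrite ∑-++ xs ys f = sym (+-assoc (f x) _ _)

  ∑-map : {B : Set} (g : B → A) (ys : List B) (f : A → ℕ) → ∑ (map g ys) f ≡ ∑ ys (f ∘ g)
  ∑-map g []       f = refl
  ∑-map g (y ∷ ys) f = cong (f (g y) +_) (∑-map g ys f)

  ∑-find : (xs : List A) {f g : A → ℕ} → ∑ xs g < ∑ xs f → ∃ λ x → g x < f x
  ∑-find (x ∷ xs) {f} {g} lt with suc (g x) ≤? f x
  ... | yes p = x , p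
  ... | no ¬p = ∑-find xs (+-cancelˡ-< (g x) _ _
                  (<-≤-trans lt (+-monoˡ-≤ _ (≮⇒≥ ¬p))))

  ∑-split : (xs : List A) {P : A → Set} (P? : Decidable P) →
            length xs ≡ ∑ xs (λ x → ⟦ P? x ⟧) + ∑ xs (λ x → 1 ∸ ⟦ P? x ⟧)
  ∑-split xs P? = trans (sym (*-identityʳ _)) (trans (sym (∑-const xs 1))
    (trans (∑-cong xs λ x → sym (m+[n∸m]≡n (⟦⟧≤1 (P? x)))) (∑-+ xs _ _)))

2mn≤m²+n² : ∀ m n → 2 * (m * n) ≤ m * m + n * n
2mn≤m²+n² m n with ≤-total m n
... | inj₁ m≤n = subst (λ k → 2 * (m * k) ≤ m * m + k * k) (m+[n∸m]≡n m≤n)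
                   (≤-trans (m≤m+n _ _) (≤-reflexive (sq m (n ∸ m))))
  where
  sq : ∀ a b → 2 * (a * (a + b)) + b * b ≡ a * a + (a + b) * (a + b)
  sq = solve-∀
... | inj₂ n≤m = subst (λ k → 2 * (k * n) ≤ k * k + n * n) (m+[n∸m]≡n n≤m)
                   (≤-trans (m≤m+n _ _) (≤-reflexive (sq n (m ∸ n))))
  where
  sq : ∀ a b → 2 * ((a + b) * a) + b * b ≡ (a + b) * (a + b) + a * a
  sq = solve-∀

∑-square : {A : Set} (xs : List A) (f : A → ℕ) → ∑ xs f * ∑ xs f ≡ ∑ xs (λ x → ∑ xs (λ y → f x * f y))
∑-square xs f = trans (sym (∑-*ʳ xs (∑ xs f) f)) (∑-cong xs λ x → sym (∑-*ˡ xs (f x) f))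

-- Both squares are expanded into double sums and compared termwise through 2ab ≤ a² + b². The
-- function `s` stands for the indicator of a set containing the support of `f`; a small support is
-- what makes the inequality strong later.
cauchy : {A : Set} (xs : List A) (f s : A → ℕ) → (∀ x → f x ≡ 0 ⊎ 1 ≤ s x) →
         ∑ xs f * ∑ xs f ≤ ∑ xs s * ∑ xs (λ x → f x * f x)
cauchy xs f s supp = *-cancelˡ-≤ 2 (begin
  2 * (∑ xs f * ∑ xs f)                                                  ≡⟨ cong (2 *_) (∑-square xs f) ⟩
  2 * ∑ xs (λ x → ∑ xs (λ y → f x * f y))                                ≡⟨ sym (∑-*ˡ xs 2 _) ⟩
  ∑ xs (λ x → 2 * ∑ xs (λ y → f x * f y))                                ≡⟨ ∑-cong xs (λ x → sym (∑-*ˡ xs 2 _)) ⟩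
  ∑ xs (λ x → ∑ xs (λ y → 2 * (f x * f y)))                              ≤⟨ ∑-mono xs (λ x → ∑-mono xs (λ y → term x y)) ⟩
  ∑ xs (λ x → ∑ xs (λ y → f x * f x * s y + s x * (f y * f y)))          ≡⟨ ∑-cong xs (λ x → trans (∑-+ xs _ _) (cong₂ _+_ (∑-*ˡ xs (f x * f x) s) (∑-*ˡ xs (s x) _))) ⟩
  ∑ xs (λ x → f x * f x * S + s x * Q)                                   ≡⟨ trans (∑-+ xs _ _) (cong₂ _+_ (∑-*ʳ xs S _) (∑-*ʳ xs Q s)) ⟩
  Q * S + S * Q                                                          ≡⟨ twice S Q ⟩
  2 * (S * Q) ∎)
  where
  open ≤-Reasoning
  S = ∑ xs s
  Q = ∑ xs (λ x → f x * f x)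
  twice : ∀ S Q → Q * S + S * Q ≡ 2 * (S * Q)
  twice = solve-∀
  term : ∀ x y → 2 * (f x * f y) ≤ f x * f x * s y + s x * (f y * f y)
  term x y with supp x | supp y
  ... | inj₁ e | _      rewrite e = z≤n
  ... | inj₂ _ | inj₁ e rewrite e | *-zeroʳ (f x) = z≤n
  ... | inj₂ sx | inj₂ sy = begin
    2 * (f x * f y)                        ≤⟨ 2mn≤m²+n² (f x) (f y) ⟩
    f x * f x + f y * f y                  ≡⟨ cong₂ _+_ (sym (*-identityʳ (f x * f x))) (sym (*-identityˡ (f y * f y))) ⟩
    f x * f x * 1 + 1 * (f y * f y)        ≤⟨ +-mono-≤ (*-monoʳ-≤ (f x * f x) sy) (*-monoˡ-≤ (f y * f y) sx) ⟩
    f x * f x * s y + s x * (f y * f y)    ∎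

-- Lists as finite sets: ranges, multiplicities, counting along injections.

rng : ℕ → List ℕ
rng zero    = []
rng (suc n) = n ∷ rng n

length-rng : ∀ n → length (rng n) ≡ n
length-rng zero    = refl
length-rng (suc n) = cong suc (length-rng n)

∑-rng-mono : ∀ n {f g : ℕ → ℕ} → (∀ i → i < n → f i ≤ g i) → ∑ (rng n) f ≤ ∑ (rng n) g
∑-rng-mono zero    h = z≤n
∑-rng-mono (suc n) h = +-mono-≤ (h n ≤-refl) (∑-rng-mono n λ i i<n → h i (m<n⇒m<1+n i<n))

∑-rng-find : ∀ n {f g : ℕ → ℕ} → ∑ (rng n) g < ∑ (rng n) f → ∃ λ i → i < n × g i < f i
∑-rng-find (suc n) {f} {g} lt with suc (g n) ≤? f n
... | yes q = n , ≤-refl , q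
... | no ¬q with ∑-rng-find n (+-cancelˡ-< (g n) _ _ (<-≤-trans lt (+-monoˡ-≤ _ (≮⇒≥ ¬q))))
... | i , i<n , q = i , m<n⇒m<1+n i<n , q

∑-rng-≟≥ : ∀ n a → n ≤ a → ∑ (rng n) (λ x → ⟦ x ≟ a ⟧) ≡ 0
∑-rng-≟≥ zero    a n≤a = refl
∑-rng-≟≥ (suc n) a n<a rewrite ⟦⟧-false (n ≟ a) (<⇒≢ n<a) = ∑-rng-≟≥ n a (<⇒≤ n<a)

∑-rng-≟< : ∀ n a → a < n → ∑ (rng n) (λ x → ⟦ x ≟ a ⟧) ≡ 1
∑-rng-≟< (suc n) a a<1+n with n ≟ a
... | yes refl = cong suc (∑-rng-≟≥ n a ≤-refl)
... | no n≢a   = ∑-rng-≟< n a (≤∧≢⇒< (m<1+n⇒m≤n a<1+n) (n≢a ∘ sym))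

∑-rng-≟≤1 : ∀ n a → ∑ (rng n) (λ x → ⟦ x ≟ a ⟧) ≤ 1
∑-rng-≟≤1 n a with a <? n
... | yes q = ≤-reflexive (∑-rng-≟< n a q)
... | no ¬q = ≤-trans (≤-reflexive (∑-rng-≟≥ n a (≮⇒≥ ¬q))) z≤n

-- Absence of repetitions is expressed by multiplicities, the form in which it enters a double sum.
AtMostOnce : {A : Set} → DecidableEquality A → List A → Set
AtMostOnce _≟_ xs = ∀ a → ∑ xs (λ x → ⟦ x ≟ a ⟧) ≤ 1

Enumeration : {A : Set} → DecidableEquality A → List A → Set
Enumeration _≟_ xs = ∀ a → ∑ xs (λ x → ⟦ x ≟ a ⟧) ≡ 1

module _ {A : Set} (_≟A_ : DecidableEquality A) where

  -- The negative answer is phrased by multiplicities: a witness would occur 0 times, which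
  -- contradicts an enumeration.
  search : (xs : List A) {P : A → Set} → Decidable P →
           (∃ P) ⊎ ((x : A) → P x → ∑ xs (λ y → ⟦ y ≟A x ⟧) ≡ 0)
  search []       P? = inj₂ λ _ _ → refl
  search (y ∷ xs) P? with P? y
  ... | yes p = inj₁ (y , p)
  ... | no ¬p with search xs P?
  ... | inj₁ w = inj₁ w
  ... | inj₂ h = inj₂ λ x Px → cong₂ _+_ (⟦⟧-false (y ≟A x) λ { refl → ¬p Px }) (h x Px)

  ∃? : {xs : List A} → Enumeration _≟A_ xs → {P : A → Set} → Decidable P → Dec (∃ P)
  ∃? {xs} en P? with search xs P?
  ... | inj₁ w = yes w
  ... | inj₂ h = no λ (x , Px) → case trans (sym (h x Px)) (en x) of λ ()

  ∑-unique : {xs : List A} → AtMostOnce _≟A_ xs → {P : A → Set} (P? : Decidable P) →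
             (∀ x y → P x → P y → x ≡ y) → ∑ xs (λ x → ⟦ P? x ⟧) ≤ 1
  ∑-unique {xs} en P? uniq with 1 ≤? ∑ xs (λ x → ⟦ P? x ⟧)
  ... | no ¬q = <⇒≤ (≰⇒> ¬q)
  ... | yes q with ∑-find xs {g = λ _ → 0} (<-≤-trans (≤-reflexive (cong suc (∑-zero xs λ _ → refl))) q)
  ... | a , Pa = ≤-trans (∑-mono xs λ x → ⟦⟧-mono (P? x) (x ≟A a) λ Px → uniq x a Px (⟦⟧>0 (P? a) Pa)) (en a)

  ∑-pick : {xs : List A} → Enumeration _≟A_ xs → (f : A → ℕ) (a : A) →
           ∑ xs (λ x → ⟦ x ≟A a ⟧ * f x) ≡ f a
  ∑-pick {xs} en f a = trans (∑-cong xs λ x → eq x) (trans (∑-*ʳ xs (f a) _) (trans (cong (_* f a) (en a)) (*-identityˡ (f a))))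
    where
    eq : ∀ x → ⟦ x ≟A a ⟧ * f x ≡ ⟦ x ≟A a ⟧ * f a
    eq x with x ≟A a
    ... | yes refl = refl
    ... | no _     = refl

  -- Double counting of the pairs (y, φ y). Injectivity is a bound on the fibres of φ restricted to
  -- `P`, so φ may be arbitrary off `P`.
  ∑-inject : {B : Set} (ys : List B) {xs : List A} → Enumeration _≟A_ xs →
             {P : B → Set} (P? : Decidable P) {Q : A → Set} (Q? : Decidable Q) (φ : B → A) →
             (∀ a → ∑ ys (λ y → ⟦ P? y ⟧ * ⟦ a ≟A φ y ⟧) ≤ 1) → (∀ y → P y → Q (φ y)) →
             ∑ ys (λ y → ⟦ P? y ⟧) ≤ ∑ xs (λ x → ⟦ Q? x ⟧)
  ∑-inject ys {xs} en {P} P? {Q} Q? φ inj PQ = begin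
    ∑ ys (λ y → ⟦ P? y ⟧)                                        ≡⟨ ∑-cong ys (λ y → sym (trans (∑-*ˡ xs ⟦ P? y ⟧ _) (trans (cong (⟦ P? y ⟧ *_) (en (φ y))) (*-identityʳ _)))) ⟩
    ∑ ys (λ y → ∑ xs (λ x → ⟦ P? y ⟧ * ⟦ x ≟A φ y ⟧))             ≡⟨ ∑-swap ys xs _ ⟩
    ∑ xs (λ x → ∑ ys (λ y → ⟦ P? y ⟧ * ⟦ x ≟A φ y ⟧))             ≤⟨ ∑-mono xs bound ⟩
    ∑ xs (λ x → ⟦ Q? x ⟧) ∎
    where
    open ≤-Reasoning
    bound : ∀ x → ∑ ys (λ y → ⟦ P? y ⟧ * ⟦ x ≟A φ y ⟧) ≤ ⟦ Q? x ⟧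
    bound x with Q? x
    ... | yes _ = inj x
    ... | no ¬q = ≤-reflexive (∑-zero ys λ y → zr y)
      where
      zr : ∀ y → ⟦ P? y ⟧ * ⟦ x ≟A φ y ⟧ ≡ 0
      zr y with P? y | x ≟A φ y
      ... | no _  | _        = refl
      ... | yes _ | no _     = refl
      ... | yes p | yes refl = contradiction (PQ y p) ¬q

-- Products of lists and vectors over a list.

cart : {A B : Set} → List A → List B → List (A × B)
cart []       ys = []
cart (x ∷ xs) ys = map (x ,_) ys ++ cart xs ys

∑-cart : {A B : Set} (xs : List A) (ys : List B) (f : A × B → ℕ) →
         ∑ (cart xs ys) f ≡ ∑ xs (λ x → ∑ ys (λ y → f (x , y)))
∑-cart []       ys f = refl
∑-cart (x ∷ xs) ys f = trans (∑-++ (map (x ,_) ys) _ f) (cong₂ _+_ (∑-map (x ,_) ys f) (∑-cart xs ys f))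

vecs : {A : Set} → List A → (k : ℕ) → List (Vec A k)
vecs xs zero    = [] ∷ []
vecs xs (suc k) = map (uncurry _∷_) (cart xs (vecs xs k))

length-as-∑ : {A : Set} (xs : List A) → length xs ≡ ∑ xs (λ _ → 1)
length-as-∑ xs = sym (trans (∑-const xs 1) (*-identityʳ _))

∑-vecs : {A : Set} (xs : List A) (k : ℕ) (f : Vec A (suc k) → ℕ) →
         ∑ (vecs xs (suc k)) f ≡ ∑ xs (λ x → ∑ (vecs xs k) (λ v → f (x ∷ v)))
∑-vecs xs k f = trans (∑-map (uncurry _∷_) (cart xs (vecs xs k)) f) (∑-cart xs (vecs xs k) _)

length-vecs : {A : Set} (xs : List A) (k : ℕ) → length (vecs xs k) ≡ length xs ^ k
length-vecs xs zero    = refl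
length-vecs xs (suc k) = trans (length-as-∑ (vecs xs (suc k))) (trans (∑-vecs xs k _)
  (trans (∑-cong xs λ _ → trans (sym (length-as-∑ (vecs xs k))) (length-vecs xs k)) (∑-const xs _)))

module _ {A : Set} (_≟A_ : DecidableEquality A) where
  open import Data.Vec.Properties using (≡-dec; ∷-injective)

  vecs-atMostOnce : {xs : List A} → AtMostOnce _≟A_ xs → ∀ k → AtMostOnce (≡-dec _≟A_) (vecs xs k)
  vecs-atMostOnce en zero    []      = ≤-refl
  vecs-atMostOnce {xs} en (suc k) (a ∷ as) = begin
    ∑ (vecs xs (suc k)) (λ v → ⟦ ≡-dec _≟A_ v (a ∷ as) ⟧)                           ≡⟨ ∑-vecs xs k _ ⟩
    ∑ xs (λ x → ∑ (vecs xs k) (λ v → ⟦ ≡-dec _≟A_ (x ∷ v) (a ∷ as) ⟧))              ≤⟨ ∑-mono xs (λ x → ∑-mono (vecs xs k) (λ v → split x v)) ⟩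
    ∑ xs (λ x → ∑ (vecs xs k) (λ v → ⟦ x ≟A a ⟧ * ⟦ ≡-dec _≟A_ v as ⟧))             ≡⟨ ∑-cong xs (λ x → ∑-*ˡ (vecs xs k) ⟦ x ≟A a ⟧ _) ⟩
    ∑ xs (λ x → ⟦ x ≟A a ⟧ * ∑ (vecs xs k) (λ v → ⟦ ≡-dec _≟A_ v as ⟧))             ≤⟨ ∑-mono xs (λ x → *-monoʳ-≤ ⟦ x ≟A a ⟧ (vecs-atMostOnce en k as)) ⟩
    ∑ xs (λ x → ⟦ x ≟A a ⟧ * 1)                                                     ≡⟨ ∑-cong xs (λ x → *-identityʳ _) ⟩
    ∑ xs (λ x → ⟦ x ≟A a ⟧)                                                         ≤⟨ en a ⟩
    1 ∎
    where
    open ≤-Reasoning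
    split : ∀ x v → ⟦ ≡-dec _≟A_ (x ∷ v) (a ∷ as) ⟧ ≤ ⟦ x ≟A a ⟧ * ⟦ ≡-dec _≟A_ v as ⟧
    split x v with ≡-dec _≟A_ (x ∷ v) (a ∷ as)
    ... | no _  = z≤n
    ... | yes e = ≤-reflexive (sym (cong₂ _*_ (⟦⟧-true (x ≟A a) (proj₁ (∷-injective e))) (⟦⟧-true (≡-dec _≟A_ v as) (proj₂ (∷-injective e)))))

-- The field F_p, with a ring solver and inverses.

module PrimeField (p : ℕ) (p-prime : Prime p) where

  instance
    p-nonZero : NonZero p
    p-nonZero = prime⇒nonZero p-prime

  0%p≡0 : 0 % p ≡ 0
  0%p≡0 = m<n⇒m%n≡m (>-nonZero⁻¹ p)

  infixl 6 _⊕_ _⊝_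
  infixl 7 _⊗_
  infix  8 ⊖_
  infix  4 _≟F_

  abstract
    F : Set
    F = Fin p

    ι : ℕ → F
    ι n = fromℕ< (m%n<n n p)

    rep : F → ℕ
    rep = toℕ

    rep<p : ∀ x → rep x < p
    rep<p = toℕ<n

    rep-ι : ∀ n → rep (ι n) ≡ n % p
    rep-ι n = toℕ-fromℕ< (m%n<n n p)

    ι-rep : ∀ x → ι (rep x) ≡ x
    ι-rep x = toℕ-injective (trans (rep-ι (toℕ x)) (m<n⇒m%n≡m (toℕ<n x)))

    _≟F_ : DecidableEquality F
    _≟F_ = Finₚ._≟_

  ι-≡ : ∀ {m n} → m % p ≡ n % p → ι m ≡ ι n
  ι-≡ {m} {n} e = trans (sym (ι-rep (ι m))) (trans (cong ι (trans (rep-ι m) (trans e (sym (rep-ι n))))) (ι-rep (ι n)))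

  ι-≡⁻¹ : ∀ {m n} → ι m ≡ ι n → m % p ≡ n % p
  ι-≡⁻¹ {m} {n} e = trans (sym (rep-ι m)) (trans (cong rep e) (rep-ι n))

  ι-inj : ∀ {m n} → m < p → n < p → ι m ≡ ι n → m ≡ n
  ι-inj m<p n<p e = trans (sym (m<n⇒m%n≡m m<p)) (trans (ι-≡⁻¹ e) (m<n⇒m%n≡m n<p))

  0F 1F : F
  0F = ι 0
  1F = ι 1

  abstract
    _⊕_ _⊗_ : F → F → F
    x ⊕ y = ι (rep x + rep y)
    x ⊗ y = ι (rep x * rep y)

    ⊖_ : F → F
    ⊖ x = ι (p ∸ rep x)

    ι-+ : ∀ m n → ι (m + n) ≡ ι m ⊕ ι n
    ι-+ m n = ι-≡ (trans (%-distribˡ-+ m n p) (cong (_% p) (sym (cong₂ _+_ (rep-ι m) (rep-ι n)))))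

    ι-* : ∀ m n → ι (m * n) ≡ ι m ⊗ ι n
    ι-* m n = ι-≡ (trans (%-distribˡ-* m n p) (cong (_% p) (sym (cong₂ _*_ (rep-ι m) (rep-ι n)))))

    ⊖-inverseʳ : ∀ x → x ⊕ (⊖ x) ≡ 0F
    ⊖-inverseʳ x = begin
      x ⊕ ι (p ∸ rep x)           ≡⟨ cong (_⊕ ι (p ∸ rep x)) (sym (ι-rep x)) ⟩
      ι (rep x) ⊕ ι (p ∸ rep x)   ≡⟨ sym (ι-+ _ _) ⟩
      ι (rep x + (p ∸ rep x))     ≡⟨ cong ι (m+[n∸m]≡n (<⇒≤ (rep<p x))) ⟩
      ι p                         ≡⟨ ι-≡ (trans (n%n≡0 p) (sym 0%p≡0)) ⟩
      0F ∎
      where open ≡-Reasoning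

  ⊕-comm : ∀ x y → x ⊕ y ≡ y ⊕ x
  ⊕-comm x y rewrite sym (ι-rep x) | sym (ι-rep y) = trans (sym (ι-+ _ _)) (trans (cong ι (+-comm (rep x) (rep y))) (ι-+ _ _))

  ⊗-comm : ∀ x y → x ⊗ y ≡ y ⊗ x
  ⊗-comm x y rewrite sym (ι-rep x) | sym (ι-rep y) = trans (sym (ι-* _ _)) (trans (cong ι (*-comm (rep x) (rep y))) (ι-* _ _))

  private
    ⊕-lift : ∀ x y {m n} → x ≡ ι m → y ≡ ι n → x ⊕ y ≡ ι (m + n)
    ⊕-lift x y refl refl = sym (ι-+ _ _)

    ⊗-lift : ∀ x y {m n} → x ≡ ι m → y ≡ ι n → x ⊗ y ≡ ι (m * n)
    ⊗-lift x y refl refl = sym (ι-* _ _)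

    ρ : ∀ x → x ≡ ι (rep x)
    ρ x = sym (ι-rep x)

  ⊕-assoc : ∀ x y z → (x ⊕ y) ⊕ z ≡ x ⊕ (y ⊕ z)
  ⊕-assoc x y z = trans (⊕-lift _ _ (⊕-lift _ _ (ρ x) (ρ y)) (ρ z)) (trans (cong ι (+-assoc (rep x) (rep y) (rep z)))
    (sym (⊕-lift _ _ (ρ x) (⊕-lift _ _ (ρ y) (ρ z)))))

  ⊗-assoc : ∀ x y z → (x ⊗ y) ⊗ z ≡ x ⊗ (y ⊗ z)
  ⊗-assoc x y z = trans (⊗-lift _ _ (⊗-lift _ _ (ρ x) (ρ y)) (ρ z)) (trans (cong ι (*-assoc (rep x) (rep y) (rep z)))
    (sym (⊗-lift _ _ (ρ x) (⊗-lift _ _ (ρ y) (ρ z)))))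

  ⊗-distribˡ-⊕ : ∀ x y z → x ⊗ (y ⊕ z) ≡ (x ⊗ y) ⊕ (x ⊗ z)
  ⊗-distribˡ-⊕ x y z = trans (⊗-lift _ _ (ρ x) (⊕-lift _ _ (ρ y) (ρ z))) (trans (cong ι (*-distribˡ-+ (rep x) (rep y) (rep z)))
    (sym (⊕-lift _ _ (⊗-lift _ _ (ρ x) (ρ y)) (⊗-lift _ _ (ρ x) (ρ z)))))

  ⊕-identityˡ : ∀ x → 0F ⊕ x ≡ x
  ⊕-identityˡ x = trans (⊕-lift _ _ refl (ρ x)) (ι-rep x)

  ⊗-identityˡ : ∀ x → 1F ⊗ x ≡ x
  ⊗-identityˡ x = trans (⊗-lift _ _ refl (ρ x)) (trans (cong ι (*-identityˡ (rep x))) (ι-rep x))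

  F-ring : CommutativeRing 0ℓ 0ℓ
  F-ring = record
    { Carrier = F ; _≈_ = _≡_ ; _+_ = _⊕_ ; _*_ = _⊗_ ; -_ = ⊖_ ; 0# = 0F ; 1# = 1F
    ; isCommutativeRing = record
      { isRing = record
        { +-isAbelianGroup = record
          { isGroup = record
            { isMonoid = record
              { isSemigroup = record
                { isMagma = record { isEquivalence = isEquivalence ; ∙-cong = cong₂ _⊕_ }
                ; assoc = ⊕-assoc }
              ; identity = ⊕-identityˡ , λ x → trans (⊕-comm x 0F) (⊕-identityˡ x) }
            ; inverse = (λ x → trans (⊕-comm (⊖ x) x) (⊖-inverseʳ x)) , ⊖-inverseʳ
            ; ⁻¹-cong = cong ⊖_ }
          ; comm = ⊕-comm }
        ; *-cong = cong₂ _⊗_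
        ; *-assoc = ⊗-assoc
        ; *-identity = ⊗-identityˡ , λ x → trans (⊗-comm x 1F) (⊗-identityˡ x)
        ; distrib = ⊗-distribˡ-⊕ , λ x y z → trans (⊗-comm (y ⊕ z) x) (trans (⊗-distribˡ-⊕ x y z) (cong₂ _⊕_ (⊗-comm x y) (⊗-comm x z))) }
      ; *-comm = ⊗-comm } }

  open CommutativeRing F-ring using () renaming (zeroˡ to ⊗-zeroˡ; zeroʳ to ⊗-zeroʳ; +-identityʳ to ⊕-identityʳ; *-identityʳ to ⊗-identityʳ) public
  open import Algebra.Properties.Ring (CommutativeRing.ring F-ring) using (-‿distribˡ-*; -‿distribʳ-*; -0#≈0#; -‿involutive; -‿+-comm)

  -- The canonical ring map from the integers; it supplies the coefficients of the ring solver.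
  ιℤ : ℤ → F
  ιℤ (ℤ.+ n)  = ι n
  ιℤ -[1+ n ] = ⊖ ι (suc n)

  ιℤ-neg : ∀ i → ιℤ (ℤ.- i) ≡ ⊖ (ιℤ i)
  ιℤ-neg (ℤ.+ zero)  = sym -0#≈0#
  ιℤ-neg (ℤ.+ suc n) = refl
  ιℤ-neg -[1+ n ]    = sym (-‿involutive _)

  private
    cancel-common : ∀ x y z → (x ⊕ y) ⊕ ⊖ (x ⊕ z) ≡ y ⊕ ⊖ z
    cancel-common x y z = begin
      (x ⊕ y) ⊕ ⊖ (x ⊕ z)         ≡⟨ cong₂ _⊕_ (⊕-comm x y) (sym (-‿+-comm x z)) ⟩
      (y ⊕ x) ⊕ (⊖ x ⊕ ⊖ z)       ≡⟨ ⊕-assoc y x _ ⟩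
      y ⊕ (x ⊕ (⊖ x ⊕ ⊖ z))       ≡⟨ cong (y ⊕_) (sym (⊕-assoc x (⊖ x) (⊖ z))) ⟩
      y ⊕ ((x ⊕ ⊖ x) ⊕ ⊖ z)       ≡⟨ cong (λ w → y ⊕ (w ⊕ ⊖ z)) (⊖-inverseʳ x) ⟩
      y ⊕ (0F ⊕ ⊖ z)              ≡⟨ cong (y ⊕_) (⊕-identityˡ _) ⟩
      y ⊕ ⊖ z ∎
      where open ≡-Reasoning

  ιℤ-⊖ : ∀ m n → ιℤ (m ℤ.⊖ n) ≡ ι m ⊕ ⊖ ι n
  ιℤ-⊖ m       zero    = sym (trans (cong (ι m ⊕_) -0#≈0#) (⊕-identityʳ _))
  ιℤ-⊖ zero    (suc n) = sym (⊕-identityˡ _)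
  ιℤ-⊖ (suc m) (suc n) = trans (cong ιℤ (ℤₚ.[1+m]⊖[1+n]≡m⊖n m n)) (trans (ιℤ-⊖ m n)
    (sym (trans (cong₂ (λ a b → a ⊕ ⊖ b) (ι-+ 1 m) (ι-+ 1 n)) (cancel-common 1F (ι m) (ι n)))))

  ιℤ-+ : ∀ i j → ιℤ (i ℤ.+ j) ≡ ιℤ i ⊕ ιℤ j
  ιℤ-+ (ℤ.+ m)  (ℤ.+ n)  = ι-+ m n
  ιℤ-+ (ℤ.+ m)  -[1+ n ] = ιℤ-⊖ m (suc n)
  ιℤ-+ -[1+ m ] (ℤ.+ n)  = trans (ιℤ-⊖ n (suc m)) (⊕-comm _ _)
  ιℤ-+ -[1+ m ] -[1+ n ] = trans (cong ⊖_ (trans (cong (ι ∘ suc) (sym (+-suc m n))) (ι-+ (suc m) (suc n)))) (sym (-‿+-comm _ _))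

  ιℤ-* : ∀ i j → ιℤ (i ℤ.* j) ≡ ιℤ i ⊗ ιℤ j
  ιℤ-* (ℤ.+ m) (ℤ.+ n) = trans (cong ιℤ (sym (ℤₚ.pos-* m n))) (ι-* m n)
  ιℤ-* (ℤ.+ m) -[1+ n ] = begin
    ιℤ (ℤ.+ m ℤ.* ℤ.- (ℤ.+ suc n))   ≡⟨ cong ιℤ (sym (ℤₚ.neg-distribʳ-* (ℤ.+ m) (ℤ.+ suc n))) ⟩
    ιℤ (ℤ.- (ℤ.+ m ℤ.* ℤ.+ suc n))   ≡⟨ ιℤ-neg (ℤ.+ m ℤ.* ℤ.+ suc n) ⟩
    ⊖ ιℤ (ℤ.+ m ℤ.* ℤ.+ suc n)       ≡⟨ cong (⊖_ ∘ ιℤ) (sym (ℤₚ.pos-* m (suc n))) ⟩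
    ⊖ ι (m * suc n)                  ≡⟨ cong ⊖_ (ι-* m (suc n)) ⟩
    ⊖ (ι m ⊗ ι (suc n))              ≡⟨ -‿distribʳ-* _ _ ⟩
    ι m ⊗ ⊖ ι (suc n) ∎
    where open ≡-Reasoning
  ιℤ-* -[1+ m ] (ℤ.+ n) = begin
    ιℤ (ℤ.- (ℤ.+ suc m) ℤ.* ℤ.+ n)   ≡⟨ cong ιℤ (sym (ℤₚ.neg-distribˡ-* (ℤ.+ suc m) (ℤ.+ n))) ⟩
    ιℤ (ℤ.- (ℤ.+ suc m ℤ.* ℤ.+ n))   ≡⟨ ιℤ-neg (ℤ.+ suc m ℤ.* ℤ.+ n) ⟩
    ⊖ ιℤ (ℤ.+ suc m ℤ.* ℤ.+ n)       ≡⟨ cong (⊖_ ∘ ιℤ) (sym (ℤₚ.pos-* (suc m) n)) ⟩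
    ⊖ ι (suc m * n)                  ≡⟨ cong ⊖_ (ι-* (suc m) n) ⟩
    ⊖ (ι (suc m) ⊗ ι n)              ≡⟨ -‿distribˡ-* _ _ ⟩
    ⊖ ι (suc m) ⊗ ι n ∎
    where open ≡-Reasoning
  ιℤ-* -[1+ m ] -[1+ n ] = begin
    ι (suc m * suc n)                ≡⟨ ι-* (suc m) (suc n) ⟩
    ι (suc m) ⊗ ι (suc n)            ≡⟨ sym (-‿involutive _) ⟩
    ⊖ (⊖ (ι (suc m) ⊗ ι (suc n)))    ≡⟨ cong ⊖_ (-‿distribˡ-* _ _) ⟩
    ⊖ (⊖ ι (suc m) ⊗ ι (suc n))      ≡⟨ -‿distribʳ-* _ _ ⟩
    ⊖ ι (suc m) ⊗ ⊖ ι (suc n) ∎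
    where open ≡-Reasoning

  private
    ACR : AlmostCommutativeRing 0ℓ 0ℓ
    ACR = fromCommutativeRing F-ring

    ℤ-raw : RawRing 0ℓ 0ℓ
    ℤ-raw = CommutativeRing.rawRing ℤₚ.+-*-commutativeRing

    ℤ⟶F : ℤ-raw -Raw-AlmostCommutative⟶ ACR
    ℤ⟶F = record { ⟦_⟧ = ιℤ ; +-homo = ιℤ-+ ; *-homo = ιℤ-* ; -‿homo = ιℤ-neg ; 0-homo = refl ; 1-homo = refl }

    ℤ-≟ : ∀ i j → Maybe (ιℤ i ≡ ιℤ j)
    ℤ-≟ i j with i ℤ.≟ j
    ... | yes e = just (cong ιℤ e)
    ... | no _  = nothing

  module S = Algebra.Solver.Ring ℤ-raw ACR ℤ⟶F ℤ-≟

  _⊝_ : F → F → F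
  x ⊝ y = x ⊕ ⊖ y

  x⊝x≡0 : ∀ x → x ⊝ x ≡ 0F
  x⊝x≡0 = ⊖-inverseʳ

  ⊝≡0⇒≡ : ∀ x y → x ⊝ y ≡ 0F → x ≡ y
  ⊝≡0⇒≡ x y e = trans (sym (S.solve 2 (λ x y → (x S.:- y) S.:+ y S.:= x) refl x y)) (trans (cong (_⊕ y) e) (⊕-identityˡ y))

  ι≡0⇒∣ : ∀ {n} → ι n ≡ 0F → p ∣ n
  ι≡0⇒∣ {n} e = m%n≡0⇒n∣m n p (trans (ι-≡⁻¹ e) 0%p≡0)

  ∣⇒ι≡0 : ∀ {n} → p ∣ n → ι n ≡ 0F
  ∣⇒ι≡0 {n} d = ι-≡ (trans (n∣m⇒m%n≡0 n p d) (sym 0%p≡0))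

  ι≢0 : ∀ {n} → 0 < n → n < p → ι n ≢ 0F
  ι≢0 {suc n} _ n<p e = <⇒≱ n<p (∣⇒≤ (ι≡0⇒∣ e))

  1<p : 1 < p
  1<p = nonTrivial⇒n>1 p {{prime⇒nonTrivial p-prime}}

  1≢0 : 1F ≢ 0F
  1≢0 = ι≢0 (s≤s z≤n) 1<p

  ⊗-zero-divisor : ∀ x y → x ⊗ y ≡ 0F → x ≡ 0F ⊎ y ≡ 0F
  ⊗-zero-divisor x y e with euclidsLemma (rep x) (rep y) p-prime (ι≡0⇒∣ (trans (ι-* _ _) (trans (cong₂ _⊗_ (ι-rep x) (ι-rep y)) e)))
  ... | inj₁ d = inj₁ (trans (sym (ι-rep x)) (∣⇒ι≡0 d))
  ... | inj₂ d = inj₂ (trans (sym (ι-rep y)) (∣⇒ι≡0 d))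

  ⊗-≢0 : ∀ {x y} → x ≢ 0F → y ≢ 0F → x ⊗ y ≢ 0F
  ⊗-≢0 {x} {y} x≢0 y≢0 e with ⊗-zero-divisor x y e
  ... | inj₁ z = x≢0 z
  ... | inj₂ z = y≢0 z

  private
    inverse-of : ∀ x → x ≢ 0F → ∃ λ y → x ⊗ y ≡ 1F
    inverse-of x x≢0 = bez (coprime-Bézout (prime⇒coprime p-prime {{≢-nonZero r≢0}} (rep<p x)))
      where
      r≢0 : rep x ≢ 0
      r≢0 e = x≢0 (trans (sym (ι-rep x)) (cong ι e))
      p≡0 : ι p ≡ 0F
      p≡0 = ι-≡ (trans (n%n≡0 p) (sym 0%p≡0))
      kp : ∀ k → ι (k * p) ≡ 0F
      kp k = trans (ι-* k p) (trans (cong (ι k ⊗_) p≡0) (⊗-zeroʳ _))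
      kx : ∀ k → ι (k * rep x) ≡ ι k ⊗ x
      kx k = trans (ι-* k _) (cong (ι k ⊗_) (ι-rep x))
      bez : Bézout.Identity 1 p (rep x) → ∃ λ y → x ⊗ y ≡ 1F
      bez (Bézout.+- a b e) = ⊖ ι b , (begin
        x ⊗ ⊖ ι b                        ≡⟨ S.solve 2 (λ x b → x S.:* (S.:- b) S.:= S.con (ℤ.+ 1) S.:- (S.con (ℤ.+ 1) S.:+ b S.:* x)) refl x (ι b) ⟩
        1F ⊕ ⊖ (1F ⊕ ι b ⊗ x)            ≡⟨ cong (λ w → 1F ⊕ ⊖ w) (trans (cong (1F ⊕_) (sym (kx b))) (trans (sym (ι-+ 1 _)) (trans (cong ι e) (kp a)))) ⟩
        1F ⊕ ⊖ 0F                        ≡⟨ trans (cong (1F ⊕_) -0#≈0#) (⊕-identityʳ _) ⟩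
        1F ∎)
        where open ≡-Reasoning
      bez (Bézout.-+ a b e) = ι b , (begin
        x ⊗ ι b            ≡⟨ ⊗-comm _ _ ⟩
        ι b ⊗ x            ≡⟨ sym (kx b) ⟩
        ι (b * rep x)      ≡⟨ cong ι (sym e) ⟩
        ι (1 + a * p)      ≡⟨ ι-+ 1 _ ⟩
        1F ⊕ ι (a * p)     ≡⟨ trans (cong (1F ⊕_) (kp a)) (⊕-identityʳ _) ⟩
        1F ∎)
        where open ≡-Reasoning

  abstract
    -- Total, with the default `inv 0F = 0F`. A sum of fractions therefore has values at its poles
    -- too, and these points are counted apart from the zeros of the numerator.
    inv : F → F
    inv x with x ≟F 0F
    ... | yes _   = 0F
    ... | no x≢0  = proj₁ (inverse-of x x≢0)

    inv-right : ∀ {x} → x ≢ 0F → x ⊗ inv x ≡ 1F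
    inv-right {x} x≢0 with x ≟F 0F
    ... | yes e    = contradiction e x≢0
    ... | no x≢0′  = proj₂ (inverse-of x x≢0′)

  inv-≢0 : ∀ {x} → x ≢ 0F → inv x ≢ 0F
  inv-≢0 {x} x≢0 e = 1≢0 (trans (sym (inv-right x≢0)) (trans (cong (x ⊗_) e) (⊗-zeroʳ x)))

  ⊗-cancelˡ : ∀ {x y z} → x ≢ 0F → x ⊗ y ≡ x ⊗ z → y ≡ z
  ⊗-cancelˡ {x} {y} {z} x≢0 e with ⊗-zero-divisor x (y ⊝ z)
    (trans (S.solve 3 (λ x y z → x S.:* (y S.:- z) S.:= x S.:* y S.:- x S.:* z) refl x y z) (trans (cong (_⊝ (x ⊗ z)) e) (x⊝x≡0 _)))
  ... | inj₁ z₀ = contradiction z₀ x≢0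
  ... | inj₂ z₀ = ⊝≡0⇒≡ y z z₀

  inv-unique : ∀ {x y} → x ≢ 0F → x ⊗ y ≡ 1F → y ≡ inv x
  inv-unique x≢0 e = ⊗-cancelˡ x≢0 (trans e (sym (inv-right x≢0)))

  inv-⊗ : ∀ {x y} → x ≢ 0F → y ≢ 0F → inv (x ⊗ y) ≡ inv x ⊗ inv y
  inv-⊗ {x} {y} x≢0 y≢0 = sym (inv-unique (⊗-≢0 x≢0 y≢0) (begin
    x ⊗ y ⊗ (inv x ⊗ inv y)       ≡⟨ S.solve 4 (λ x y a b → x S.:* y S.:* (a S.:* b) S.:= (x S.:* a) S.:* (y S.:* b)) refl x y (inv x) (inv y) ⟩
    (x ⊗ inv x) ⊗ (y ⊗ inv y)     ≡⟨ cong₂ _⊗_ (inv-right x≢0) (inv-right y≢0) ⟩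
    1F ⊗ 1F                       ≡⟨ ⊗-identityˡ 1F ⟩
    1F ∎))
    where open ≡-Reasoning

  elems : List F
  elems = map ι (rng p)

  elems-enum : Enumeration _≟F_ elems
  elems-enum x = trans (∑-map ι (rng p) _) (trans (≤-antisym
      (∑-rng-mono p λ i i<p → ⟦⟧-mono (ι i ≟F x) (i ≟ rep x) λ e → trans (sym (m<n⇒m%n≡m i<p)) (trans (sym (rep-ι i)) (cong rep e)))
      (∑-mono (rng p) λ i → ⟦⟧-mono (i ≟ rep x) (ι i ≟F x) λ { refl → ι-rep x }))
    (∑-rng-≟< p (rep x) (rep<p x)))

  length-elems : length elems ≡ p
  length-elems = trans (length-as-∑ elems) (trans (∑-map ι (rng p) _) (trans (sym (length-as-∑ (rng p))) (length-rng p)))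

  ∑F-const : ∀ c → ∑ elems (λ _ → c) ≡ p * c
  ∑F-const c = trans (∑-const elems c) (cong (_* c) length-elems)

-- Words that index sums of fractions.

fins : ∀ n → List (Fin n)
fins zero    = []
fins (suc n) = zero ∷ map suc (fins n)

length-fins : ∀ n → length (fins n) ≡ n
length-fins zero    = refl
length-fins (suc n) = cong suc (trans (length-map suc (fins n)) (length-fins n))

fins-atMostOnce : ∀ n → AtMostOnce Finₚ._≟_ (fins n)
fins-atMostOnce (suc n) zero = ≤-reflexive (cong suc (trans (∑-map suc (fins n) _) (∑-zero (fins n) λ _ → refl)))
fins-atMostOnce (suc n) (suc a) = ≤-trans (≤-reflexive (∑-map suc (fins n) _))
  (≤-trans (∑-mono (fins n) λ x → ⟦⟧-mono (suc x Finₚ.≟ suc a) (x Finₚ.≟ a) Finₚ.suc-injective) (fins-atMostOnce n a))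

-- A numerator out of m and a pole offset out of V. The second range uses V = 1 (only numerators
-- vary), the third m = 1 (only poles vary).
Entry : ℕ → ℕ → Set
Entry m V = Fin m × Fin V

infix 4 _≟E_ _≟W_

_≟E_ : ∀ {m V} → DecidableEquality (Entry m V)
_≟E_ = Prodₚ.≡-dec Finₚ._≟_ Finₚ._≟_

_≟W_ : ∀ {m V k} → DecidableEquality (Vec (Entry m V) k)
_≟W_ = Vecₚ.≡-dec _≟E_

entries : ∀ m V → List (Entry m V)
entries m V = cart (fins m) (fins V)

entries-atMostOnce : ∀ m V → AtMostOnce _≟E_ (entries m V)
entries-atMostOnce m V (a , b) = begin
  ∑ (entries m V) (λ e → ⟦ e ≟E (a , b) ⟧)                                  ≡⟨ ∑-cart (fins m) (fins V) _ ⟩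
  ∑ (fins m) (λ x → ∑ (fins V) (λ y → ⟦ (x , y) ≟E (a , b) ⟧))              ≤⟨ ∑-mono (fins m) (λ x → ∑-mono (fins V) (λ y → split x y)) ⟩
  ∑ (fins m) (λ x → ∑ (fins V) (λ y → ⟦ x Finₚ.≟ a ⟧ * ⟦ y Finₚ.≟ b ⟧))     ≡⟨ ∑-cong (fins m) (λ x → ∑-*ˡ (fins V) ⟦ x Finₚ.≟ a ⟧ _) ⟩
  ∑ (fins m) (λ x → ⟦ x Finₚ.≟ a ⟧ * ∑ (fins V) (λ y → ⟦ y Finₚ.≟ b ⟧))     ≤⟨ ∑-mono (fins m) (λ x → *-monoʳ-≤ ⟦ x Finₚ.≟ a ⟧ (fins-atMostOnce V b)) ⟩
  ∑ (fins m) (λ x → ⟦ x Finₚ.≟ a ⟧ * 1)                                     ≡⟨ ∑-cong (fins m) (λ x → *-identityʳ _) ⟩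
  ∑ (fins m) (λ x → ⟦ x Finₚ.≟ a ⟧)                                         ≤⟨ fins-atMostOnce m a ⟩
  1 ∎
  where
  open ≤-Reasoning
  split : ∀ x y → ⟦ (x , y) ≟E (a , b) ⟧ ≤ ⟦ x Finₚ.≟ a ⟧ * ⟦ y Finₚ.≟ b ⟧
  split x y with (x , y) ≟E (a , b)
  ... | no _  = z≤n
  ... | yes e = ≤-reflexive (sym (cong₂ _*_ (⟦⟧-true (x Finₚ.≟ a) (cong proj₁ e)) (⟦⟧-true (y Finₚ.≟ b) (cong proj₂ e))))

words : ∀ m V k → List (Vec (Entry m V) k)
words m V k = vecs (entries m V) k

words-atMostOnce : ∀ m V k → AtMostOnce _≟W_ (words m V k)
words-atMostOnce m V k = vecs-atMostOnce _≟E_ (entries-atMostOnce m V) k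

length-words : ∀ m V k → length (words m V k) ≡ (m * V) ^ k
length-words m V k = trans (length-vecs (entries m V) k) (cong (_^ k)
  (trans (length-as-∑ (entries m V)) (trans (∑-cart (fins m) (fins V) _) (trans (∑-cong (fins m) λ _ → sym (length-as-∑ (fins V)))
  (trans (∑-const (fins m) _) (cong₂ _*_ (length-fins m) (length-fins V)))))))

-- Zeros of polynomials and of sums of partial fractions.

module RationalFunctions (p : ℕ) (p-prime : Prime p) where
  open PrimeField p p-prime

  -- Polynomials with fewer than n coefficients, in Horner form.
  IsPoly : ℕ → (F → F) → Set
  IsPoly zero    f = ∀ x → f x ≡ 0F
  IsPoly (suc n) f = Σ (F → F) λ g → Σ F λ a → IsPoly n g × (∀ x → f x ≡ x ⊗ g x ⊕ a)

  poly-cong : ∀ n {f g} → (∀ x → g x ≡ f x) → IsPoly n f → IsPoly n g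
  poly-cong zero    e h = λ x → trans (e x) (h x)
  poly-cong (suc n) e (g , a , hg , hf) = g , a , hg , λ x → trans (e x) (hf x)

  poly-weaken : ∀ n {f} → IsPoly n f → IsPoly (suc n) f
  poly-weaken zero    h = (λ _ → 0F) , 0F , (λ _ → refl) , λ x → trans (h x) (sym (trans (⊕-identityʳ _) (⊗-zeroʳ x)))
  poly-weaken (suc n) (g , a , hg , hf) = g , a , poly-weaken n hg , hf

  poly-+ : ∀ n {f g} → IsPoly n f → IsPoly n g → IsPoly n (λ x → f x ⊕ g x)
  poly-+ zero    hf hg = λ x → trans (cong₂ _⊕_ (hf x) (hg x)) (⊕-identityˡ 0F)
  poly-+ (suc n) (f′ , a , hf′ , hf) (g′ , b , hg′ , hg) = (λ x → f′ x ⊕ g′ x) , a ⊕ b , poly-+ n hf′ hg′ ,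
    λ x → trans (cong₂ _⊕_ (hf x) (hg x))
      (S.solve 5 (λ x f a g b → (x S.:* f S.:+ a) S.:+ (x S.:* g S.:+ b) S.:= x S.:* (f S.:+ g) S.:+ (a S.:+ b)) refl x (f′ x) a (g′ x) b)

  poly-scale : ∀ n {f} c → IsPoly n f → IsPoly n (λ x → c ⊗ f x)
  poly-scale zero    c hf = λ x → trans (cong (c ⊗_) (hf x)) (⊗-zeroʳ c)
  poly-scale (suc n) c (f′ , a , hf′ , hf) = (λ x → c ⊗ f′ x) , c ⊗ a , poly-scale n c hf′ ,
    λ x → trans (cong (c ⊗_) (hf x)) (S.solve 4 (λ x c f a → c S.:* (x S.:* f S.:+ a) S.:= x S.:* (c S.:* f) S.:+ c S.:* a) refl x c (f′ x) a)

  poly-linear : ∀ n {f} v → IsPoly n f → IsPoly (suc n) (λ x → (x ⊕ v) ⊗ f x)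
  poly-linear n {f} v hf = poly-cong (suc n)
    (λ x → S.solve 3 (λ x v f → (x S.:+ v) S.:* f S.:= x S.:* f S.:+ v S.:* f) refl x v (f x))
    (poly-+ (suc n) (f , 0F , hf , λ x → sym (⊕-identityʳ _)) (poly-weaken n (poly-scale n v hf)))

  poly-divide : ∀ n {f} → IsPoly (suc n) f → ∀ r → Σ (F → F) λ h → IsPoly n h × (∀ x → f x ≡ (x ⊝ r) ⊗ h x ⊕ f r)
  poly-divide zero {f} (g , a , hg , hf) r = (λ _ → 0F) , (λ _ → refl) , λ x → trans (const x) (sym (trans (cong₂ _⊕_ (⊗-zeroʳ _) (const r)) (⊕-identityˡ a)))
    where
    const : ∀ x → f x ≡ a
    const x = trans (hf x) (trans (cong (λ w → x ⊗ w ⊕ a) (hg x)) (trans (cong (_⊕ a) (⊗-zeroʳ x)) (⊕-identityˡ a)))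
  poly-divide (suc n) {f} (g , a , hg , hf) r with poly-divide n hg r
  ... | h , hh , eq = (λ x → g x ⊕ r ⊗ h x) , poly-+ (suc n) hg (poly-weaken n (poly-scale n r hh)) , λ x → begin
    f x                                                     ≡⟨ hf x ⟩
    x ⊗ g x ⊕ a                                             ≡⟨ S.solve 4 (λ x r g a → x S.:* g S.:+ a S.:= (x S.:- r) S.:* g S.:+ r S.:* g S.:+ a) refl x r (g x) a ⟩
    (x ⊝ r) ⊗ g x ⊕ r ⊗ g x ⊕ a                             ≡⟨ cong (λ w → (x ⊝ r) ⊗ g x ⊕ r ⊗ w ⊕ a) (eq x) ⟩
    (x ⊝ r) ⊗ g x ⊕ r ⊗ ((x ⊝ r) ⊗ h x ⊕ g r) ⊕ a           ≡⟨ S.solve 6 (λ x r g h k a → (x S.:- r) S.:* g S.:+ r S.:* ((x S.:- r) S.:* h S.:+ k) S.:+ a S.:= (x S.:- r) S.:* (g S.:+ r S.:* h) S.:+ (r S.:* k S.:+ a)) refl x r (g x) (h x) (g r) a ⟩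
    (x ⊝ r) ⊗ (g x ⊕ r ⊗ h x) ⊕ (r ⊗ g r ⊕ a)               ≡⟨ cong ((x ⊝ r) ⊗ (g x ⊕ r ⊗ h x) ⊕_) (sym (hf r)) ⟩
    (x ⊝ r) ⊗ (g x ⊕ r ⊗ h x) ⊕ f r ∎
    where open ≡-Reasoning

  -- Nonvanishing at one point `w` takes the place of a nonzero coefficient: it passes to the
  -- quotient by x - r, which keeps the induction going.
  poly-roots : ∀ n {f} → IsPoly n f → ∀ w → f w ≢ 0F → ∑ elems (λ x → ⟦ f x ≟F 0F ⟧) ≤ n
  poly-roots zero    hf w fw≢0 = contradiction (hf w) fw≢0
  poly-roots (suc n) {f} hf w fw≢0 with 1 ≤? ∑ elems (λ x → ⟦ f x ≟F 0F ⟧)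
  ... | no none = ≤-trans (<⇒≤ (≰⇒> none)) (s≤s z≤n)
  ... | yes some with ∑-find elems {g = λ _ → 0} (<-≤-trans (≤-reflexive (cong suc (∑-zero elems λ _ → refl))) some)
  ... | r , fr with poly-divide n hf r
  ... | h , hh , eq = begin
    ∑ elems (λ x → ⟦ f x ≟F 0F ⟧)                               ≤⟨ ∑-mono elems root ⟩
    ∑ elems (λ x → ⟦ x ≟F r ⟧ + ⟦ h x ≟F 0F ⟧)                  ≡⟨ ∑-+ elems _ _ ⟩
    ∑ elems (λ x → ⟦ x ≟F r ⟧) + ∑ elems (λ x → ⟦ h x ≟F 0F ⟧)  ≤⟨ +-mono-≤ (≤-reflexive (elems-enum r)) (poly-roots n hh w hw≢0) ⟩
    suc n ∎
    where
    open ≤-Reasoning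
    fr≡0 : f r ≡ 0F
    fr≡0 = ⟦⟧>0 (f r ≟F 0F) fr
    factor : ∀ x → f x ≡ (x ⊝ r) ⊗ h x
    factor x = trans (eq x) (trans (cong ((x ⊝ r) ⊗ h x ⊕_) fr≡0) (⊕-identityʳ _))
    hw≢0 : h w ≢ 0F
    hw≢0 e = fw≢0 (trans (factor w) (trans (cong ((w ⊝ r) ⊗_) e) (⊗-zeroʳ _)))
    root : ∀ x → ⟦ f x ≟F 0F ⟧ ≤ ⟦ x ≟F r ⟧ + ⟦ h x ≟F 0F ⟧
    root x with f x ≟F 0F
    ... | no _  = z≤n
    ... | yes e with ⊗-zero-divisor _ _ (trans (sym (factor x)) e)
    ... | inj₁ z = ≤-trans (≤-reflexive (sym (⟦⟧-true (x ≟F r) (⊝≡0⇒≡ x r z)))) (m≤m+n _ _)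
    ... | inj₂ z = ≤-trans (≤-reflexive (sym (⟦⟧-true (h x ≟F 0F) z))) (m≤n+m _ _)

  -- (α , v) stands for the partial fraction α / (x + v).
  Fractions : Set
  Fractions = List (F × F)

  fracSum num den : Fractions → F → F
  fracSum []             x = 0F
  fracSum ((α , v) ∷ ts) x = α ⊗ inv (x ⊕ v) ⊕ fracSum ts x
  den []             x = 1F
  den ((α , v) ∷ ts) x = (x ⊕ v) ⊗ den ts x
  num []             x = 0F
  num ((α , v) ∷ ts) x = α ⊗ den ts x ⊕ (x ⊕ v) ⊗ num ts x

  den-poly : ∀ ts → IsPoly (suc (length ts)) (den ts)
  den-poly []             = (λ _ → 0F) , 1F , (λ _ → refl) , λ x → sym (trans (cong (_⊕ 1F) (⊗-zeroʳ x)) (⊕-identityˡ 1F))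
  den-poly ((α , v) ∷ ts) = poly-linear (suc (length ts)) v (den-poly ts)

  num-poly : ∀ ts → IsPoly (length ts) (num ts)
  num-poly []             = λ _ → refl
  num-poly ((α , v) ∷ ts) = poly-+ (suc (length ts)) (poly-scale (suc (length ts)) α (den-poly ts)) (poly-linear (length ts) v (num-poly ts))

  fracSum-num : ∀ ts x → den ts x ≢ 0F → fracSum ts x ⊗ den ts x ≡ num ts x
  fracSum-num []             x d≢0 = ⊗-zeroˡ 1F
  fracSum-num ((α , v) ∷ ts) x d≢0 = begin
    (α ⊗ inv y ⊕ fracSum ts x) ⊗ (y ⊗ den ts x)                        ≡⟨ S.solve 5 (λ α i f y d → (α S.:* i S.:+ f) S.:* (y S.:* d) S.:= α S.:* d S.:* (y S.:* i) S.:+ y S.:* (f S.:* d)) refl α (inv y) (fracSum ts x) y (den ts x) ⟩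
    α ⊗ den ts x ⊗ (y ⊗ inv y) ⊕ y ⊗ (fracSum ts x ⊗ den ts x)         ≡⟨ cong₂ (λ a b → α ⊗ den ts x ⊗ a ⊕ y ⊗ b) (inv-right y≢0) (fracSum-num ts x d′≢0) ⟩
    α ⊗ den ts x ⊗ 1F ⊕ y ⊗ num ts x                                   ≡⟨ cong (_⊕ y ⊗ num ts x) (⊗-identityʳ _) ⟩
    α ⊗ den ts x ⊕ y ⊗ num ts x ∎
    where
    open ≡-Reasoning
    y = x ⊕ v
    y≢0 : y ≢ 0F
    y≢0 e = d≢0 (trans (cong (_⊗ den ts x) e) (⊗-zeroˡ _))
    d′≢0 : den ts x ≢ 0F
    d′≢0 e = d≢0 (trans (cong (y ⊗_) e) (⊗-zeroʳ _))

  x⊕v≡0⇒ : ∀ x v w → x ⊕ v ≡ 0F → x ⊕ w ≡ 0F → v ≡ w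
  x⊕v≡0⇒ x v w e e′ = ⊝≡0⇒≡ v w (trans (S.solve 3 (λ x v w → v S.:- w S.:= (x S.:+ v) S.:- (x S.:+ w)) refl x v w) (trans (cong₂ _⊝_ e e′) (x⊝x≡0 0F)))

  den-≢0 : ∀ ts x → All (λ (_ , v) → x ⊕ v ≢ 0F) ts → den ts x ≢ 0F
  den-≢0 []       x _        = 1≢0
  den-≢0 (_ ∷ ts) x (q ∷ qs) = ⊗-≢0 q (den-≢0 ts x qs)

  poles : ∀ ts → ∑ elems (λ x → ⟦ den ts x ≟F 0F ⟧) ≤ length ts
  poles []             = ≤-reflexive (∑-zero elems λ _ → ⟦⟧-false (1F ≟F 0F) 1≢0)
  poles ((α , v) ∷ ts) = begin
    ∑ elems (λ x → ⟦ (x ⊕ v) ⊗ den ts x ≟F 0F ⟧)                         ≤⟨ ∑-mono elems split ⟩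
    ∑ elems (λ x → ⟦ x ⊕ v ≟F 0F ⟧ + ⟦ den ts x ≟F 0F ⟧)                 ≡⟨ ∑-+ elems _ _ ⟩
    ∑ elems (λ x → ⟦ x ⊕ v ≟F 0F ⟧) + ∑ elems (λ x → ⟦ den ts x ≟F 0F ⟧) ≤⟨ +-mono-≤ (∑-unique _≟F_ {elems} (≤-reflexive ∘ elems-enum) (λ x → x ⊕ v ≟F 0F) one) (poles ts) ⟩
    suc (length ts) ∎
    where
    open ≤-Reasoning
    one : ∀ x y → x ⊕ v ≡ 0F → y ⊕ v ≡ 0F → x ≡ y
    one x y e e′ = x⊕v≡0⇒ v x y (trans (⊕-comm v x) e) (trans (⊕-comm v y) e′)
    split : ∀ x → ⟦ (x ⊕ v) ⊗ den ts x ≟F 0F ⟧ ≤ ⟦ x ⊕ v ≟F 0F ⟧ + ⟦ den ts x ≟F 0F ⟧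
    split x with (x ⊕ v) ⊗ den ts x ≟F 0F
    ... | no _  = z≤n
    ... | yes e with ⊗-zero-divisor _ _ e
    ... | inj₁ z = ≤-trans (≤-reflexive (sym (⟦⟧-true (x ⊕ v ≟F 0F) z))) (m≤m+n _ _)
    ... | inj₂ z = ≤-trans (≤-reflexive (sym (⟦⟧-true (den ts x ≟F 0F) z))) (m≤n+m _ _)

  -- At x = - v the numerator is α times the product of the differences of poles.
  frac-roots : ∀ α v ts → α ≢ 0F → All (λ (_ , w) → w ≢ v) ts →
               ∑ elems (λ x → ⟦ fracSum ((α , v) ∷ ts) x ≟F 0F ⟧) ≤ 2 * suc (length ts)
  frac-roots α v ts α≢0 distinct = begin
    ∑ elems (λ x → ⟦ fracSum ts′ x ≟F 0F ⟧)                                       ≤⟨ ∑-mono elems split ⟩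
    ∑ elems (λ x → ⟦ den ts′ x ≟F 0F ⟧ + ⟦ num ts′ x ≟F 0F ⟧)                      ≡⟨ ∑-+ elems _ _ ⟩
    ∑ elems (λ x → ⟦ den ts′ x ≟F 0F ⟧) + ∑ elems (λ x → ⟦ num ts′ x ≟F 0F ⟧)      ≤⟨ +-mono-≤ (poles ts′) (poly-roots (length ts′) (num-poly ts′) (⊖ v) num≢0) ⟩
    suc (length ts) + suc (length ts)                                             ≡⟨ cong (suc (length ts) +_) (sym (+-identityʳ _)) ⟩
    2 * suc (length ts) ∎
    where
    open ≤-Reasoning
    ts′ = (α , v) ∷ ts
    -v+v : ⊖ v ⊕ v ≡ 0F
    -v+v = trans (⊕-comm _ _) (x⊝x≡0 v)
    num≢0 : num ts′ (⊖ v) ≢ 0F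
    num≢0 e = ⊗-≢0 α≢0 (den-≢0 ts (⊖ v) (All.map (λ {(_ , w)} w≢v z → w≢v (x⊕v≡0⇒ (⊖ v) w v z -v+v)) distinct))
      (trans (sym (trans (cong (λ z → α ⊗ den ts (⊖ v) ⊕ z ⊗ num ts (⊖ v)) -v+v) (trans (cong (α ⊗ den ts (⊖ v) ⊕_) (⊗-zeroˡ _)) (⊕-identityʳ _)))) e)
    split : ∀ x → ⟦ fracSum ts′ x ≟F 0F ⟧ ≤ ⟦ den ts′ x ≟F 0F ⟧ + ⟦ num ts′ x ≟F 0F ⟧
    split x with den ts′ x ≟F 0F
    ... | yes _ = ≤-trans (⟦⟧≤1 (fracSum ts′ x ≟F 0F)) (m≤m+n _ _)
    ... | no d≢0 = ⟦⟧-mono (fracSum ts′ x ≟F 0F) (num ts′ x ≟F 0F) λ e → trans (sym (fracSum-num ts′ x d≢0)) (trans (cong (_⊗ den ts′ x) e) (⊗-zeroˡ _))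

  neg : Fractions → Fractions
  neg = map λ (α , v) → ⊖ α , v

  fracSum-neg : ∀ ts us x → fracSum (ts ++ neg us) x ≡ fracSum ts x ⊝ fracSum us x
  fracSum-neg [] [] x = sym (x⊝x≡0 0F)
  fracSum-neg [] ((α , v) ∷ us) x = trans (cong (⊖ α ⊗ inv (x ⊕ v) ⊕_) (fracSum-neg [] us x))
    (S.solve 4 (λ z α i f → S.:- α S.:* i S.:+ (z S.:- f) S.:= z S.:- (α S.:* i S.:+ f)) refl 0F α (inv (x ⊕ v)) (fracSum us x))
  fracSum-neg ((α , v) ∷ ts) us x = trans (cong (α ⊗ inv (x ⊕ v) ⊕_) (fracSum-neg ts us x))
    (S.solve 3 (λ a f g → a S.:+ (f S.:- g) S.:= (a S.:+ f) S.:- g) refl (α ⊗ inv (x ⊕ v)) (fracSum ts x) (fracSum us x))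

  -- The word ((x₀,t₀),(x₁,t₁),…) stands for Σᵢ (xᵢ+1) / (c + s + iV + tᵢ).
  terms : ∀ {m V k} → ℕ → Vec (Entry m V) k → Fractions
  terms         s []            = []
  terms {V = V} s ((x , t) ∷ w) = (ι (suc (toℕ x)) , ι (s + toℕ t)) ∷ terms (s + V) w

  length-terms : ∀ {m V k} s (w : Vec (Entry m V) k) → length (terms s w) ≡ k
  length-terms s []      = refl
  length-terms {V = V} s (_ ∷ w) = cong suc (length-terms (s + V) w)

  terms-poles : ∀ {m V k} s n (w : Vec (Entry m V) k) → n < s → s + k * V ≤ p → All (λ (_ , v) → v ≢ ι n) (terms s w)
  terms-poles s n [] _ _ = []
  terms-poles {V = V} {k = suc k} s n ((x , t) ∷ w) n<s s+kV≤p =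
    (λ e → >⇒≢ (<-≤-trans n<s (m≤m+n s (toℕ t))) (ι-inj (<-≤-trans (+-monoʳ-< s (toℕ<n t)) s+V≤p) (<-≤-trans n<s (≤-trans (m≤m+n s _) s+kV≤p)) e))
    ∷ terms-poles (s + V) n w (<-≤-trans n<s (m≤m+n s V)) (≤-trans (≤-reflexive (+-assoc s V _)) s+kV≤p)
    where
    s+V≤p : s + V ≤ p
    s+V≤p = ≤-trans (+-monoʳ-≤ s (m≤m+n V (k * V))) s+kV≤p

  -- At the first entry where the words differ, the difference of the sums has a pole with nonzero
  -- residue. Later entries cannot cancel it, because each entry owns its own block of V offsets.
  -- There remain at most 2k fractions, each accounting for one pole and one zero of the numerator.
  coincidences : ∀ {m V k} s (w w′ : Vec (Entry m V) k) → m < p → s + k * V ≤ p → w ≢ w′ →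
                 ∑ elems (λ c → ⟦ fracSum (terms s w) c ≟F fracSum (terms s w′) c ⟧) ≤ 4 * k
  coincidences s [] [] _ _ w≢w′ = contradiction refl w≢w′
  coincidences {m} {V} {suc k} s ((x , t) ∷ w) ((x′ , t′) ∷ w′) m<p sk≤p w≢w′ = cases (t Finₚ.≟ t′) (x Finₚ.≟ x′)
    where
    open ≤-Reasoning
    sk≤p′ : s + V + k * V ≤ p
    sk≤p′ = ≤-trans (≤-reflexive (+-assoc s V _)) sk≤p
    s+t< : ∀ (t : Fin V) → s + toℕ t < s + V
    s+t< t = +-monoʳ-< s (toℕ<n t)
    s+t<p : ∀ (t : Fin V) → s + toℕ t < p
    s+t<p t = <-≤-trans (s+t< t) (≤-trans (m≤m+n (s + V) _) sk≤p′)
    ts us : Fractions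
    ts = terms (s + V) w
    us = terms (s + V) w′
    α≢0 : ∀ (x : Fin m) → ι (suc (toℕ x)) ≢ 0F
    α≢0 x = ι≢0 (s≤s z≤n) (≤-<-trans (toℕ<n x) m<p)
    neg-poles : ∀ {P : F → Set} {us} → All (λ (_ , v) → P v) us → All (λ (_ , v) → P v) (neg us)
    neg-poles []       = []
    neg-poles (q ∷ qs) = q ∷ neg-poles qs
    far : ∀ t → All (λ (_ , v) → v ≢ ι (s + toℕ t)) (ts ++ neg us)
    far t = ++⁺ (terms-poles (s + V) _ w (s+t< t) sk≤p′) (neg-poles (terms-poles (s + V) _ w′ (s+t< t) sk≤p′))
    len : length (ts ++ neg us) ≡ k + k
    len = trans (length-++ ts) (cong₂ _+_ (length-terms (s + V) w) (trans (length-map _ us) (length-terms (s + V) w′)))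
    2[1+2k]≤ : 2 * suc (suc (k + k)) ≤ 4 * suc k
    2[1+2k]≤ = ≤-reflexive (identity k)
      where
      identity : ∀ k → 2 * suc (suc (k + k)) ≡ 4 * suc k
      identity = solve-∀
    cases : Dec (t ≡ t′) → Dec (x ≡ x′) → _
    cases (yes refl) (yes refl) = begin
      ∑ elems (λ c → ⟦ fracSum (terms s ((x , t) ∷ w)) c ≟F fracSum (terms s ((x , t) ∷ w′)) c ⟧) ≤⟨ ∑-mono elems (λ c → ⟦⟧-mono (_ ≟F _) (_ ≟F _) (cancel c)) ⟩
      ∑ elems (λ c → ⟦ fracSum ts c ≟F fracSum us c ⟧)    ≤⟨ coincidences (s + V) w w′ m<p sk≤p′ (λ { refl → w≢w′ refl }) ⟩
      4 * k                                                         ≤⟨ *-monoʳ-≤ 4 (n≤1+n k) ⟩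
      4 * suc k ∎
      where
      cancel : ∀ c {a} → a ⊕ fracSum ts c ≡ a ⊕ fracSum us c → fracSum ts c ≡ fracSum us c
      cancel c {a} e = ⊝≡0⇒≡ _ _ (trans (S.solve 3 (λ a f g → f S.:- g S.:= (a S.:+ f) S.:- (a S.:+ g)) refl a (fracSum ts c) (fracSum us c)) (trans (cong (_⊝ (a ⊕ fracSum us c)) e) (x⊝x≡0 _)))
    cases (yes refl) (no x≢x′) = begin
      ∑ elems (λ c → ⟦ fracSum (terms s ((x , t) ∷ w)) c ≟F fracSum (terms s ((x′ , t) ∷ w′)) c ⟧) ≤⟨ ∑-mono elems (λ c → ⟦⟧-mono (_ ≟F _) (_ ≟F _) (differ c)) ⟩
      ∑ elems (λ c → ⟦ fracSum ((α , ι (s + toℕ t)) ∷ ts ++ neg us) c ≟F 0F ⟧)  ≤⟨ frac-roots α (ι (s + toℕ t)) (ts ++ neg us) diff≢0 (far t) ⟩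
      2 * suc (length (ts ++ neg us))                                                    ≡⟨ cong (λ l → 2 * suc l) len ⟩
      2 * suc (k + k)                                                                    ≤⟨ *-monoʳ-≤ 2 (n≤1+n (suc (k + k))) ⟩
      2 * suc (suc (k + k))                                                              ≤⟨ 2[1+2k]≤ ⟩
      4 * suc k ∎
      where
      α = ι (suc (toℕ x)) ⊝ ι (suc (toℕ x′))
      diff≢0 : α ≢ 0F
      diff≢0 e = x≢x′ (toℕ-injective (suc-injective (ι-inj (≤-<-trans (toℕ<n x) m<p) (≤-<-trans (toℕ<n x′) m<p) (⊝≡0⇒≡ _ _ e))))
      differ : ∀ c → fracSum (terms s ((x , t) ∷ w)) c ≡ fracSum (terms s ((x′ , t) ∷ w′)) c →
               fracSum ((α , ι (s + toℕ t)) ∷ ts ++ neg us) c ≡ 0F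
      differ c e = trans (cong (α ⊗ inv (c ⊕ ι (s + toℕ t)) ⊕_) (fracSum-neg ts us c))
        (trans (S.solve 5 (λ a b i f g → (a S.:- b) S.:* i S.:+ (f S.:- g) S.:= (a S.:* i S.:+ f) S.:- (b S.:* i S.:+ g)) refl
                 (ι (suc (toℕ x))) (ι (suc (toℕ x′))) (inv (c ⊕ ι (s + toℕ t))) (fracSum ts c) (fracSum us c))
          (trans (cong (_⊝ fracSum (terms s ((x′ , t) ∷ w′)) c) e) (x⊝x≡0 _)))
    cases (no t≢t′) _ = begin
      ∑ elems (λ c → ⟦ fracSum (terms s ((x , t) ∷ w)) c ≟F fracSum (terms s ((x′ , t′) ∷ w′)) c ⟧) ≤⟨ ∑-mono elems (λ c → ⟦⟧-mono (_ ≟F _) (_ ≟F _) (differ c)) ⟩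
      ∑ elems (λ c → ⟦ fracSum ((α , v) ∷ (⊖ α′ , v′) ∷ ts ++ neg us) c ≟F 0F ⟧)  ≤⟨ frac-roots α v ((⊖ α′ , v′) ∷ ts ++ neg us) (α≢0 x) (v′≢v ∷ far t) ⟩
      2 * suc (suc (length (ts ++ neg us)))                                               ≡⟨ cong (λ l → 2 * suc (suc l)) len ⟩
      2 * suc (suc (k + k))                                                               ≤⟨ 2[1+2k]≤ ⟩
      4 * suc k ∎
      where
      α  = ι (suc (toℕ x))
      α′ = ι (suc (toℕ x′))
      v  = ι (s + toℕ t)
      v′ = ι (s + toℕ t′)
      v′≢v : v′ ≢ v
      v′≢v e = t≢t′ (toℕ-injective (sym (+-cancelˡ-≡ s _ _ (ι-inj (s+t<p t′) (s+t<p t) e))))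
      differ : ∀ c → fracSum (terms s ((x , t) ∷ w)) c ≡ fracSum (terms s ((x′ , t′) ∷ w′)) c →
               fracSum ((α , v) ∷ (⊖ α′ , v′) ∷ ts ++ neg us) c ≡ 0F
      differ c e = trans (cong (λ z → α ⊗ inv (c ⊕ v) ⊕ (⊖ α′ ⊗ inv (c ⊕ v′) ⊕ z)) (fracSum-neg ts us c))
        (trans (S.solve 6 (λ a i b j f g → a S.:* i S.:+ (S.:- b S.:* j S.:+ (f S.:- g)) S.:= (a S.:* i S.:+ f) S.:- (b S.:* j S.:+ g)) refl
                 α (inv (c ⊕ v)) α′ (inv (c ⊕ v′)) (fracSum ts c) (fracSum us c))
          (trans (cong (_⊝ fracSum (terms s ((x′ , t′) ∷ w′)) c) e) (x⊝x≡0 _)))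

-- Tail sums, sums of inverse squares, and gaps in sets of integers.

*≤⇒≤/ : ∀ m n o .{{_ : NonZero n}} → m * n ≤ o → m ≤ o / n
*≤⇒≤/ m n o le = ≤-trans (≤-reflexive (sym (m*n/n≡m m n))) (/-monoˡ-≤ n le)

∑-rng-member : ∀ n (f : ℕ → ℕ) {i} → i < n → f i ≤ ∑ (rng n) f
∑-rng-member (suc n) f {i} i<1+n with i ≟ n
... | yes refl = m≤m+n _ _
... | no i≢n   = ≤-trans (∑-rng-member n f (≤∧≢⇒< (m<1+n⇒m≤n i<1+n) i≢n)) (m≤n+m _ _)

∑-rng-const : ∀ n c → ∑ (rng n) (λ _ → c) ≡ n * c
∑-rng-const n c = trans (∑-const (rng n) c) (cong (_* c) (length-rng n))

-- Layer-cake decomposition: the excess of v over a is the number of thresholds a + i below v.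
∑-rng-tail : ∀ a n v → v ≤ a + n → v ≤ a + ∑ (rng n) (λ i → ⟦ a + i <? v ⟧)
∑-rng-tail a zero    v v≤ = v≤
∑-rng-tail a (suc n) v v≤ with v ≤? a + n
... | yes q = ≤-trans (∑-rng-tail a n v q) (+-monoʳ-≤ a (m≤n+m _ _))
... | no ¬q = begin
  v                                                               ≤⟨ v≤ ⟩
  a + suc n                                                       ≡⟨ +-suc a n ⟩
  suc (a + n)                                                     ≤⟨ s≤s (∑-rng-tail a n (a + n) ≤-refl) ⟩
  suc (a + ∑ (rng n) (λ i → ⟦ a + i <? a + n ⟧))                  ≡⟨ sym (+-suc a _) ⟩
  a + suc (∑ (rng n) (λ i → ⟦ a + i <? a + n ⟧))                  ≤⟨ +-monoʳ-≤ a (+-mono-≤ (≤-reflexive (sym (⟦⟧-true (a + n <? v) (≰⇒> ¬q))))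
                                                                       (∑-mono (rng n) λ i → ⟦⟧-mono (a + i <? a + n) (a + i <? v) λ lt → <-trans lt (≰⇒> ¬q))) ⟩
  a + ∑ (rng (suc n)) (λ i → ⟦ a + i <? v ⟧) ∎
  where open ≤-Reasoning

double-sum-member : ∀ m n (f : ℕ → ℕ → ℕ) {i j} → i < m → j < n → f i j ≤ ∑ (rng m) (λ i → ∑ (rng n) (f i))
double-sum-member m n f {i} i<m j<n = ≤-trans (∑-rng-member n (f i) j<n) (∑-rng-member m (λ i → ∑ (rng n) (f i)) i<m)

triple-count : {A : Set} (xs : List A) (m n b : ℕ) (f : ℕ → ℕ → A → ℕ) → (∀ i j → i < m → ∑ xs (f i j) ≤ b) →
               ∑ xs (λ x → ∑ (rng m) (λ i → ∑ (rng n) (λ j → f i j x))) ≤ m * (n * b)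
triple-count xs m n b f h = begin
  ∑ xs (λ x → ∑ (rng m) (λ i → ∑ (rng n) (λ j → f i j x)))     ≡⟨ ∑-swap xs (rng m) (λ x i → ∑ (rng n) (λ j → f i j x)) ⟩
  ∑ (rng m) (λ i → ∑ xs (λ x → ∑ (rng n) (λ j → f i j x)))     ≡⟨ ∑-cong (rng m) (λ i → ∑-swap xs (rng n) (λ x j → f i j x)) ⟩
  ∑ (rng m) (λ i → ∑ (rng n) (λ j → ∑ xs (f i j)))             ≤⟨ ∑-rng-mono m (λ i i<m → ∑-mono (rng n) λ j → h i j i<m) ⟩
  ∑ (rng m) (λ i → ∑ (rng n) (λ j → b))                        ≡⟨ trans (∑-cong (rng m) λ _ → ∑-rng-const n b) (∑-rng-const m (n * b)) ⟩
  m * (n * b) ∎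
  where open ≤-Reasoning

-- Σ_{j<i} A/(7+j)² ≤ A (1/6 - 1/(6+i)), with denominators cleared.
inverse-squares : ∀ (T : ℕ → ℕ) A → (∀ i → T i * ((7 + i) * (7 + i)) ≤ A) →
                  ∀ i → ∑ (rng i) T * (6 * (6 + i)) ≤ A * i
inverse-squares T A bound zero    = z≤n
inverse-squares T A bound (suc i) = *-cancelˡ-≤ (6 + i) (begin
  (6 + i) * ((T i + S) * (6 * (6 + suc i)))                     ≡⟨ expand i (T i) S ⟩
  S * (6 * (6 + i)) * (7 + i) + T i * (6 * ((6 + i) * (7 + i)))  ≤⟨ +-mono-≤ (*-monoˡ-≤ (7 + i) (inverse-squares T A bound i))
                                                                    (*-monoʳ-≤ (T i) (*-monoʳ-≤ 6 (*-monoˡ-≤ (7 + i) (n≤1+n (6 + i))))) ⟩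
  A * i * (7 + i) + T i * (6 * ((7 + i) * (7 + i)))              ≡⟨ cong (A * i * (7 + i) +_) (pull (T i) ((7 + i) * (7 + i))) ⟩
  A * i * (7 + i) + 6 * (T i * ((7 + i) * (7 + i)))              ≤⟨ +-monoʳ-≤ (A * i * (7 + i)) (*-monoʳ-≤ 6 (bound i)) ⟩
  A * i * (7 + i) + 6 * A                                        ≡⟨ collect A i ⟩
  (6 + i) * (A * suc i) ∎)
  where
  open ≤-Reasoning
  S = ∑ (rng i) T
  expand : ∀ i t s → (6 + i) * ((t + s) * (6 * (6 + suc i))) ≡ s * (6 * (6 + i)) * (7 + i) + t * (6 * ((6 + i) * (7 + i)))
  expand = solve-∀
  pull : ∀ t q → t * (6 * q) ≡ 6 * (t * q)
  pull = solve-∀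
  collect : ∀ A i → A * i * (7 + i) + 6 * A ≡ (6 + i) * (A * suc i)
  collect = solve-∀

record ShortGap (P : ℕ → Set) (n k : ℕ) : Set where
  constructor shortGap
  field
    lo width x gap : ℕ
    P-lo : P lo
    P-hi : P (lo + width)
    P-x : P x
    P-x+gap : P (x + gap)
    hi<n : lo + width < n
    gap>0 : 0 < gap
    k*gap≤ : k * gap ≤ width

topmost : ∀ {P : ℕ → Set} (P? : Decidable P) n k → suc k ≤ ∑ (rng n) (λ i → ⟦ P? i ⟧) →
          ∃ λ h → h < n × P h × k ≤ ∑ (rng h) (λ i → ⟦ P? i ⟧)
topmost P? (suc n) k le with P? n
... | yes Pn = n , ≤-refl , Pn , s≤s⁻¹ le
... | no _ with topmost P? n k le
... | h , h<n , Ph , rest = h , m<n⇒m<1+n h<n , Ph , rest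

-- The `suc (suc k)` points have `suc k` consecutive gaps, and the least gap is at most the average.
-- Points are peeled off from the top; the recorded gap is replaced whenever the gap below the new
-- top is smaller.
short-gap : ∀ {P : ℕ → Set} (P? : Decidable P) n k → suc (suc k) ≤ ∑ (rng n) (λ i → ⟦ P? i ⟧) → ShortGap P n (suc k)
short-gap {P} P? n k le with topmost P? n (suc k) le
short-gap {P} P? n zero le | h , h<n , Ph , rest with topmost P? h 0 rest
... | l , l<h , Pl , _ = shortGap l (h ∸ l) l (h ∸ l) Pl Ph′ Pl Ph′
      (subst (_< n) (sym l+) h<n) (m<n⇒0<n∸m l<h) (≤-reflexive (*-identityˡ _))
  where
  l+ : l + (h ∸ l) ≡ h
  l+ = m+[n∸m]≡n (<⇒≤ l<h)
  Ph′ : P (l + (h ∸ l))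
  Ph′ = subst P (sym l+) Ph
short-gap {P} P? n (suc k) le | h , h<n , Ph , rest with short-gap P? h k rest
... | shortGap lo width x gap P-lo P-hi P-x P-x+gap hi<h gap>0 k*gap≤ with gap ≤? h ∸ (lo + width)
...   | yes g≤ = shortGap lo (h ∸ lo) x gap P-lo (subst P (sym lo+) Ph) P-x P-x+gap (subst (_< n) (sym lo+) h<n) gap>0
        (≤-trans (+-mono-≤ g≤ k*gap≤) (≤-reflexive (sym split)))
  where
  hi = lo + width
  lo+ : lo + (h ∸ lo) ≡ h
  lo+ = m+[n∸m]≡n (≤-trans (m≤m+n lo width) (<⇒≤ hi<h))
  split : h ∸ lo ≡ h ∸ hi + width
  split = +-cancelˡ-≡ lo _ _ (trans lo+ (trans (sym (m∸n+n≡m (<⇒≤ hi<h))) (trans (+-comm (h ∸ hi) (lo + width)) (trans (+-assoc lo width (h ∸ hi)) (cong (lo +_) (+-comm width (h ∸ hi)))))))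
...   | no g≰ = shortGap lo (h ∸ lo) hi (h ∸ hi) P-lo (subst P (sym lo+) Ph) P-hi (subst P (sym hi+) Ph) (subst (_< n) (sym lo+) h<n) (m<n⇒0<n∸m hi<h)
        (≤-trans (+-monoʳ-≤ (h ∸ hi) (≤-trans (*-monoʳ-≤ (suc k) (<⇒≤ (≰⇒> g≰))) k*gap≤)) (≤-reflexive (sym split)))
  where
  hi = lo + width
  lo+ : lo + (h ∸ lo) ≡ h
  lo+ = m+[n∸m]≡n (≤-trans (m≤m+n lo width) (<⇒≤ hi<h))
  hi+ : hi + (h ∸ hi) ≡ h
  hi+ = m+[n∸m]≡n (<⇒≤ hi<h)
  split : h ∸ lo ≡ h ∸ hi + width
  split = +-cancelˡ-≡ lo _ _ (trans lo+ (trans (sym (m∸n+n≡m (<⇒≤ hi<h))) (trans (+-comm (h ∸ hi) (lo + width)) (trans (+-assoc lo width (h ∸ hi)) (cong (lo +_) (+-comm width (h ∸ hi)))))))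

∣-∣-exchange : ∀ {x y b d} → x + b ≡ y + d → ∣ x - y ∣ ≡ ∣ d - b ∣
∣-∣-exchange {x} {y} {b} {d} e = begin
  ∣ x - y ∣             ≡⟨ sym (∣m+n-m+o∣≡∣n-o∣ b x y) ⟩
  ∣ b + x - b + y ∣     ≡⟨ cong₂ ∣_-_∣ (trans (+-comm b x) e) (+-comm b y) ⟩
  ∣ y + d - y + b ∣     ≡⟨ ∣m+n-m+o∣≡∣n-o∣ y d b ⟩
  ∣ d - b ∣ ∎
  where open ≡-Reasoning

-- A lower bound for the number of distinct ratios y/u.

module Ratios (p : ℕ) (p-prime : Prime p) where
  open PrimeField p p-prime

  module Hits (a N : ℕ) (N<p : N < p) where

    -- Membership of `suc u` times c in the cyclic interval from a is tested on the representative
    -- of the difference, which is at the same time the position of the product in the interval.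
    Hit : F → ℕ → Set
    Hit c u = rep (ι (suc u) ⊗ c ⊝ ι a) < N

    Hit? : ∀ c → Decidable (Hit c)
    Hit? c u = rep (ι (suc u) ⊗ c ⊝ ι a) <? N

    hit-eq : ∀ c u → ι (suc u) ⊗ c ≡ ι (a + rep (ι (suc u) ⊗ c ⊝ ι a))
    hit-eq c u = sym (trans (ι-+ a _) (trans (cong (ι a ⊕_) (ι-rep _)) (S.solve 2 (λ a y → a S.:+ (y S.:- a) S.:= y) refl (ι a) (ι (suc u) ⊗ c))))

    N≤hits : ∀ u → suc u < p → N ≤ ∑ elems (λ c → ⟦ Hit? c u ⟧)
    N≤hits u u<p = begin
      N                                        ≡⟨ sym (trans (∑-rng-const N 1) (*-identityʳ N)) ⟩
      ∑ (rng N) (λ _ → 1)                      ≤⟨ ∑-rng-mono N (λ j j<N → ≤-reflexive (sym (⟦⟧-true (j <? N) j<N))) ⟩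
      ∑ (rng N) (λ j → ⟦ j <? N ⟧)             ≤⟨ ∑-inject _≟F_ (rng N) {elems} elems-enum (_<? N) (λ c → Hit? c u) φ injective hits ⟩
      ∑ elems (λ c → ⟦ Hit? c u ⟧) ∎
      where
      open ≤-Reasoning
      w = ι (suc u)
      w≢0 : w ≢ 0F
      w≢0 = ι≢0 (s≤s z≤n) u<p
      φ : ℕ → F
      φ j = inv w ⊗ (ι a ⊕ ι j)
      wφ : ∀ j → w ⊗ φ j ≡ ι a ⊕ ι j
      wφ j = trans (sym (⊗-assoc w (inv w) _)) (trans (cong (_⊗ (ι a ⊕ ι j)) (inv-right w≢0)) (⊗-identityˡ _))
      wφ-a : ∀ j → w ⊗ φ j ⊝ ι a ≡ ι j
      wφ-a j = trans (cong (_⊝ ι a) (wφ j)) (S.solve 2 (λ a j → (a S.:+ j) S.:- a S.:= j) refl (ι a) (ι j))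
      rep-φ : ∀ j → j < N → rep (w ⊗ φ j ⊝ ι a) ≡ j
      rep-φ j j<N = trans (cong rep (wφ-a j)) (trans (rep-ι j) (m<n⇒m%n≡m (<-trans j<N N<p)))
      hits : ∀ j → j < N → Hit (φ j) u
      hits j j<N = subst (_< N) (sym (rep-φ j j<N)) j<N
      injective : ∀ c → ∑ (rng N) (λ j → ⟦ j <? N ⟧ * ⟦ c ≟F φ j ⟧) ≤ 1
      injective c = ≤-trans (∑-mono (rng N) λ j → at j) (∑-rng-≟≤1 N (rep (w ⊗ c ⊝ ι a)))
        where
        at : ∀ j → ⟦ j <? N ⟧ * ⟦ c ≟F φ j ⟧ ≤ ⟦ j ≟ rep (w ⊗ c ⊝ ι a) ⟧
        at j with j <? N | c ≟F φ j
        ... | no _ | _ = z≤n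
        ... | yes _ | no _ = z≤n
        ... | yes j<N | yes refl = ≤-reflexive (sym (⟦⟧-true (j ≟ _) (sym (rep-φ j j<N))))

  -- The ratios y/u with y ∈ {a,…,a+N-1} and 1 ≤ u ≤ U; u is stored as u - 1.
  module RatioSet (a N U : ℕ) (U≤N : U ≤ N) (0<U : 0 < U) (2UN≤p : 2 * (U * N) ≤ p) (U<p : U < p) where

    N<p : N < p
    N<p = <-≤-trans (m<m+n N {N} (<-≤-trans 0<U U≤N)) (≤-trans (≤-trans (≤-reflexive (cong (N +_) (sym (+-identityʳ N)))) (*-monoʳ-≤ 2 (m≤n*m N U {{>-nonZero 0<U}}))) 2UN≤p)

    open Hits a N N<p public

    ν : F → ℕ
    ν c = ∑ (rng U) (λ u → ⟦ Hit? c u ⟧)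

    Ratio? : Decidable (λ c → 1 ≤ ν c)
    Ratio? c = 1 ≤? ν c

    ratios : ℕ
    ratios = ∑ elems (λ c → ⟦ Ratio? c ⟧)

    ν≤U : ∀ c → ν c ≤ U
    ν≤U c = ≤-trans (∑-mono (rng U) λ u → ⟦⟧≤1 (Hit? c u)) (≤-reflexive (trans (∑-rng-const U 1) (*-identityʳ U)))

    UN≤∑ν : U * N ≤ ∑ elems ν
    UN≤∑ν = ≤-trans (≤-trans (≤-reflexive (sym (∑-rng-const U N))) (∑-rng-mono U (λ u u<U → N≤hits u (≤-<-trans u<U U<p)))) (≤-reflexive (sym (∑-swap elems (rng U) _)))

    tail : ℕ → ℕ
    tail k = ∑ elems (λ c → ⟦ k <? ν c ⟧)

    -- If ν c > k then c = ± s / q with q ≤ U / k and s ≤ N / k.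
    rational : ∀ k c → suc k < ν c → ∃ λ q → ∃ λ s → q < U / suc k × s < suc (N / suc k) ×
               (ι (suc q) ⊗ c ≡ ι s ⊎ ι (suc q) ⊗ c ≡ ⊖ ι s)
    rational k c lt with short-gap (Hit? c) U k lt
    ... | shortGap lo width x gap P-lo P-hi P-x P-x+gap hi<U gap>0 k*gap≤ =
      pred gap , s , <-≤-trans (≤-reflexive gap-eq) q≤ , s≤s s≤ ,
      signed (≤-total j₁ j₂)
      where
      instance
        gap-nonZero : NonZero gap
        gap-nonZero = >-nonZero gap>0
      gap-eq : suc (pred gap) ≡ gap
      gap-eq = suc-pred gap
      j : ℕ → ℕ
      j u = rep (ι (suc u) ⊗ c ⊝ ι a)
      j₁ = j x
      j₂ = j (x + gap)
      J₁ = j lo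
      J₂ = j (lo + width)
      s = ∣ j₂ - j₁ ∣
      difference : ∀ u g → ι g ⊗ c ≡ ι (j (u + g)) ⊝ ι (j u)
      difference u g = begin
        ι g ⊗ c                                          ≡⟨ S.solve 3 (λ g u c → g S.:* c S.:= (u S.:+ g) S.:* c S.:- u S.:* c) refl (ι g) (ι (suc u)) c ⟩
        (ι (suc u) ⊕ ι g) ⊗ c ⊝ ι (suc u) ⊗ c            ≡⟨ cong₂ _⊝_ (trans (cong (_⊗ c) (sym (ι-+ (suc u) g))) (hit-eq c (u + g))) (hit-eq c u) ⟩
        ι (a + j (u + g)) ⊝ ι (a + j u)                  ≡⟨ cong₂ _⊝_ (ι-+ a _) (ι-+ a _) ⟩
        (ι a ⊕ ι (j (u + g))) ⊝ (ι a ⊕ ι (j u))          ≡⟨ S.solve 3 (λ a x y → (a S.:+ x) S.:- (a S.:+ y) S.:= x S.:- y) refl (ι a) _ _ ⟩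
        ι (j (u + g)) ⊝ ι (j u) ∎
        where open ≡-Reasoning
      width<U : width < U
      width<U = ≤-<-trans (m≤n+m width lo) hi<U
      gap≤width : gap ≤ width
      gap≤width = ≤-trans (m≤n*m gap (suc k)) k*gap≤
      width>0 : 0 < width
      width>0 = <-≤-trans gap>0 gap≤width
      -- Eliminates c from gap·c = j₂ - j₁ and width·c = J₂ - J₁. Both sides are below 2UN ≤ p, so
      -- the congruence is an equality of integers, and the difference of the j's is gap/width ≤
      -- 1/(k+1) times that of the J's.
      cross-F : ι (width * j₂ + gap * J₁) ≡ ι (width * j₁ + gap * J₂)
      cross-F = ⊝≡0⇒≡ _ _ (begin
        ι (width * j₂ + gap * J₁) ⊝ ι (width * j₁ + gap * J₂)
          ≡⟨ cong₂ _⊝_ (lin width j₂ gap J₁) (lin width j₁ gap J₂) ⟩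
        (ι width ⊗ ι j₂ ⊕ ι gap ⊗ ι J₁) ⊝ (ι width ⊗ ι j₁ ⊕ ι gap ⊗ ι J₂)
          ≡⟨ S.solve 6 (λ w g a b d e → (w S.:* a S.:+ g S.:* d) S.:- (w S.:* b S.:+ g S.:* e) S.:= w S.:* (a S.:- b) S.:- g S.:* (e S.:- d)) refl (ι width) (ι gap) (ι j₂) (ι j₁) (ι J₁) (ι J₂) ⟩
        ι width ⊗ (ι j₂ ⊝ ι j₁) ⊝ ι gap ⊗ (ι J₂ ⊝ ι J₁)
          ≡⟨ cong₂ (λ y z → ι width ⊗ y ⊝ ι gap ⊗ z) (sym (difference x gap)) (sym (difference lo width)) ⟩
        ι width ⊗ (ι gap ⊗ c) ⊝ ι gap ⊗ (ι width ⊗ c)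
          ≡⟨ S.solve 3 (λ w g c → w S.:* (g S.:* c) S.:- g S.:* (w S.:* c) S.:= S.con (ℤ.+ 0)) refl (ι width) (ι gap) c ⟩
        0F ∎)
        where
        open ≡-Reasoning
        lin : ∀ a b d e → ι (a * b + d * e) ≡ ι a ⊗ ι b ⊕ ι d ⊗ ι e
        lin a b d e = trans (ι-+ _ _) (cong₂ _⊕_ (ι-* a b) (ι-* d e))
      small : ∀ {i i′} → i < N → i′ < N → width * i + gap * i′ < p
      small {i} {i′} i<N i′<N = <-≤-trans (+-mono-<-≤ {width * i} {U * N} (*-mono-< width<U i<N) (*-mono-≤ (<⇒≤ (≤-<-trans gap≤width width<U)) (<⇒≤ i′<N)))
        (≤-trans (≤-reflexive (cong (U * N +_) (sym (+-identityʳ (U * N))))) 2UN≤p)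
      cross : width * j₂ + gap * J₁ ≡ width * j₁ + gap * J₂
      cross = ι-inj (small P-x+gap P-lo) (small P-x P-hi) cross-F
      proportional : width * s ≡ gap * ∣ J₂ - J₁ ∣
      proportional = trans (*-distribˡ-∣-∣ width j₂ j₁) (trans (∣-∣-exchange {width * j₂} {width * j₁} {gap * J₁} {gap * J₂} cross) (sym (*-distribˡ-∣-∣ gap J₂ J₁)))
      J-small : ∣ J₂ - J₁ ∣ ≤ N
      J-small = ≤-trans (∣m-n∣≤m⊔n J₂ J₁) (⊔-lub (<⇒≤ P-hi) (<⇒≤ P-lo))
      s*k≤N : s * suc k ≤ N
      s*k≤N = *-cancelˡ-≤ width {{>-nonZero width>0}} (begin
        width * (s * suc k)             ≡⟨ sym (*-assoc width s (suc k)) ⟩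
        width * s * suc k               ≡⟨ cong (_* suc k) proportional ⟩
        gap * ∣ J₂ - J₁ ∣ * suc k       ≡⟨ rotate gap ∣ J₂ - J₁ ∣ (suc k) ⟩
        suc k * gap * ∣ J₂ - J₁ ∣       ≤⟨ *-mono-≤ k*gap≤ J-small ⟩
        width * N ∎)
        where
        open ≤-Reasoning
        rotate : ∀ g t k → g * t * k ≡ k * g * t
        rotate = solve-∀
      s≤ : s ≤ N / suc k
      s≤ = *≤⇒≤/ s (suc k) N s*k≤N
      q≤ : gap ≤ U / suc k
      q≤ = *≤⇒≤/ gap (suc k) U (≤-trans (≤-reflexive (*-comm gap (suc k))) (≤-trans k*gap≤ (<⇒≤ width<U)))
      signed : j₁ ≤ j₂ ⊎ j₂ ≤ j₁ → ι (suc (pred gap)) ⊗ c ≡ ι s ⊎ ι (suc (pred gap)) ⊗ c ≡ ⊖ ι s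
      signed (inj₁ le) = inj₁ (trans (cong (λ g → ι g ⊗ c) gap-eq) (trans (difference x gap) (sym (begin
        ι s                          ≡⟨ S.solve 2 (λ s j → s S.:= (j S.:+ s) S.:- j) refl (ι s) (ι j₁) ⟩
        (ι j₁ ⊕ ι s) ⊝ ι j₁          ≡⟨ cong (_⊝ ι j₁) (trans (sym (ι-+ j₁ s)) (cong ι (trans (cong (j₁ +_) (m≤n⇒∣n-m∣≡n∸m le)) (m+[n∸m]≡n le)))) ⟩
        ι j₂ ⊝ ι j₁ ∎))))
        where open ≡-Reasoning
      signed (inj₂ le) = inj₂ (trans (cong (λ g → ι g ⊗ c) gap-eq) (trans (difference x gap) (sym (begin
        ⊖ ι s                        ≡⟨ S.solve 2 (λ s j → S.:- s S.:= j S.:- (j S.:+ s)) refl (ι s) (ι j₂) ⟩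
        ι j₂ ⊝ (ι j₂ ⊕ ι s)          ≡⟨ cong (ι j₂ ⊝_) (trans (sym (ι-+ j₂ s)) (cong ι (trans (cong (j₂ +_) (m≤n⇒∣m-n∣≡n∸m le)) (m+[n∸m]≡n le)))) ⟩
        ι j₂ ⊝ ι j₁ ∎))))
        where open ≡-Reasoning

    -- Such a c is determined by the fraction from `rational`: with k for `suc k`, there are U/k
    -- values of q, N/k + 1 of s and two signs. As k ≤ N, the count N/k + 1 is at most 2N/k.
    tail-bound : ∀ k → suc k ≤ N → tail (suc k) * (suc k * suc k) ≤ 4 * (U * N)
    tail-bound k k≤N = begin
      tail (suc k) * (suc k * suc k)                ≤⟨ *-monoˡ-≤ (suc k * suc k) count ⟩
      Q * (suc S′ * 2) * (suc k * suc k)            ≡⟨ regroup Q S′ (suc k) ⟩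
      2 * (Q * suc k * (S′ * suc k + suc k))        ≤⟨ *-monoʳ-≤ 2 (*-mono-≤ (m/n*n≤m U (suc k)) (+-mono-≤ (m/n*n≤m N (suc k)) k≤N)) ⟩
      2 * (U * (N + N))                             ≡⟨ four U N ⟩
      4 * (U * N) ∎
      where
      open ≤-Reasoning
      Q = U / suc k
      S′ = N / suc k
      regroup : ∀ Q S k → Q * (suc S * 2) * (k * k) ≡ 2 * (Q * k * (S * k + k))
      regroup = solve-∀
      four : ∀ U N → 2 * (U * (N + N)) ≡ 4 * (U * N)
      four = solve-∀
      match : ℕ → ℕ → F → ℕ
      match q s c = ⟦ ι (suc q) ⊗ c ≟F ι s ⟧ + ⟦ ι (suc q) ⊗ c ≟F ⊖ ι s ⟧
      one : ∀ c → ⟦ suc k <? ν c ⟧ ≤ ∑ (rng Q) (λ q → ∑ (rng (suc S′)) (λ s → match q s c))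
      one c = indicate (suc k <? ν c) λ lt → found lt (rational k c lt)
        where
        indicate : ∀ {P : Set} {n} (d : Dec P) → (P → 1 ≤ n) → ⟦ d ⟧ ≤ n
        indicate (yes q) h = h q
        indicate (no _)  h = z≤n
        found : suc k < ν c → (∃ λ q → ∃ λ s → q < Q × s < suc S′ × (ι (suc q) ⊗ c ≡ ι s ⊎ ι (suc q) ⊗ c ≡ ⊖ ι s)) →
                1 ≤ ∑ (rng Q) (λ q → ∑ (rng (suc S′)) (λ s → match q s c))
        found _ (q , s , q< , s< , e) = ≤-trans (hit e) (double-sum-member Q (suc S′) (λ q s → match q s c) q< s<)
          where
          hit : ι (suc q) ⊗ c ≡ ι s ⊎ ι (suc q) ⊗ c ≡ ⊖ ι s → 1 ≤ match q s c
          hit (inj₁ e) = ≤-trans (≤-reflexive (sym (⟦⟧-true (ι (suc q) ⊗ c ≟F ι s) e))) (m≤m+n _ _)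
          hit (inj₂ e) = ≤-trans (≤-reflexive (sym (⟦⟧-true (ι (suc q) ⊗ c ≟F ⊖ ι s) e))) (m≤n+m _ _)
      solutions : ∀ q b → q < Q → ∑ elems (λ c → ⟦ ι (suc q) ⊗ c ≟F b ⟧) ≤ 1
      solutions q b q<Q = ∑-unique _≟F_ {elems} (≤-reflexive ∘ elems-enum) (λ c → ι (suc q) ⊗ c ≟F b)
        λ x y ex ey → ⊗-cancelˡ (ι≢0 (s≤s z≤n) (≤-<-trans (≤-trans q<Q (m/n≤m U (suc k))) U<p)) (trans ex (sym ey))
      count : tail (suc k) ≤ Q * (suc S′ * 2)
      count = ≤-trans (∑-mono elems one) (triple-count elems Q (suc S′) 2 match λ q s q<Q →
        ≤-trans (≤-reflexive (∑-+ elems _ _)) (+-mono-≤ (solutions q (ι s) q<Q) (solutions q (⊖ ι s) q<Q)))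

    -- The multiplicities `ν` sum to at least UN. Their first 7 layers contribute at most 7 per
    -- ratio; the further layers, bounded by 4UN/k² for k ≥ 7, sum to at most 4UN/6. Absorbing these
    -- two thirds of UN leaves 3·7 = 21.
    ratios-bound : U * N ≤ 21 * ratios
    ratios-bound = +-cancelʳ-≤ (2 * (U * N)) _ _ (begin
      U * N + 2 * (U * N)                                ≡⟨ refl ⟩
      3 * (U * N)                                        ≤⟨ *-monoʳ-≤ 3 (≤-trans UN≤∑ν layers) ⟩
      3 * (7 * ratios + T)                               ≡⟨ distr ratios T ⟩
      21 * ratios + 3 * T                                ≤⟨ +-monoʳ-≤ (21 * ratios) 3T≤ ⟩
      21 * ratios + 2 * (U * N) ∎)
      where
      open ≤-Reasoning
      distr : ∀ r t → 3 * (7 * r + t) ≡ 21 * r + 3 * t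
      distr = solve-∀
      T′ : ℕ → ℕ
      T′ i = tail (7 + i)
      T = ∑ (rng U) T′
      layer : ∀ c → ν c ≤ 7 * ⟦ Ratio? c ⟧ + ∑ (rng U) (λ i → ⟦ 7 + i <? ν c ⟧)
      layer c with Ratio? c
      ... | yes _ = ∑-rng-tail 7 U (ν c) (≤-trans (ν≤U c) (m≤n+m U 7))
      ... | no ¬q = ≤-trans (<⇒≤pred (≰⇒> ¬q)) z≤n
      layers : ∑ elems ν ≤ 7 * ratios + T
      layers = begin
        ∑ elems ν                                                                            ≤⟨ ∑-mono elems layer ⟩
        ∑ elems (λ c → 7 * ⟦ Ratio? c ⟧ + ∑ (rng U) (λ i → ⟦ 7 + i <? ν c ⟧))                 ≡⟨ ∑-+ elems _ _ ⟩
        ∑ elems (λ c → 7 * ⟦ Ratio? c ⟧) + ∑ elems (λ c → ∑ (rng U) (λ i → ⟦ 7 + i <? ν c ⟧)) ≡⟨ cong₂ _+_ (∑-*ˡ elems 7 _) (∑-swap elems (rng U) _) ⟩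
        7 * ratios + T ∎
      each : ∀ i → T′ i * ((7 + i) * (7 + i)) ≤ 4 * (U * N)
      each i with 7 + i ≤? N
      ... | yes le = tail-bound (6 + i) le
      ... | no gt  = ≤-trans (≤-reflexive (cong (_* ((7 + i) * (7 + i))) (∑-zero elems λ c → ⟦⟧-false (7 + i <? ν c) λ lt → gt (≤-trans (<⇒≤ lt) (≤-trans (ν≤U c) U≤N))))) z≤n
      3T≤ : 3 * T ≤ 2 * (U * N)
      3T≤ = *-cancelˡ-≤ 2 (*-cancelʳ-≤ _ _ (6 + U) (begin
        2 * (3 * T) * (6 + U)         ≡⟨ six T (6 + U) ⟩
        T * (6 * (6 + U))             ≤⟨ inverse-squares T′ (4 * (U * N)) each U ⟩
        4 * (U * N) * U               ≤⟨ *-monoʳ-≤ (4 * (U * N)) (m≤n+m U 6) ⟩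
        4 * (U * N) * (6 + U)         ≡⟨ cong (_* (6 + U)) (four (U * N)) ⟩
        2 * (2 * (U * N)) * (6 + U) ∎))
        where
        six : ∀ T n → 2 * (3 * T) * n ≡ T * (6 * n)
        six = solve-∀
        four : ∀ n → 4 * n ≡ 2 * (2 * n)
        four = solve-∀

∑-positive : {A : Set} (xs : List A) (f : A → ℕ) → 0 < ∑ xs f → ∃ λ x → 0 < f x
∑-positive xs f pos = ∑-find xs {g = λ _ → 0} (<-≤-trans (≤-reflexive (cong suc (∑-zero xs λ _ → refl))) pos)

∑-witness : {A : Set} (xs : List A) {P : A → Set} (P? : Decidable P) → 0 < ∑ xs (λ x → ⟦ P? x ⟧) → ∃ P
∑-witness xs P? pos with ∑-positive xs _ pos
... | x , e = x , ⟦⟧>0 (P? x) e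

∑-rng-witness : ∀ n {P : ℕ → Set} (P? : Decidable P) → 0 < ∑ (rng n) (λ i → ⟦ P? i ⟧) → ∃ λ i → i < n × P i
∑-rng-witness n P? pos with ∑-rng-find n {g = λ _ → 0} (<-≤-trans (≤-reflexive (cong suc (∑-zero (rng n) λ _ → refl))) pos)
... | i , i<n , e = i , i<n , ⟦⟧>0 (P? i) e

∑-another : {A : Set} (_≟A_ : DecidableEquality A) {xs : List A} → AtMostOnce _≟A_ xs → {P : A → Set} (P? : Decidable P) →
            1 < ∑ xs (λ x → ⟦ P? x ⟧) → ∀ a → ∃ λ b → P b × b ≢ a
∑-another _≟A_ {xs} once P? pos a with ∑-find xs {f = λ b → ⟦ P? b ⟧} {g = λ b → ⟦ b ≟A a ⟧} (≤-<-trans (once a) pos)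
... | b , lt = b , ⟦⟧>0 (P? b) (≤-<-trans z≤n lt) , λ e → <⇒≱ lt (≤-trans (⟦⟧≤1 (P? b)) (≤-reflexive (sym (⟦⟧-true (b ≟A a) e))))

-- Additive energy of the value sets, averaged over ratios.

module Energy (p : ℕ) (p-prime : Prime p) (m V k : ℕ) (m<p : m < p) (kV≤p : k * V ≤ p) where
  open PrimeField p p-prime
  open RationalFunctions p p-prime

  Word : Set
  Word = Vec (Entry m V) k

  W : List Word
  W = words m V k

  value : F → Word → F
  value c w = fracSum (terms 0 w) c

  #W : ℕ
  #W = length W

  fibre : F → F → ℕ
  fibre c b = ∑ W (λ w → ⟦ b ≟F value c w ⟧)

  energy : F → ℕ
  energy c = ∑ W (λ w → ∑ W (λ w′ → ⟦ value c w ≟F value c w′ ⟧))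

  Image? : ∀ c → Decidable (λ b → 0 < fibre c b)
  Image? c b = 0 <? fibre c b

  image : F → ℕ
  image c = ∑ elems (λ b → ⟦ Image? c b ⟧)

  image-word : ∀ c b → 0 < fibre c b → ∃ λ w → b ≡ value c w
  image-word c b pos with ∑-positive W _ pos
  ... | w , e = w , ⟦⟧>0 (b ≟F value c w) e

  ∑-fibre : ∀ c (g : F → ℕ) → ∑ elems (λ b → fibre c b * g b) ≡ ∑ W (λ w → g (value c w))
  ∑-fibre c g = begin
    ∑ elems (λ b → fibre c b * g b)                              ≡⟨ ∑-cong elems (λ b → sym (∑-*ʳ W (g b) _)) ⟩
    ∑ elems (λ b → ∑ W (λ w → ⟦ b ≟F value c w ⟧ * g b))         ≡⟨ ∑-swap elems W _ ⟩
    ∑ W (λ w → ∑ elems (λ b → ⟦ b ≟F value c w ⟧ * g b))         ≡⟨ ∑-cong W (λ w → ∑-pick _≟F_ {elems} elems-enum g (value c w)) ⟩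
    ∑ W (λ w → g (value c w)) ∎
    where open ≡-Reasoning

  energy-fibre : ∀ c → energy c ≡ ∑ elems (λ b → fibre c b * fibre c b)
  energy-fibre c = sym (∑-fibre c (fibre c))

  #W-fibre : ∀ c → #W ≡ ∑ elems (fibre c)
  #W-fibre c = trans (length-as-∑ W) (trans (sym (∑-fibre c (λ _ → 1))) (∑-cong elems λ b → *-identityʳ _))

  cauchy-image : ∀ c → #W * #W ≤ image c * energy c
  cauchy-image c = begin
    #W * #W                                                       ≡⟨ cong₂ _*_ (#W-fibre c) (#W-fibre c) ⟩
    ∑ elems (fibre c) * ∑ elems (fibre c)                         ≤⟨ cauchy elems (fibre c) (λ b → ⟦ Image? c b ⟧) support ⟩
    image c * ∑ elems (λ b → fibre c b * fibre c b)               ≡⟨ cong (image c *_) (sym (energy-fibre c)) ⟩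
    image c * energy c ∎
    where
    open ≤-Reasoning
    support : ∀ b → fibre c b ≡ 0 ⊎ 1 ≤ ⟦ Image? c b ⟧
    support b with Image? c b
    ... | yes _ = inj₂ ≤-refl
    ... | no ¬q = inj₁ (n≤0⇒n≡0 (≮⇒≥ ¬q))

  -- Diagonal pairs of words contribute the full mass of χ, and two distinct words agree for at most
  -- 4k values of c.
  energy-total : (χ : F → ℕ) → (∀ c → χ c ≤ 1) → ∑ elems (λ c → χ c * energy c) ≤ #W * (∑ elems χ + 4 * k * #W)
  energy-total χ χ≤1 = begin
    ∑ elems (λ c → χ c * energy c)
      ≡⟨ ∑-cong elems (λ c → trans (sym (∑-*ˡ W (χ c) _)) (∑-cong W λ w → sym (∑-*ˡ W (χ c) _))) ⟩
    ∑ elems (λ c → ∑ W (λ w → ∑ W (λ w′ → hit c w w′)))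
      ≡⟨ trans (∑-swap elems W _) (∑-cong W λ w → ∑-swap elems W _) ⟩
    ∑ W (λ w → ∑ W (λ w′ → ∑ elems (λ c → hit c w w′)))
      ≤⟨ ∑-mono W (λ w → ∑-mono W λ w′ → pair w w′) ⟩
    ∑ W (λ w → ∑ W (λ w′ → ⟦ w′ ≟W w ⟧ * X + 4 * k))
      ≡⟨ ∑-cong W (λ w → trans (∑-+ W _ _) (cong₂ _+_ (∑-*ʳ W X _) (∑-const W (4 * k)))) ⟩
    ∑ W (λ w → ∑ W (λ w′ → ⟦ w′ ≟W w ⟧) * X + #W * (4 * k))
      ≤⟨ ∑-mono W (λ w → +-monoˡ-≤ (#W * (4 * k)) (≤-trans (*-monoˡ-≤ X (words-atMostOnce m V k w)) (≤-reflexive (*-identityˡ X)))) ⟩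
    ∑ W (λ w → X + #W * (4 * k))
      ≡⟨ ∑-const W _ ⟩
    #W * (X + #W * (4 * k))
      ≡⟨ cong (λ z → #W * (X + z)) (*-comm #W (4 * k)) ⟩
    #W * (X + 4 * k * #W) ∎
    where
    open ≤-Reasoning
    X = ∑ elems χ
    hit : F → Word → Word → ℕ
    hit c w w′ = χ c * ⟦ value c w ≟F value c w′ ⟧
    pair : ∀ w w′ → ∑ elems (λ c → hit c w w′) ≤ ⟦ w′ ≟W w ⟧ * X + 4 * k
    pair w w′ with w′ ≟W w
    ... | yes refl = ≤-trans (∑-mono elems λ c → ≤-trans (*-monoʳ-≤ (χ c) (⟦⟧≤1 (value c w ≟F value c w))) (≤-reflexive (*-identityʳ _)))
                       (≤-trans (≤-reflexive (sym (+-identityʳ X))) (m≤m+n _ _))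
    ... | no w′≢w  = ≤-trans (∑-mono elems λ c → ≤-trans (*-monoˡ-≤ ⟦ value c w ≟F value c w′ ⟧ (χ≤1 c)) (≤-reflexive (*-identityˡ _)))
                       (coincidences 0 w w′ m<p kV≤p (λ e → w′≢w (sym e)))

  -- Some c in `P` has energy at most the average over `P`, and Cauchy-Schwarz turns small energy
  -- into a large image.
  large-image : {P : F → Set} (P? : Decidable P) → 0 < ∑ elems (λ c → ⟦ P? c ⟧) → 0 < #W →
                 ∃ λ c → P c × (∑ elems (λ c → ⟦ P? c ⟧) * #W ≤ image c * (∑ elems (λ c → ⟦ P? c ⟧) + 4 * k * #W))
  -- `suc B` in place of `B` makes the averaged inequality strict, so the c that is found has
  -- nonzero weight and hence satisfies `P`.
  large-image {P} P? X>0 W>0 = select (∑-find elems {f = λ c → ⟦ P? c ⟧ * suc B} {g = λ c → ⟦ P? c ⟧ * (X * energy c)} average)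
    where
    open ≤-Reasoning
    X = ∑ elems (λ c → ⟦ P? c ⟧)
    B = #W * (X + 4 * k * #W)
    average : ∑ elems (λ c → ⟦ P? c ⟧ * (X * energy c)) < ∑ elems (λ c → ⟦ P? c ⟧ * suc B)
    average = begin-strict
      ∑ elems (λ c → ⟦ P? c ⟧ * (X * energy c))   ≡⟨ ∑-cong elems (λ c → exchange ⟦ P? c ⟧ X (energy c)) ⟩
      ∑ elems (λ c → X * (⟦ P? c ⟧ * energy c))   ≡⟨ ∑-*ˡ elems X _ ⟩
      X * ∑ elems (λ c → ⟦ P? c ⟧ * energy c)     ≤⟨ *-monoʳ-≤ X (energy-total (λ c → ⟦ P? c ⟧) (λ c → ⟦⟧≤1 (P? c))) ⟩
      X * B                                       <⟨ *-monoʳ-< X {{>-nonZero X>0}} (n<1+n B) ⟩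
      X * suc B                                   ≡⟨ sym (∑-*ʳ elems (suc B) _) ⟩
      ∑ elems (λ c → ⟦ P? c ⟧ * suc B) ∎
      where
      exchange : ∀ a x e → a * (x * e) ≡ x * (a * e)
      exchange = solve-∀
    select : (∃ λ c → ⟦ P? c ⟧ * (X * energy c) < ⟦ P? c ⟧ * suc B) → _
    select (c , lt) with P? c
    ... | yes Pc = c , Pc , *-cancelʳ-≤ _ _ #W {{>-nonZero W>0}} (begin
      X * #W * #W                             ≡⟨ *-assoc X #W #W ⟩
      X * (#W * #W)                           ≤⟨ *-monoʳ-≤ X (cauchy-image c) ⟩
      X * (image c * energy c)                ≡⟨ exchange X (image c) (energy c) ⟩
      image c * (X * energy c)                ≤⟨ *-monoʳ-≤ (image c) (m<1+n⇒m≤n (subst₂ _<_ (*-identityˡ _) (*-identityˡ _) lt)) ⟩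
      image c * (#W * (X + 4 * k * #W))       ≡⟨ trans (cong (image c *_) (*-comm #W _)) (sym (*-assoc (image c) _ #W)) ⟩
      image c * (X + 4 * k * #W) * #W ∎)
      where
      exchange : ∀ x i e → x * (i * e) ≡ i * (x * e)
      exchange = solve-∀

-- Sealed copies of the above, whose enumerations would otherwise be unfolded during conversion checking.
module Images (p : ℕ) (p-prime : Prime p) (m V k : ℕ) (m<p : m < p) (kV≤p : k * V ≤ p) where
  open PrimeField p p-prime
  private
    module E = Energy p p-prime m V k m<p kV≤p

  open E using (Word; value) public

  abstract
    #W : ℕ
    #W = E.#W

    #W≡ : #W ≡ (m * V) ^ k
    #W≡ = length-words m V k

    InImage : F → F → Set
    InImage c b = 0 < E.fibre c b

    InImage? : ∀ c → Decidable (InImage c)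
    InImage? c = E.Image? c

    image-word : ∀ c b → InImage c b → ∃ λ w → b ≡ value c w
    image-word = E.image-word

  image : F → ℕ
  image c = ∑ elems (λ b → ⟦ InImage? c b ⟧)

  abstract
    large-image : {P : F → Set} (P? : Decidable P) (X : ℕ) → X ≡ ∑ elems (λ c → ⟦ P? c ⟧) → 0 < X → 0 < #W →
                  ∃ λ c → P c × (X * #W ≤ image c * (X + 4 * k * #W))
    large-image P? X refl = E.large-image P?

-- Growth of iterated difference sets.

module Growth (p : ℕ) (p-prime : Prime p) where
  open PrimeField p p-prime

  F-∃? : {P : F → Set} → Decidable P → Dec (∃ P)
  F-∃? = ∃? _≟F_ {elems} elems-enum

  module DifferenceSums {B : F → Set} (B? : Decidable B) {b₀ b₁ : F} (Bb₀ : B b₀) (Bb₁ : B b₁) (b₁≢b₀ : b₁ ≢ b₀) where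

    -- The t-fold sumset of B - B; it increases with t because B - B contains 0.
    R : ℕ → F → Set
    R zero    x = x ≡ 0F
    R (suc t) x = ∃ λ b → ∃ λ b′ → B b × B b′ × R t (x ⊝ b ⊕ b′)

    R? : ∀ t → Decidable (R t)
    R? zero    x = x ≟F 0F
    R? (suc t) x = F-∃? λ b → F-∃? λ b′ → B? b ×-dec (B? b′ ×-dec R? t (x ⊝ b ⊕ b′))

    R-weaken : ∀ t x → R t x → R (suc t) x
    R-weaken t x Rx = b₀ , b₀ , Bb₀ , Bb₀ , subst (R t) (S.solve 2 (λ x b → x S.:= x S.:- b S.:+ b) refl x b₀) Rx

    size : ℕ → ℕ
    size t = ∑ elems (λ x → ⟦ R? t x ⟧)

    β : ℕ
    β = ∑ elems (λ b → ⟦ B? b ⟧)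

    β≤translate : ∀ e → β ≤ ∑ elems (λ x → ⟦ B? (x ⊝ e) ⟧)
    β≤translate e = ∑-inject _≟F_ elems {elems} elems-enum B? (λ x → B? (x ⊝ e)) (_⊕ e) injective (λ b → subst B (shift b))
      where
      shift : ∀ b → b ≡ (b ⊕ e) ⊝ e
      shift b = S.solve 2 (λ b e → b S.:= (b S.:+ e) S.:- e) refl b e
      injective : ∀ x → ∑ elems (λ b → ⟦ B? b ⟧ * ⟦ x ≟F b ⊕ e ⟧) ≤ 1
      injective x = ≤-trans (∑-mono elems at) (≤-reflexive (elems-enum (x ⊝ e)))
        where
        at : ∀ b → ⟦ B? b ⟧ * ⟦ x ≟F b ⊕ e ⟧ ≤ ⟦ b ≟F x ⊝ e ⟧
        at b with x ≟F b ⊕ e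
        ... | no _ = ≤-trans (≤-reflexive (*-zeroʳ ⟦ B? b ⟧)) z≤n
        ... | yes refl = ≤-trans (≤-trans (≤-reflexive (*-identityʳ _)) (⟦⟧≤1 (B? b))) (≤-reflexive (sym (⟦⟧-true (b ≟F (b ⊕ e) ⊝ e) (shift b))))

    -- A translate of B by a new element of R (2 + t) lies in R (3 + t) and misses R t.
    grow : ∀ t e → R (2 + t) e → ¬ R (1 + t) e → size t + β ≤ size (3 + t)
    grow t e Re ¬Re = begin
      size t + β                                                                          ≤⟨ +-monoʳ-≤ (size t) (β≤translate (e ⊝ b₀)) ⟩
      size t + ∑ elems (λ x → ⟦ B? (x ⊝ (e ⊝ b₀)) ⟧)                                      ≡⟨ sym (∑-+ elems _ _) ⟩
      ∑ elems (λ x → ⟦ R? t x ⟧ + ⟦ B? (x ⊝ (e ⊝ b₀)) ⟧)                                  ≤⟨ ∑-mono elems (λ x → disjoint x (R? t x) (B? (x ⊝ (e ⊝ b₀)))) ⟩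
      size (3 + t) ∎
      where
      open ≤-Reasoning
      disjoint : ∀ x (d : Dec (R t x)) (d′ : Dec (B (x ⊝ (e ⊝ b₀)))) → ⟦ d ⟧ + ⟦ d′ ⟧ ≤ ⟦ R? (3 + t) x ⟧
      disjoint x (yes Rx) (yes Bx) = contradiction (b₀ , x ⊝ (e ⊝ b₀) , Bb₀ , Bx , subst (R t)
        (S.solve 3 (λ x e b → x S.:= e S.:- b S.:+ (x S.:- (e S.:- b))) refl x e b₀) Rx) ¬Re
      disjoint x (yes Rx) (no _)   = ≤-reflexive (sym (⟦⟧-true (R? (3 + t) x) (R-weaken _ x (R-weaken _ x (R-weaken t x Rx)))))
      disjoint x (no _)   (yes Bx) = ≤-reflexive (sym (⟦⟧-true (R? (3 + t) x) (x ⊝ (e ⊝ b₀) , b₀ , Bx , Bb₀ , subst (R (2 + t))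
        (S.solve 3 (λ x e b → e S.:= x S.:- (x S.:- (e S.:- b)) S.:+ b) refl x e b₀) Re)))
      disjoint x (no _)   (no _)   = z≤n

    -- A stalled sumset contains 0 and is stable under adding b₁ - b₀, a nonzero element, which
    -- generates the additive group of F_p.
    closed⇒full : ∀ t → (∀ x → R (2 + t) x → R (1 + t) x) → ∀ x → R (1 + t) x
    closed⇒full t closed x = subst (R (1 + t)) (begin
      ι (rep y) ⊗ z            ≡⟨ cong (_⊗ z) (ι-rep y) ⟩
      x ⊗ inv z ⊗ z            ≡⟨ S.solve 3 (λ x i z → x S.:* i S.:* z S.:= x S.:* (z S.:* i)) refl x (inv z) z ⟩
      x ⊗ (z ⊗ inv z)          ≡⟨ cong (x ⊗_) (inv-right z≢0) ⟩
      x ⊗ 1F                   ≡⟨ ⊗-identityʳ x ⟩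
      x ∎) (multiples (rep y))
      where
      open ≡-Reasoning
      z = b₁ ⊝ b₀
      y = x ⊗ inv z
      z≢0 : z ≢ 0F
      z≢0 e = b₁≢b₀ (⊝≡0⇒≡ _ _ e)
      zero-in : ∀ t → R t 0F
      zero-in zero    = refl
      zero-in (suc t) = R-weaken t 0F (zero-in t)
      multiples : ∀ n → R (1 + t) (ι n ⊗ z)
      multiples zero    = subst (R (1 + t)) (sym (⊗-zeroˡ z)) (zero-in (1 + t))
      multiples (suc n) = closed _ (b₁ , b₀ , Bb₁ , Bb₀ , subst (R (1 + t))
        (trans (S.solve 3 (λ n b₁ b₀ → n S.:* (b₁ S.:- b₀) S.:= (S.con (ℤ.+ 1) S.:+ n) S.:* (b₁ S.:- b₀) S.:- b₁ S.:+ b₀) refl (ι n) b₁ b₀)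
          (cong (λ w → w ⊗ z ⊝ b₁ ⊕ b₀) (sym (ι-+ 1 n)))) (multiples n))

    -- Three further differences either gain β elements, or the set has stalled and is everything.
    -- Thus about 3p/β differences always suffice: linear growth in place of a sumset theorem.
    size-growth : ∀ i → (∀ x → R (i * 3) x) ⊎ (i * β ≤ size (i * 3))
    size-growth zero = inj₂ z≤n
    size-growth (suc i) with size-growth i
    ... | inj₁ full = inj₁ λ x → R-weaken (2 + i * 3) x (R-weaken (1 + i * 3) x (R-weaken (i * 3) x (full x)))
    ... | inj₂ le with F-∃? (λ e → R? (2 + i * 3) e ×-dec ¬? (R? (1 + i * 3) e))
      where open import Relation.Nullary.Decidable using (¬?)
    ...   | yes (e , Re , ¬Re) = inj₂ (≤-trans (≤-reflexive (+-comm β (i * β))) (≤-trans (+-monoˡ-≤ β le) (grow (i * 3) e Re ¬Re)))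
    ...   | no none = inj₁ λ x → R-weaken (2 + i * 3) x (R-weaken (1 + i * 3) x (closed⇒full (i * 3) closed x))
      where
      closed : ∀ x → R (2 + i * 3) x → R (1 + i * 3) x
      closed x Rx with R? (1 + i * 3) x
      ... | yes q = q
      ... | no ¬q = contradiction (x , Rx , ¬q) none

    size≤p : ∀ t → size t ≤ p
    size≤p t = ≤-trans (∑-mono elems λ x → ⟦⟧≤1 (R? t x)) (≤-reflexive (trans (∑F-const 1) (*-identityʳ p)))

    full : ∀ i → p < i * β → ∀ x → R (i * 3) x
    full i p<iβ with size-growth i
    ... | inj₁ f  = f
    ... | inj₂ le = contradiction (≤-trans le (size≤p (i * 3))) (<⇒≱ p<iβ)

-- Represented elements, and integer roots.

module Intervals (p : ℕ) (p-prime : Prime p) where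
  open PrimeField p p-prime

  ZeroFree : ℕ → ℕ → Set
  ZeroFree a N = ∀ j → j < N → ι (a + j) ≢ 0F

module Representations (p : ℕ) (p-prime : Prime p) (A : ℕ) where
  open PrimeField p p-prime

  quotSum : ∀ {n} → ℕ → Vec (ℕ × ℕ) n → F
  quotSum a []            = 0F
  quotSum a ((k , j) ∷ v) = ι (A + k) ⊗ inv (ι (a + j)) ⊕ quotSum a v

  -- x = Σ (A + kᵢ) / (a + jᵢ) with n summands, kᵢ < M and jᵢ < N.
  Represented : (M a N n : ℕ) → F → Set
  Represented M a N n x = Σ (Vec (ℕ × ℕ) n) λ v → VAll.All (λ (k , j) → k < M × j < N) v × quotSum a v ≡ x

^-cancel-< : ∀ k {m n} → m ^ k < n ^ k → m < n
^-cancel-< k {m} {n} lt = ≰⇒> λ n≤m → <⇒≱ lt (^-monoˡ-≤ k n≤m)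

^-distribʳ : ∀ m n k → (m * n) ^ k ≡ m ^ k * n ^ k
^-distribʳ m n zero    = refl
^-distribʳ m n (suc k) rewrite ^-distribʳ m n k = exchange m n (m ^ k) (n ^ k)
  where
  exchange : ∀ a b c d → a * b * (c * d) ≡ a * c * (b * d)
  exchange = solve-∀

record CeilRoot (k X : ℕ) : Set where
  constructor ceilRoot
  field
    root : ℕ
    root>0 : 0 < root
    X≤root^k : X ≤ root ^ k
    root^k≤ : root ^ k ≤ 2 ^ k * X

-- Rounding a root up at most doubles it, which costs the factor 2^k on the power.
ceil-root : ∀ k X → 0 < X → CeilRoot (suc k) X
ceil-root k X X>0 = descend X (≤-trans (≤-trans (n≤1+n X) (≤-reflexive (sym (*-identityʳ (suc X))))) (*-monoʳ-≤ (suc X) (m^n>0 (suc X) k)))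
  where
  descend : ∀ r → X ≤ suc r ^ suc k → CeilRoot (suc k) X
  descend zero    X≤ = ceilRoot 1 (s≤s z≤n) X≤ (≤-trans (≤-reflexive (^-zeroˡ (suc k))) (*-mono-≤ (m^n>0 2 (suc k)) X>0))
  descend (suc r) X≤ with X ≤? suc r ^ suc k
  ... | yes le = descend r le
  ... | no gt = ceilRoot (suc (suc r)) (s≤s z≤n) X≤ (begin
    suc (suc r) ^ suc k         ≤⟨ ^-monoˡ-≤ (suc k) (≤-trans (m≤m+n (suc (suc r)) r) (≤-reflexive (double r))) ⟩
    (2 * suc r) ^ suc k         ≡⟨ ^-distribʳ 2 (suc r) (suc k) ⟩
    2 ^ suc k * suc r ^ suc k   ≤⟨ *-monoʳ-≤ (2 ^ suc k) (<⇒≤ (≰⇒> gt)) ⟩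
    2 ^ suc k * X ∎)
    where
    open ≤-Reasoning
    double : ∀ r → suc (suc r) + r ≡ 2 * suc r
    double = solve-∀

-- Since m is at most 2 X^(1/(k+1)), the goal follows from 2P < M X^(k/(k+1)); powers are compared
-- so that no root is taken.
root-step : ∀ k P M X m → 0 < X → m ^ suc k ≤ 2 ^ suc k * X → (2 * P) ^ suc k < M ^ suc k * X ^ k → P * m < M * X
root-step k P M X m X>0 m^k≤ big = ^-cancel-< (suc k) (begin-strict
  (P * m) ^ suc k                     ≡⟨ ^-distribʳ P m (suc k) ⟩
  P ^ suc k * m ^ suc k               ≤⟨ *-monoʳ-≤ (P ^ suc k) m^k≤ ⟩
  P ^ suc k * (2 ^ suc k * X)         ≡⟨ exchange (P ^ suc k) (2 ^ suc k) X ⟩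
  2 ^ suc k * P ^ suc k * X           ≡⟨ cong (_* X) (sym (^-distribʳ 2 P (suc k))) ⟩
  (2 * P) ^ suc k * X                 <⟨ *-monoˡ-< X {{>-nonZero X>0}} big ⟩
  M ^ suc k * X ^ k * X               ≡⟨ trans (*-assoc (M ^ suc k) (X ^ k) X) (cong (M ^ suc k *_) (*-comm (X ^ k) X)) ⟩
  M ^ suc k * X ^ suc k               ≡⟨ sym (^-distribʳ M X (suc k)) ⟩
  (M * X) ^ suc k ∎)
  where
  open ≤-Reasoning
  exchange : ∀ a b x → a * (b * x) ≡ b * a * x
  exchange = solve-∀

-- Second range: one good ratio, numerators filled by differences.

module Middle (p : ℕ) (p-prime : Prime p) (A : ℕ) where
  open PrimeField p p-prime
  open RationalFunctions p p-prime
  open Ratios p p-prime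
  open Growth p p-prime
  open Intervals p p-prime
  open Representations p p-prime A

  lin : ∀ {k} → ℕ → Vec ℕ k → F → F
  lin s []       c = 0F
  lin s (l ∷ ls) c = ι l ⊗ inv (c ⊕ ι s) ⊕ lin (suc s) ls c

  lin-+ : ∀ {k} s (ls ls′ : Vec ℕ k) c → lin s (zipWith _+_ ls ls′) c ≡ lin s ls c ⊕ lin s ls′ c
  lin-+ s [] [] c = sym (⊕-identityʳ 0F)
  lin-+ s (l ∷ ls) (l′ ∷ ls′) c = trans (cong₂ (λ a b → a ⊗ inv (c ⊕ ι s) ⊕ b) (ι-+ l l′) (lin-+ (suc s) ls ls′ c))
    (S.solve 5 (λ a b i f g → (a S.:+ b) S.:* i S.:+ (f S.:+ g) S.:= (a S.:* i S.:+ f) S.:+ (b S.:* i S.:+ g)) refl (ι l) (ι l′) (inv (c ⊕ ι s)) _ _)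

  lin-replicate-+ : ∀ k s m n c → lin s (replicate k (m + n)) c ≡ lin s (replicate k m) c ⊕ lin s (replicate k n) c
  lin-replicate-+ zero    s m n c = sym (⊕-identityʳ 0F)
  lin-replicate-+ (suc k) s m n c = trans (cong₂ (λ a b → a ⊗ inv (c ⊕ ι s) ⊕ b) (ι-+ m n) (lin-replicate-+ k (suc s) m n c))
    (S.solve 5 (λ a b i f g → (a S.:+ b) S.:* i S.:+ (f S.:+ g) S.:= (a S.:* i S.:+ f) S.:+ (b S.:* i S.:+ g)) refl (ι m) (ι n) (inv (c ⊕ ι s)) _ _)

  lin-replicate-0 : ∀ k s c → lin s (replicate k 0) c ≡ 0F
  lin-replicate-0 zero    s c = refl
  lin-replicate-0 (suc k) s c = trans (cong₂ _⊕_ (⊗-zeroˡ _) (lin-replicate-0 k (suc s) c)) (⊕-identityˡ 0F)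

  coefs : ∀ {m k} → Vec (Entry m 1) k → Vec ℕ k
  coefs []            = []
  coefs ((x , _) ∷ w) = suc (toℕ x) ∷ coefs w

  -- Subtracting a word would need negative numerators. The entries m - x are nonnegative and differ
  -- from -x by a shift common to all words, which is later taken off the target.
  complement : ∀ {m k} → Vec (Entry m 1) k → Vec ℕ k
  complement         []            = []
  complement {m} ((x , _) ∷ w) = m ∸ suc (toℕ x) ∷ complement w

  lin-coefs : ∀ {m k} s (w : Vec (Entry m 1) k) c → fracSum (terms s w) c ≡ lin s (coefs w) c
  lin-coefs s [] c = refl
  lin-coefs s ((x , zero) ∷ w) c = cong₂ (λ a b → ι (suc (toℕ x)) ⊗ inv (c ⊕ ι a) ⊕ b) (+-identityʳ s)
    (trans (cong (λ z → fracSum (terms z w) c) (+-comm s 1)) (lin-coefs (suc s) w c))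

  lin-complement : ∀ {m k} s (w : Vec (Entry m 1) k) c → lin s (complement w) c ⊕ lin s (coefs w) c ≡ lin s (replicate k m) c
  lin-complement s [] c = ⊕-identityʳ 0F
  lin-complement {m} s ((x , _) ∷ w) c = trans
    (S.solve 5 (λ a b i f g → (a S.:* i S.:+ f) S.:+ (b S.:* i S.:+ g) S.:= (a S.:+ b) S.:* i S.:+ (f S.:+ g)) refl (ι (m ∸ suc (toℕ x))) (ι (suc (toℕ x))) (inv (c ⊕ ι s)) _ _)
    (cong₂ (λ a b → a ⊗ inv (c ⊕ ι s) ⊕ b) (trans (sym (ι-+ _ _)) (cong ι (m∸n+n≡m (toℕ<n x)))) (lin-complement (suc s) w c))

  Bounded : ∀ {k} → ℕ → Vec ℕ k → Set
  Bounded b = VAll.All (_≤ b)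

  bounded-0 : ∀ k → Bounded 0 (replicate k 0)
  bounded-0 zero    = []
  bounded-0 (suc k) = z≤n ∷ bounded-0 k

  bounded-step : ∀ {m k b} (w w′ : Vec (Entry m 1) k) (l : Vec ℕ k) → Bounded b l →
                 Bounded (2 * m + b) (zipWith _+_ l (zipWith _+_ (coefs w) (complement w′)))
  bounded-step [] [] [] [] = []
  bounded-step {m} {b = b} ((x , _) ∷ w) ((x′ , _) ∷ w′) (l ∷ ls) (q ∷ qs) =
    ≤-trans (+-mono-≤ q (+-mono-≤ (toℕ<n x) (m∸n≤m m (suc (toℕ x′))))) (≤-reflexive (collect b m)) ∷ bounded-step w w′ ls qs
    where
    collect : ∀ b m → b + (m + m) ≡ 2 * m + b
    collect = solve-∀

  -- Summands lᵢ/(y + iu), where y = a + j and c = y/u.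
  module Progression (a N : ℕ) (zf : ZeroFree a N) (c : F) (j u : ℕ) (cu : ι u ⊗ c ≡ ι (a + j)) where

    summands : ∀ {k} → ℕ → Vec ℕ k → Vec (ℕ × ℕ) k
    summands s []       = []
    summands s (l ∷ ls) = (l , j + s * u) ∷ summands (suc s) ls

    denominator : ∀ s → ι (a + (j + s * u)) ≡ ι u ⊗ (c ⊕ ι s)
    denominator s = begin
      ι (a + (j + s * u))          ≡⟨ cong ι (sym (+-assoc a j _)) ⟩
      ι (a + j + s * u)            ≡⟨ ι-+ (a + j) _ ⟩
      ι (a + j) ⊕ ι (s * u)        ≡⟨ cong₂ _⊕_ (sym cu) (ι-* s u) ⟩
      ι u ⊗ c ⊕ ι s ⊗ ι u          ≡⟨ S.solve 3 (λ u c s → u S.:* c S.:+ s S.:* u S.:= u S.:* (c S.:+ s)) refl (ι u) c (ι s) ⟩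
      ι u ⊗ (c ⊕ ι s) ∎
      where open ≡-Reasoning

    -- The factor u cancels from every denominator, and the start A of the numerator interval
    -- contributes a term independent of the l's.
    quotSum-summands : ∀ {k} s (ls : Vec ℕ k) → j + (s + k) * u ≤ N → 0 < u →
                       quotSum a (summands s ls) ≡ inv (ι u) ⊗ (lin s ls c ⊕ ι A ⊗ lin s (replicate k 1) c)
    quotSum-summands s [] _ _ = S.solve 2 (λ i A → S.con (ℤ.+ 0) S.:= i S.:* (S.con (ℤ.+ 0) S.:+ A S.:* S.con (ℤ.+ 0))) refl (inv (ι u)) (ι A)
    quotSum-summands {suc k} s (l ∷ ls) fit u>0 = trans
      (cong₂ (λ x y → ι (A + l) ⊗ x ⊕ y) (trans (cong inv (denominator s)) (inv-⊗ ιu≢0 c+s≢0))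
        (quotSum-summands (suc s) ls (≤-trans (≤-reflexive (cong (λ z → j + z * u) (sym (+-suc s k)))) fit) u>0))
      (trans (cong (λ z → z ⊗ (inv (ι u) ⊗ inv (c ⊕ ι s)) ⊕ inv (ι u) ⊗ (f ⊕ ι A ⊗ g)) (ι-+ A l))
        (S.solve 6 (λ A l i k f g → (A S.:+ l) S.:* (i S.:* k) S.:+ i S.:* (f S.:+ A S.:* g) S.:= i S.:* ((l S.:* k S.:+ f) S.:+ A S.:* (S.con (ℤ.+ 1) S.:* k S.:+ g))) refl (ι A) (ι l) (inv (ι u)) (inv (c ⊕ ι s)) f g))
      where
      f g : F
      f = lin (suc s) ls c
      g = lin (suc s) (replicate k 1) c
      nonzero : ι u ⊗ (c ⊕ ι s) ≢ 0F
      nonzero e = zf (j + s * u) (<-≤-trans (+-monoʳ-< j (*-monoˡ-< u {{>-nonZero u>0}} (m<m+n s {suc k} (s≤s z≤n)))) fit) (trans (denominator s) e)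
      ιu≢0 : ι u ≢ 0F
      ιu≢0 e = nonzero (trans (cong (_⊗ (c ⊕ ι s)) e) (⊗-zeroˡ _))
      c+s≢0 : c ⊕ ι s ≢ 0F
      c+s≢0 e = nonzero (trans (cong (ι u ⊗_) e) (⊗-zeroʳ _))

    summands-bounded : ∀ {k M b} s (ls : Vec ℕ k) → b < M → 0 < u → Bounded b ls → j + (s + k) * u ≤ N →
                       VAll.All (λ (k , j) → k < M × j < N) (summands s ls)
    summands-bounded s [] _ _ [] _ = []
    summands-bounded {suc k} s (l ∷ ls) b<M u>0 (q ∷ qs) fit =
      (≤-<-trans q b<M , <-≤-trans (+-monoʳ-< j (*-monoˡ-< u {{>-nonZero u>0}} (m<m+n s {suc k} (s≤s z≤n)))) fit)
      ∷ summands-bounded (suc s) ls b<M u>0 qs (≤-trans (≤-reflexive (cong (λ z → j + z * u) (sym (+-suc s k)))) fit)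

  module Fill (M a N U : ℕ) (zf : ZeroFree a N) (M≤p : M ≤ p) (m : ℕ) (X : ℕ) (X≤p : X ≤ p) (X≤m^12 : X ≤ m ^ 12)
              (m>0 : 0 < m) (300pm<MX : 300 * p * m < M * X)
              {P : F → Set} (P? : Decidable P) (X≡ : X ≡ ∑ elems (λ c → ⟦ P? c ⟧))
              (P-ratio : ∀ c → P c → ∃ λ u → ∃ λ j → u < U × U < p × j + 12 * U ≤ N × ι (suc u) ⊗ c ≡ ι (a + j)) where
    open ≤-Reasoning
    300m<X : 300 * m < X
    300m<X = *-cancelˡ-< p (300 * m) X (begin-strict
      p * (300 * m)     ≡⟨ exchange p m ⟩
      300 * p * m       <⟨ 300pm<MX ⟩
      M * X             ≤⟨ *-monoˡ-≤ X M≤p ⟩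
      p * X ∎)
      where
      exchange : ∀ p m → p * (300 * m) ≡ 300 * p * m
      exchange = solve-∀
    300<X : 300 < X
    300<X = ≤-<-trans (m≤m*n 300 m {{>-nonZero m>0}}) 300m<X
    X>0 : 0 < X
    X>0 = ≤-<-trans z≤n 300<X
    instance
      X-nonZero : NonZero X
      X-nonZero = >-nonZero X>0
    m<p : m < p
    m<p = ≤-<-trans (m≤n*m m 300) (<-≤-trans 300m<X X≤p)
    12≤p : 12 * 1 ≤ p
    12≤p = ≤-trans (m≤m+n 12 288) (≤-trans (<⇒≤ 300<X) X≤p)
    open Images p p-prime m 1 12 m<p 12≤p
    X≤#W : X ≤ #W
    X≤#W = ≤-trans X≤m^12 (≤-reflexive (sym (trans #W≡ (cong (_^ 12) (*-identityʳ m)))))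
    #W>0 : 0 < #W
    #W>0 = <-≤-trans X>0 X≤#W

    i t : ℕ
    -- The image has at least X/49 elements, so i copies of it exceed p. Each copy costs three
    -- differences and each difference raises a numerator by at most 2m, which requires 6mi < M;
    -- since iX ≤ 50p, this is where 300 = 6·50 comes from.
    i = suc (49 * p / X)
    t = i * 3

    t*2m<M : t * (2 * m) < M
    t*2m<M = *-cancelʳ-< X (i * 3 * (2 * m)) M (begin-strict
      i * 3 * (2 * m) * X         ≡⟨ regroup i m X ⟩
      6 * m * (i * X)             ≤⟨ *-monoʳ-≤ (6 * m) (+-mono-≤ X≤p (m/n*n≤m (49 * p) X)) ⟩
      6 * m * (p + 49 * p)        ≡⟨ collect m p ⟩
      300 * p * m                 <⟨ 300pm<MX ⟩
      M * X ∎)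
      where
      regroup : ∀ i m X → i * 3 * (2 * m) * X ≡ 6 * m * (i * X)
      regroup = solve-∀
      collect : ∀ m p → 6 * m * (p + 49 * p) ≡ 300 * p * m
      collect = solve-∀

    module At (c : F) (large : X * #W ≤ image c * (X + 4 * 12 * #W)) where
      β : ℕ
      β = image c
      -- 49 = 1 + 4·12, the 1 from the diagonal because X ≤ `#W`.
      X≤49β : X ≤ 49 * β
      X≤49β = *-cancelʳ-≤ X (49 * β) #W {{>-nonZero #W>0}} (begin
        X * #W                       ≤⟨ large ⟩
        β * (X + 4 * 12 * #W)        ≤⟨ *-monoʳ-≤ β (+-monoˡ-≤ (4 * 12 * #W) X≤#W) ⟩
        β * (#W + 4 * 12 * #W)       ≡⟨ collect β #W ⟩
        49 * β * #W ∎)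
        where
        collect : ∀ b w → b * (w + 4 * 12 * w) ≡ 49 * b * w
        collect = solve-∀
      1<β : 1 < β
      1<β = *-cancelˡ-< 49 1 β (<-≤-trans (≤-<-trans (m≤m+n 49 251) 300<X) X≤49β)
      first : ∃ λ b → InImage c b
      first = ∑-witness elems (InImage? c) (<⇒≤ 1<β)
      second : ∃ λ b → InImage c b × b ≢ proj₁ first
      second = ∑-another _≟F_ {elems} (≤-reflexive ∘ elems-enum) (InImage? c) 1<β (proj₁ first)
      module DS = DifferenceSums (InImage? c) {proj₁ first} {proj₁ second} (proj₂ first) (proj₁ (proj₂ second)) (proj₂ (proj₂ second))
      49p<iX : 49 * p < i * X
      49p<iX = ≤-<-trans (≤-reflexive (m≡m%n+[m/n]*n (49 * p) X)) (+-monoˡ-< (49 * p / X * X) (m%n<n (49 * p) X))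
      p<iβ : p < i * β
      p<iβ = *-cancelˡ-< 49 p (i * β) (<-≤-trans 49p<iX (≤-trans (*-monoʳ-≤ i X≤49β) (≤-reflexive (exchange i β))))
        where
        exchange : ∀ i b → i * (49 * b) ≡ 49 * (i * b)
        exchange = solve-∀
      L : ℕ → F
      L n = lin 0 (replicate 12 n) c

      -- Each difference b - b′ is realised by a word plus a complemented word up to the fixed shift
      -- `L m`; these shifts accumulate to `L (t * m)`.
      combine : ∀ t y → DS.R t y → Σ (Vec ℕ 12) λ l → Bounded (t * (2 * m)) l × lin 0 l c ≡ y ⊕ L (t * m)
      combine zero y y≡0 = replicate 12 0 , bounded-0 12 , sym (trans (cong (_⊕ L 0) y≡0) (⊕-identityˡ (L 0)))
      combine (suc t) y (b , b′ , Bb , Bb′ , Ry) = join (image-word c b Bb) (image-word c b′ Bb′) (combine t _ Ry)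
        where
        join : (∃ λ w → b ≡ value c w) → (∃ λ w → b′ ≡ value c w) →
               (Σ (Vec ℕ 12) λ l → Bounded (t * (2 * m)) l × lin 0 l c ≡ (y ⊝ b ⊕ b′) ⊕ L (t * m)) →
               Σ (Vec ℕ 12) λ l → Bounded (suc t * (2 * m)) l × lin 0 l c ≡ y ⊕ L (suc t * m)
        join (w , eb) (w′ , eb′) (l , lb , el) = zipWith _+_ l (zipWith _+_ (coefs w) (complement w′)) , bounded-step w w′ l lb , equation
          where
          C : F
          C = lin 0 (complement w′) c
          module R = ≡-Reasoning
          equation : lin 0 (zipWith _+_ l (zipWith _+_ (coefs w) (complement w′))) c ≡ y ⊕ L (suc t * m)
          equation = R.begin
            lin 0 (zipWith _+_ l (zipWith _+_ (coefs w) (complement w′))) c  R.≡⟨ lin-+ 0 l (zipWith _+_ (coefs w) (complement w′)) c ⟩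
            lin 0 l c ⊕ lin 0 (zipWith _+_ (coefs w) (complement w′)) c      R.≡⟨ cong₂ _⊕_ el (lin-+ 0 (coefs w) (complement w′) c) ⟩
            (y ⊝ b ⊕ b′) ⊕ L (t * m) ⊕ (lin 0 (coefs w) c ⊕ C)               R.≡⟨ cong (λ z → (y ⊝ b ⊕ b′) ⊕ L (t * m) ⊕ (z ⊕ C)) (sym (trans eb (lin-coefs 0 w c))) ⟩
            (y ⊝ b ⊕ b′) ⊕ L (t * m) ⊕ (b ⊕ C)                               R.≡⟨ S.solve 5 (λ y b b′ T C → (y S.:- b S.:+ b′) S.:+ T S.:+ (b S.:+ C) S.:= y S.:+ ((C S.:+ b′) S.:+ T)) refl y b b′ (L (t * m)) C ⟩
            y ⊕ ((C ⊕ b′) ⊕ L (t * m))                                       R.≡⟨ cong (λ z → y ⊕ ((C ⊕ z) ⊕ L (t * m))) (trans eb′ (lin-coefs 0 w′ c)) ⟩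
            y ⊕ ((C ⊕ lin 0 (coefs w′) c) ⊕ L (t * m))                       R.≡⟨ cong (λ z → y ⊕ (z ⊕ L (t * m))) (lin-complement 0 w′ c) ⟩
            y ⊕ (L m ⊕ L (t * m))                                            R.≡⟨ cong (y ⊕_) (sym (lin-replicate-+ 12 0 m (t * m) c)) ⟩
            y ⊕ L (suc t * m) R.∎

    filled : ∀ x → Represented M a N 12 x
    filled x = from-ratio (large-image P? X X≡ X>0 #W>0)
      where
      from-ratio : (∃ λ c → P c × (X * #W ≤ image c * (X + 4 * 12 * #W))) → Represented M a N 12 x
      from-ratio (c , Pc , large) = from-pair (P-ratio c Pc)
        where
        open At c large
        from-pair : (∃ λ u → ∃ λ j → u < U × U < p × j + 12 * U ≤ N × ι (suc u) ⊗ c ≡ ι (a + j)) → Represented M a N 12 x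
        from-pair (u′ , j , u′<U , U<p , j+12U≤N , cu) = finish (combine t y (DS.full i p<iβ y))
          where
          u = suc u′
          open Progression a N zf c j u cu
          -- Takes off in advance the shift due to numerators starting at A and the one due to the
          -- complements.
          y = ι u ⊗ x ⊝ ι A ⊗ L 1 ⊝ L (t * m)
          fits : j + (0 + 12) * u ≤ N
          fits = ≤-trans (+-monoʳ-≤ j (*-monoʳ-≤ 12 u′<U)) j+12U≤N
          u≢0 : ι u ≢ 0F
          u≢0 = ι≢0 (s≤s z≤n) (≤-<-trans u′<U U<p)
          finish : (Σ (Vec ℕ 12) λ l → Bounded (t * (2 * m)) l × lin 0 l c ≡ y ⊕ L (t * m)) → Represented M a N 12 x
          finish (l , lb , el) = summands 0 l , summands-bounded 0 l t*2m<M (s≤s z≤n) lb fits ,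
            trans (quotSum-summands 0 l fits (s≤s z≤n)) (trans (cong (λ z → inv (ι u) ⊗ (z ⊕ ι A ⊗ L 1)) el)
            (trans (S.solve 6 (λ i u x T A L → i S.:* ((u S.:* x S.:- A S.:* L S.:- T S.:+ T) S.:+ A S.:* L) S.:= (u S.:* i) S.:* x) refl (inv (ι u)) (ι u) x (L (t * m)) (ι A) (L 1))
              (trans (cong (_⊗ x) (inv-right u≢0)) (⊗-identityˡ x))))

  -- The first terms y are taken from the first n elements only, so that 12 steps of length at most
  -- U stay inside the interval.
  middle-range : ∀ M a N U n X₀ → ZeroFree a N → M ≤ p → 0 < U → U ≤ n → n + 12 * U ≤ N → 2 * (U * n) ≤ p →
                 21 * X₀ ≤ U * n → (2 * (300 * p)) ^ 12 < M ^ 12 * X₀ ^ 11 → ∀ x → Represented M a N 12 x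
  middle-range M a N U n X₀ zf M≤p U>0 U≤n fit 2Un≤p 21X₀≤Un big = with-root ratios refl ratios>0 ratios≤p X₀≤ratios
    where
    n>0 : 0 < n
    n>0 = <-≤-trans U>0 U≤n
    U<p : U < p
    U<p = <-≤-trans (m<m+n U {U + 0} (≤-trans U>0 (m≤m+n U 0))) (≤-trans (*-monoʳ-≤ 2 (m≤m*n U n {{>-nonZero n>0}})) 2Un≤p)
    open RatioSet a n U U≤n U>0 2Un≤p U<p
    ratios>0 : 0 < ratios
    ratios>0 = *-cancelˡ-< 21 0 ratios (<-≤-trans (*-mono-≤ U>0 n>0) ratios-bound)
    ratios≤p : ratios ≤ p
    ratios≤p = ≤-trans (∑-mono elems λ c → ⟦⟧≤1 (Ratio? c)) (≤-reflexive (trans (∑F-const 1) (*-identityʳ p)))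
    X₀≤ratios : X₀ ≤ ratios
    X₀≤ratios = *-cancelˡ-≤ 21 (≤-trans 21X₀≤Un ratios-bound)
    ratio : ∀ c → 1 ≤ ν c → ∃ λ u → ∃ λ j → u < U × U < p × j + 12 * U ≤ N × ι (suc u) ⊗ c ≡ ι (a + j)
    ratio c νc = found (∑-rng-witness U (Hit? c) νc)
      where
      found : (∃ λ u → u < U × Hit c u) → ∃ λ u → ∃ λ j → u < U × U < p × j + 12 * U ≤ N × ι (suc u) ⊗ c ≡ ι (a + j)
      found (u , u<U , hit) = u , rep (ι (suc u) ⊗ c ⊝ ι a) , u<U , U<p , ≤-trans (+-monoˡ-≤ (12 * U) (<⇒≤ hit)) fit , hit-eq c u
    with-root : ∀ X → X ≡ ratios → 0 < X → X ≤ p → X₀ ≤ X → ∀ x → Represented M a N 12 x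
    with-root X X≡ X>0 X≤p X₀≤X = rooted (ceil-root 11 X X>0)
      where
      rooted : CeilRoot 12 X → ∀ x → Represented M a N 12 x
      rooted (ceilRoot m m>0 X≤m^12 m^12≤) = Fill.filled M a N U zf M≤p m X X≤p X≤m^12 m>0
        (root-step 11 (300 * p) M X m X>0 m^12≤ (<-≤-trans big (*-monoʳ-≤ (M ^ 12) (^-monoˡ-≤ 11 X₀≤X)))) Ratio? X≡ ratio

-- Second moment over dilations and ratios.

1∸⟦⟧ : {P : Set} (d : Dec P) → ¬ P → 1 ≤ 1 ∸ ⟦ d ⟧
1∸⟦⟧ (yes p) ¬p = contradiction p ¬p
1∸⟦⟧ (no _)  _  = ≤-refl

-- (p + β) S² ≤ p² T follows from (p - β) T ≥ S² because (p - β)(p + β) ≤ p².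
sharpen : ∀ p β s S² T → s + β ≤ p → S² ≤ s * T → (p + β) * S² ≤ p * p * T
sharpen p β s S² T s+β≤p S²≤ = begin
  (p + β) * S²         ≤⟨ *-monoʳ-≤ (p + β) S²≤ ⟩
  (p + β) * (s * T)    ≡⟨ sym (*-assoc (p + β) s T) ⟩
  (p + β) * s * T      ≤⟨ *-monoˡ-≤ T (begin
    (p + β) * s          ≤⟨ *-monoʳ-≤ (p + β) (m+n≤o⇒m≤o∸n s s+β≤p) ⟩
    (p + β) * (p ∸ β)    ≤⟨ square β p (m+n≤o⇒n≤o s s+β≤p) ⟩
    p * p ∎) ⟩
  p * p * T ∎
  where
  open ≤-Reasoning
  square : ∀ β p → β ≤ p → (p + β) * (p ∸ β) ≤ p * p
  square β p β≤p = subst (λ q → (q + β) * (p ∸ β) ≤ q * q) (m+[n∸m]≡n β≤p)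
    (≤-trans (m≤m+n _ (β * β)) (≤-reflexive (identity β (p ∸ β))))
    where
    identity : ∀ b d → (b + d + b) * d + b * b ≡ (b + d) * (b + d)
    identity = solve-∀

module PushForward (p : ℕ) (p-prime : Prime p) {Y : Set} (ys : List Y) (g : Y → ℕ) (φ : Y → PrimeField.F p p-prime) where
  open PrimeField p p-prime

  push : F → ℕ
  push x = ∑ ys (λ y → g y * ⟦ x ≟F φ y ⟧)

  ∑-push : (h : F → ℕ) → ∑ elems (λ x → push x * h x) ≡ ∑ ys (λ y → g y * h (φ y))
  ∑-push h = begin
    ∑ elems (λ x → push x * h x)                                 ≡⟨ ∑-cong elems (λ x → sym (∑-*ʳ ys (h x) _)) ⟩
    ∑ elems (λ x → ∑ ys (λ y → g y * ⟦ x ≟F φ y ⟧ * h x))        ≡⟨ ∑-swap elems ys _ ⟩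
    ∑ ys (λ y → ∑ elems (λ x → g y * ⟦ x ≟F φ y ⟧ * h x))        ≡⟨ ∑-cong ys (λ y → trans (∑-cong elems λ x → *-assoc (g y) _ (h x)) (∑-*ˡ elems (g y) _)) ⟩
    ∑ ys (λ y → g y * ∑ elems (λ x → ⟦ x ≟F φ y ⟧ * h x))        ≡⟨ ∑-cong ys (λ y → cong (g y *_) (∑-pick _≟F_ {elems} elems-enum h (φ y))) ⟩
    ∑ ys (λ y → g y * h (φ y)) ∎
    where open ≡-Reasoning

  push-total : ∑ elems push ≡ ∑ ys g
  push-total = trans (∑-cong elems λ x → sym (*-identityʳ _)) (trans (∑-push (λ _ → 1)) (∑-cong ys λ y → *-identityʳ _))

  push-square : ∑ elems (λ x → push x * push x) ≡ ∑ ys (λ y → ∑ ys (λ y′ → g y * g y′ * ⟦ φ y ≟F φ y′ ⟧))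
  push-square = trans (∑-push push) (∑-cong ys λ y → trans (sym (∑-*ˡ ys (g y) _)) (∑-cong ys λ y′ → sym (*-assoc (g y) (g y′) _)))

module Dilations (p : ℕ) (p-prime : Prime p) where
  open PrimeField p p-prime

  -- Second moment over all dilations: for most pairs (u , c) the set u B + val c W is
  -- nearly all of F, because two distinct points (b , val c w) lie on at most one line of given slope.
  module Variance {Wd : Set} (W : List Wd) (val : F → Wd → F)
                  {B : F → Set} (B? : Decidable B) (K : ℕ)
                  (energy≤ : ∑ elems (λ c → ∑ W (λ w → ∑ W (λ w′ → ⟦ val c w ≟F val c w′ ⟧))) ≤ K * (length W * length W))
                  (#W>0 : 0 < length W) (target : F) where

    α : F → ℕ
    α b = ⟦ B? b ⟧

    β #W S : ℕ
    β = ∑ elems α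
    #W = length W
    S = β * #W

    Y : List (F × Wd)
    Y = cart elems W

    g : F × Wd → ℕ
    g (b , w) = α b

    φ : F → F → F × Wd → F
    φ u c (b , w) = u ⊗ b ⊕ val c w

    module P (u c : F) = PushForward p p-prime Y g (φ u c)

    ∑g : ∑ Y g ≡ S
    ∑g = trans (∑-cart elems W g) (trans (∑-cong elems λ b → trans (∑-const W (α b)) (*-comm #W (α b))) (∑-*ʳ elems #W α))

    second : F → F → ℕ
    second u c = ∑ elems (λ x → P.push u c x * P.push u c x)

    T : ℕ
    T = ∑ elems (λ c → ∑ elems (λ u → second u c))

    collision : F × Wd → F × Wd → ℕ
    collision y y′ = ∑ elems (λ c → ∑ elems (λ u → ⟦ φ u c y ≟F φ u c y′ ⟧))

    agree : Wd → Wd → ℕ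
    agree w w′ = ∑ elems (λ c → ⟦ val c w ≟F val c w′ ⟧)

    -- For b ≠ b′ and fixed c the equation u b + v = u b′ + v′ determines u, so at most p pairs (c,
    -- u) collide. For b = b′ the dilation u is free, but the two words must agree at c.
    collision≤ : ∀ b w b′ w′ → collision (b , w) (b′ , w′) ≤ p + p * (⟦ b′ ≟F b ⟧ * agree w w′)
    collision≤ b w b′ w′ = begin
      collision (b , w) (b′ , w′)                                              ≤⟨ ∑-mono elems per-c ⟩
      ∑ elems (λ c → 1 + p * (⟦ b′ ≟F b ⟧ * ⟦ val c w ≟F val c w′ ⟧))          ≡⟨ trans (∑-+ elems _ _) (cong₂ _+_ (trans (∑F-const 1) (*-identityʳ p)) (trans (∑-*ˡ elems p _) (cong (p *_) (∑-*ˡ elems ⟦ b′ ≟F b ⟧ _)))) ⟩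
      p + p * (⟦ b′ ≟F b ⟧ * agree w w′) ∎
      where
      open ≤-Reasoning
      per-c : ∀ c → ∑ elems (λ u → ⟦ φ u c (b , w) ≟F φ u c (b′ , w′) ⟧) ≤ 1 + p * (⟦ b′ ≟F b ⟧ * ⟦ val c w ≟F val c w′ ⟧)
      per-c c = by (b′ ≟F b)
        where
        by : (d : Dec (b′ ≡ b)) → ∑ elems (λ u → ⟦ φ u c (b , w) ≟F φ u c (b′ , w′) ⟧) ≤ 1 + p * (⟦ d ⟧ * ⟦ val c w ≟F val c w′ ⟧)
        by (yes refl) = ≤-trans (≤-trans (∑-mono elems λ u → ⟦⟧-mono (φ u c (b , w) ≟F φ u c (b , w′)) (val c w ≟F val c w′) (cancel (u ⊗ b)))
                          (≤-reflexive (trans (∑F-const _) (cong (p *_) (sym (*-identityˡ _)))))) (n≤1+n _)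
          where
          cancel : ∀ a {v v′} → a ⊕ v ≡ a ⊕ v′ → v ≡ v′
          cancel a {v} {v′} e = ⊝≡0⇒≡ v v′ (trans (S.solve 3 (λ a v v′ → v S.:- v′ S.:= (a S.:+ v) S.:- (a S.:+ v′)) refl a v v′) (trans (cong (_⊝ (a ⊕ v′)) e) (x⊝x≡0 _)))
        by (no b′≢b) = ≤-trans (∑-unique _≟F_ {elems} (≤-reflexive ∘ elems-enum) (λ u → φ u c (b , w) ≟F φ u c (b′ , w′)) one) (m≤m+n 1 _)
          where
          one : ∀ u u′ → φ u c (b , w) ≡ φ u c (b′ , w′) → φ u′ c (b , w) ≡ φ u′ c (b′ , w′) → u ≡ u′
          one u u′ e e′ = ⊗-cancelˡ {b ⊝ b′} (λ z → b′≢b (sym (⊝≡0⇒≡ b b′ z))) (trans (slope u e) (sym (slope u′ e′)))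
            where
            slope : ∀ u → u ⊗ b ⊕ val c w ≡ u ⊗ b′ ⊕ val c w′ → (b ⊝ b′) ⊗ u ≡ val c w′ ⊝ val c w
            slope u e = ⊝≡0⇒≡ _ _ (trans (S.solve 5 (λ b b′ u v v′ → (b S.:- b′) S.:* u S.:- (v′ S.:- v) S.:= (u S.:* b S.:+ v) S.:- (u S.:* b′ S.:+ v′)) refl b b′ u (val c w) (val c w′))
              (trans (cong (_⊝ (u ⊗ b′ ⊕ val c w′)) e) (x⊝x≡0 _)))

    -- The term p S² is the value for perfectly equidistributed sums, S²/p for each of p² pairs; the
    -- excess comes only from b = b′ and is governed by the energy.
    T≤ : T ≤ p * (S * S) + p * (β * (K * (#W * #W)))
    T≤ = begin
      T
        ≡⟨ ∑-cong elems (λ c → ∑-cong elems λ u → P.push-square u c) ⟩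
      ∑ elems (λ c → ∑ elems (λ u → ∑ Y (λ y → ∑ Y (λ y′ → g y * g y′ * ⟦ φ u c y ≟F φ u c y′ ⟧))))
        ≡⟨ ∑-cong elems (λ c → trans (∑-swap elems Y _) (∑-cong Y λ y → ∑-swap elems Y _)) ⟩
      ∑ elems (λ c → ∑ Y (λ y → ∑ Y (λ y′ → ∑ elems (λ u → g y * g y′ * ⟦ φ u c y ≟F φ u c y′ ⟧))))
        ≡⟨ trans (∑-swap elems Y _) (∑-cong Y λ y → ∑-swap elems Y _) ⟩
      ∑ Y (λ y → ∑ Y (λ y′ → ∑ elems (λ c → ∑ elems (λ u → g y * g y′ * ⟦ φ u c y ≟F φ u c y′ ⟧))))
        ≡⟨ ∑-cong Y (λ y → ∑-cong Y λ y′ → trans (∑-cong elems λ c → ∑-*ˡ elems (g y * g y′) _) (∑-*ˡ elems (g y * g y′) _)) ⟩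
      ∑ Y (λ y → ∑ Y (λ y′ → g y * g y′ * collision y y′))
        ≤⟨ ∑-mono Y (λ y → ∑-mono Y λ y′ → *-monoʳ-≤ (g y * g y′) (collision≤ (proj₁ y) (proj₂ y) (proj₁ y′) (proj₂ y′))) ⟩
      ∑ Y (λ y → ∑ Y (λ y′ → g y * g y′ * (p + p * rest y y′)))
        ≡⟨ ∑-cong Y (λ y → trans (∑-cong Y λ y′ → distribute (g y) (g y′) p (rest y y′)) (∑-+ Y _ _)) ⟩
      ∑ Y (λ y → ∑ Y (λ y′ → p * g y * g y′) + ∑ Y (λ y′ → p * (g y * g y′ * rest y y′)))
        ≡⟨ ∑-+ Y _ _ ⟩
      ∑ Y (λ y → ∑ Y (λ y′ → p * g y * g y′)) + ∑ Y (λ y → ∑ Y (λ y′ → p * (g y * g y′ * rest y y′)))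
        ≡⟨ cong₂ _+_ main-term (trans (∑-cong Y λ y → ∑-*ˡ Y p _) (∑-*ˡ Y p _)) ⟩
      p * (S * S) + p * ∑ Y (λ y → ∑ Y (λ y′ → g y * g y′ * rest y y′))
        ≤⟨ +-monoʳ-≤ (p * (S * S)) (*-monoʳ-≤ p diagonal) ⟩
      p * (S * S) + p * (β * (K * (#W * #W))) ∎
      where
      open ≤-Reasoning
      rest : F × Wd → F × Wd → ℕ
      rest (b , w) (b′ , w′) = ⟦ b′ ≟F b ⟧ * agree w w′
      distribute : ∀ a b p r → a * b * (p + p * r) ≡ p * a * b + p * (a * b * r)
      distribute = solve-∀
      main-term : ∑ Y (λ y → ∑ Y (λ y′ → p * g y * g y′)) ≡ p * (S * S)
      main-term = trans (∑-cong Y λ y → trans (∑-*ˡ Y (p * g y) g) (cong (p * g y *_) ∑g)) (trans (∑-*ʳ Y S _)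
        (trans (cong (_* S) (trans (∑-*ˡ Y p g) (cong (p *_) ∑g))) (*-assoc p S S)))
      agreements : ∑ W (λ w → ∑ W (agree w)) ≤ K * (#W * #W)
      agreements = ≤-trans (≤-reflexive (trans (∑-cong W λ w → sym (∑-swap elems W _)) (sym (∑-swap elems W _)))) energy≤
      diagonal : ∑ Y (λ y → ∑ Y (λ y′ → g y * g y′ * rest y y′)) ≤ β * (K * (#W * #W))
      diagonal = begin
        ∑ Y (λ y → ∑ Y (λ y′ → g y * g y′ * rest y y′))
          ≡⟨ trans (∑-cart elems W _) (∑-cong elems λ b → ∑-cong W λ w → ∑-cart elems W _) ⟩
        ∑ elems (λ b → ∑ W (λ w → ∑ elems (λ b′ → ∑ W (λ w′ → α b * α b′ * (⟦ b′ ≟F b ⟧ * agree w w′)))))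
          ≤⟨ ∑-mono elems (λ b → ∑-mono W λ w → ∑-mono elems λ b′ → ∑-mono W λ w′ →
               ≤-trans (*-monoˡ-≤ (⟦ b′ ≟F b ⟧ * agree w w′) (≤-trans (*-monoʳ-≤ (α b) (⟦⟧≤1 (B? b′))) (≤-reflexive (*-identityʳ (α b))))) (≤-reflexive (exchange (α b) ⟦ b′ ≟F b ⟧ (agree w w′)))) ⟩
        ∑ elems (λ b → ∑ W (λ w → ∑ elems (λ b′ → ∑ W (λ w′ → ⟦ b′ ≟F b ⟧ * (α b * agree w w′)))))
          ≡⟨ ∑-cong elems (λ b → ∑-cong W λ w → trans (∑-cong elems λ b′ → ∑-*ˡ W ⟦ b′ ≟F b ⟧ _) (trans (∑-*ʳ elems (∑ W (λ w′ → α b * agree w w′)) _) (trans (cong (_* ∑ W (λ w′ → α b * agree w w′)) (elems-enum b)) (*-identityˡ _)))) ⟩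
        ∑ elems (λ b → ∑ W (λ w → ∑ W (λ w′ → α b * agree w w′)))
          ≡⟨ trans (∑-cong elems λ b → trans (∑-cong W λ w → ∑-*ˡ W (α b) _) (∑-*ˡ W (α b) _)) (∑-*ʳ elems _ α) ⟩
        β * ∑ W (λ w → ∑ W (agree w))
          ≤⟨ *-monoʳ-≤ β agreements ⟩
        β * (K * (#W * #W)) ∎
        where
        exchange : ∀ a d r → a * (d * r) ≡ d * (a * r)
        exchange = solve-∀

    -- The number of solutions (b , b′ , w) of u b + u b′ + val c w = u target.
    solutions : F → F → ℕ
    solutions u c = ∑ elems (λ b → α b * P.push u c (u ⊗ (target ⊝ b)))

    -- The condition u ≠ 0 ensures that the β missed points u (target - b) are distinct.
    Bad : F → F → Set
    Bad u c = u ≢ 0F × solutions u c ≡ 0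

    Bad? : ∀ u → Decidable (Bad u)
    Bad? u c = ¬? (u ≟F 0F) ×-dec (solutions u c ≟ 0)

    -- Cauchy-Schwarz over all p points gives the bound without β. For a bad pair the sums avoid β
    -- points, and Cauchy-Schwarz over the remaining p - β points yields the gain.
    second≥ : ∀ u c → (p + β * ⟦ Bad? u c ⟧) * (S * S) ≤ p * p * second u c
    second≥ u c = by (Bad? u c)
      where
      open ≤-Reasoning
      q : F → ℕ
      q = P.push u c
      S≡ : ∑ elems q ≡ S
      S≡ = trans (P.push-total u c) ∑g
      by : (d : Dec (Bad u c)) → (p + β * ⟦ d ⟧) * (S * S) ≤ p * p * second u c
      by (no _) = ≤-trans (≤-reflexive (cong (λ z → (p + z) * (S * S)) (*-zeroʳ β))) (sharpen p 0 p (S * S) (second u c) (≤-reflexive (+-identityʳ p)) (begin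
        S * S                              ≡⟨ cong₂ _*_ (sym S≡) (sym S≡) ⟩
        ∑ elems q * ∑ elems q              ≤⟨ cauchy elems q (λ _ → 1) (λ _ → inj₂ ≤-refl) ⟩
        ∑ elems (λ _ → 1) * second u c     ≡⟨ cong (_* second u c) (trans (∑F-const 1) (*-identityʳ p)) ⟩
        p * second u c ∎))
      by (yes (u≢0 , none)) = ≤-trans (≤-reflexive (cong (λ z → (p + z) * (S * S)) (*-identityʳ β))) (sharpen p β (∑ elems s) (S * S) (second u c) s+β≤p (begin
        S * S                              ≡⟨ cong₂ _*_ (sym S≡) (sym S≡) ⟩
        ∑ elems q * ∑ elems q              ≤⟨ cauchy elems q s support ⟩
        ∑ elems s * second u c ∎))
        where
        ψ : F → F
        ψ x = target ⊝ inv u ⊗ x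
        uψ : ∀ x → u ⊗ (target ⊝ ψ x) ≡ x
        uψ x = trans (S.solve 4 (λ u t i x → u S.:* (t S.:- (t S.:- i S.:* x)) S.:= (u S.:* i) S.:* x) refl u target (inv u) x) (trans (cong (_⊗ x) (inv-right u≢0)) (⊗-identityˡ x))
        ψu : ∀ b → ψ (u ⊗ (target ⊝ b)) ≡ b
        ψu b = trans (S.solve 4 (λ u t i b → t S.:- i S.:* (u S.:* (t S.:- b)) S.:= t S.:- (u S.:* i) S.:* (t S.:- b)) refl u target (inv u) b)
          (trans (cong (λ z → target ⊝ z ⊗ (target ⊝ b)) (inv-right u≢0)) (trans (cong (target ⊝_) (⊗-identityˡ _)) (S.solve 2 (λ t b → t S.:- (t S.:- b) S.:= b) refl target b)))
        s : F → ℕ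
        s x = 1 ∸ α (ψ x)
        zero-at : ∀ b → B b → q (u ⊗ (target ⊝ b)) ≡ 0
        zero-at b Bb = n≤0⇒n≡0 (begin
          q (u ⊗ (target ⊝ b))                                       ≡⟨ sym (*-identityˡ _) ⟩
          1 * q (u ⊗ (target ⊝ b))                                   ≡⟨ cong (_* q (u ⊗ (target ⊝ b))) (sym (⟦⟧-true (B? b) Bb)) ⟩
          α b * q (u ⊗ (target ⊝ b))                                 ≡⟨ sym (∑-pick _≟F_ {elems} elems-enum (λ b → α b * q (u ⊗ (target ⊝ b))) b) ⟩
          ∑ elems (λ x → ⟦ x ≟F b ⟧ * (α x * q (u ⊗ (target ⊝ x))))  ≤⟨ ∑-mono elems (λ x → ≤-trans (*-monoˡ-≤ _ (⟦⟧≤1 (x ≟F b))) (≤-reflexive (*-identityˡ _))) ⟩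
          solutions u c                                              ≡⟨ none ⟩
          0 ∎)
        support : ∀ x → q x ≡ 0 ⊎ 1 ≤ s x
        support x = at (B? (ψ x)) refl
          where
          at : (d : Dec (B (ψ x))) → d ≡ B? (ψ x) → q x ≡ 0 ⊎ 1 ≤ s x
          at (yes Bx) _ = inj₁ (trans (cong q (sym (uψ x))) (zero-at (ψ x) Bx))
          at (no ¬Bx) _ = inj₂ (1∸⟦⟧ (B? (ψ x)) ¬Bx)
        β≤ : β ≤ ∑ elems (λ x → α (ψ x))
        β≤ = ∑-inject _≟F_ elems {elems} elems-enum B? (λ x → B? (ψ x)) (λ b → u ⊗ (target ⊝ b)) injective (λ b Bb → subst B (sym (ψu b)) Bb)
          where
          injective : ∀ x → ∑ elems (λ b → ⟦ B? b ⟧ * ⟦ x ≟F u ⊗ (target ⊝ b) ⟧) ≤ 1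
          injective x = ≤-trans (∑-mono elems λ b → ≤-trans (*-monoˡ-≤ ⟦ x ≟F u ⊗ (target ⊝ b) ⟧ (⟦⟧≤1 (B? b))) (≤-trans (≤-reflexive (*-identityˡ _))
            (⟦⟧-mono (x ≟F u ⊗ (target ⊝ b)) (b ≟F ψ x) λ e → trans (sym (ψu b)) (cong ψ (sym e))))) (≤-reflexive (elems-enum (ψ x)))
        s+β≤p : ∑ elems s + β ≤ p
        s+β≤p = begin
          ∑ elems s + β                                   ≤⟨ +-monoʳ-≤ (∑ elems s) β≤ ⟩
          ∑ elems s + ∑ elems (λ x → α (ψ x))             ≡⟨ +-comm (∑ elems s) _ ⟩
          ∑ elems (λ x → α (ψ x)) + ∑ elems s             ≡⟨ sym (∑-split elems (λ x → B? (ψ x))) ⟩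
          length elems                                    ≡⟨ length-elems ⟩
          p ∎

    bad : ℕ
    bad = ∑ elems (λ u → ∑ elems (λ c → ⟦ Bad? u c ⟧))

    -- On summing `second≥` over all pairs and comparing with `T≤`, the main terms p³ S² cancel, so
    -- the gain from the bad pairs is bounded by the energy term alone.
    few-bad : 0 < β → β * β * bad ≤ K * (p * p * p)
    few-bad β>0 = *-cancelˡ-≤ (β * (#W * #W)) {{>-nonZero (*-mono-≤ β>0 (*-mono-≤ #W>0 #W>0))}} (+-cancelˡ-≤ (p * p * p * (S * S)) _ _ (begin
      p * p * p * (S * S) + β * (#W * #W) * (β * β * bad)                     ≡⟨ regroup p β #W bad ⟩
      (p * (p * p) + β * bad) * (S * S)                                       ≡⟨ cong (_* (S * S)) (cong₂ _+_ (sym (trans (∑F-const (p * p)) refl)) (sym (∑-*ˡ elems β _))) ⟩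
      (∑ elems (λ u → p * p) + ∑ elems (λ u → β * ∑ elems (λ c → ⟦ Bad? u c ⟧))) * (S * S)
        ≡⟨ cong (_* (S * S)) (sym (trans (∑-cong elems λ u → trans (∑-+ elems _ _) (cong₂ _+_ (∑F-const p) (∑-*ˡ elems β _))) (∑-+ elems _ _))) ⟩
      ∑ elems (λ u → ∑ elems (λ c → p + β * ⟦ Bad? u c ⟧)) * (S * S)
        ≡⟨ sym (trans (∑-cong elems λ u → ∑-*ʳ elems (S * S) _) (∑-*ʳ elems (S * S) _)) ⟩
      ∑ elems (λ u → ∑ elems (λ c → (p + β * ⟦ Bad? u c ⟧) * (S * S)))        ≤⟨ ∑-mono elems (λ u → ∑-mono elems λ c → second≥ u c) ⟩
      ∑ elems (λ u → ∑ elems (λ c → p * p * second u c))                      ≡⟨ trans (∑-cong elems λ u → ∑-*ˡ elems (p * p) _) (∑-*ˡ elems (p * p) _) ⟩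
      p * p * ∑ elems (λ u → ∑ elems (λ c → second u c))                      ≡⟨ cong (p * p *_) (∑-swap elems elems _) ⟩
      p * p * T                                                               ≤⟨ *-monoʳ-≤ (p * p) T≤ ⟩
      p * p * (p * (S * S) + p * (β * (K * (#W * #W))))                       ≡⟨ final p (S * S) β K (#W * #W) ⟩
      p * p * p * (S * S) + β * (#W * #W) * (K * (p * p * p)) ∎))
      where
      open ≤-Reasoning
      regroup : ∀ p β W n → p * p * p * (β * W * (β * W)) + β * (W * W) * (β * β * n) ≡ (p * (p * p) + β * n) * (β * W * (β * W))
      regroup = solve-∀
      final : ∀ p s β K w → p * p * (p * s + p * (β * (K * w))) ≡ p * p * p * s + β * w * (K * (p * p * p))
      final = solve-∀

    record Solution (u c : F) : Set where
      constructor solution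
      field
        b b′ : F
        w : Wd
        Bb : B b
        Bb′ : B b′
        equation : u ⊗ (target ⊝ b′) ≡ u ⊗ b ⊕ val c w

    not-bad : ∀ u c → u ≢ 0F → ¬ Bad u c → Solution u c
    not-bad u c u≢0 ¬bad = outer (∑-positive elems _ (n≢0⇒n>0 λ e → ¬bad (u≢0 , e)))
      where
      positive-factors : ∀ a b → 0 < a * b → 0 < a × 0 < b
      positive-factors (suc a) zero    pos = contradiction (subst (0 <_) (*-zeroʳ (suc a)) pos) λ ()
      positive-factors (suc a) (suc b) pos = s≤s z≤n , s≤s z≤n
      outer : (∃ λ b′ → 0 < α b′ * P.push u c (u ⊗ (target ⊝ b′))) → Solution u c
      outer (b′ , pos) = inner (∑-positive Y _ (proj₂ (positive-factors (α b′) _ pos)))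
        where
        inner : (∃ λ y → 0 < g y * ⟦ u ⊗ (target ⊝ b′) ≟F φ u c y ⟧) → Solution u c
        inner ((b , w) , pos′) = solution b b′ w (⟦⟧>0 (B? b) (proj₁ (positive-factors (α b) _ pos′))) (⟦⟧>0 (B? b′) (proj₁ (positive-factors (α b′) _ pos)))
          (⟦⟧>0 (_ ≟F _) (proj₂ (positive-factors (α b) _ pos′)))

-- Third range: sums of reciprocals over long intervals.

∑-reindex : {A : Set} (_≟A_ : DecidableEquality A) {xs : List A} → Enumeration _≟A_ xs → {B : Set} (ys : List B) (φ : B → A) →
            (∀ a → ∑ ys (λ y → ⟦ a ≟A φ y ⟧) ≤ 1) → (f : A → ℕ) → ∑ ys (f ∘ φ) ≤ ∑ xs f
∑-reindex _≟A_ {xs} en ys φ inj f = begin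
  ∑ ys (f ∘ φ)                                        ≡⟨ ∑-cong ys (λ y → sym (∑-pick _≟A_ {xs} en f (φ y))) ⟩
  ∑ ys (λ y → ∑ xs (λ x → ⟦ x ≟A φ y ⟧ * f x))        ≡⟨ ∑-swap ys xs _ ⟩
  ∑ xs (λ x → ∑ ys (λ y → ⟦ x ≟A φ y ⟧ * f x))        ≡⟨ ∑-cong xs (λ x → ∑-*ʳ ys (f x) _) ⟩
  ∑ xs (λ x → ∑ ys (λ y → ⟦ x ≟A φ y ⟧) * f x)        ≤⟨ ∑-mono xs (λ x → ≤-trans (*-monoˡ-≤ (f x) (inj x)) (≤-reflexive (*-identityˡ (f x)))) ⟩
  ∑ xs f ∎
  where open ≤-Reasoning

∑-rng-injective : {A : Set} (_≟A_ : DecidableEquality A) (n : ℕ) (φ : ℕ → A) → (∀ i j → i < n → j < n → φ i ≡ φ j → i ≡ j) →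
                  ∀ a → ∑ (rng n) (λ i → ⟦ a ≟A φ i ⟧) ≤ 1
∑-rng-injective _≟A_ zero    φ inj a = z≤n
∑-rng-injective _≟A_ (suc n) φ inj a with a ≟A φ n
... | no _     = ∑-rng-injective _≟A_ n φ (λ i j i<n j<n → inj i j (m<n⇒m<1+n i<n) (m<n⇒m<1+n j<n)) a
... | yes refl = s≤s (≤-trans (∑-rng-mono n λ i i<n → ≤-reflexive (⟦⟧-false (φ n ≟A φ i) λ e → <⇒≢ i<n (sym (inj n i ≤-refl (m<n⇒m<1+n i<n) e))))
                   (≤-reflexive (trans (∑-rng-const n 0) (*-zeroʳ n))))

module Large (p : ℕ) (p-prime : Prime p) where
  open PrimeField p p-prime
  open RationalFunctions p p-prime
  open Ratios p p-prime
  open Dilations p p-prime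
  open Intervals p p-prime

  recipSum : ∀ {n} → ℕ → Vec ℕ n → F
  recipSum a []      = 0F
  recipSum a (j ∷ v) = inv (ι (a + j)) ⊕ recipSum a v

  recipSum-++ : ∀ {m n} a (v : Vec ℕ m) (w : Vec ℕ n) → recipSum a (v Vec.++ w) ≡ recipSum a v ⊕ recipSum a w
  recipSum-++ a []      w = sym (⊕-identityˡ _)
  recipSum-++ a (j ∷ v) w = trans (cong (inv (ι (a + j)) ⊕_) (recipSum-++ a v w)) (sym (⊕-assoc _ _ _))

  Reciprocals : (a N n : ℕ) → F → Set
  Reciprocals a N n x = Σ (Vec ℕ n) λ v → VAll.All (_< N) v × recipSum a v ≡ x

  reciprocals-⊕ : ∀ {a N m n x y} → Reciprocals a N m x → Reciprocals a N n y → Reciprocals a N (m + n) (x ⊕ y)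
  reciprocals-⊕ {a} (v , bv , ev) (w , bw , ew) = v Vec.++ w , VAllₚ.++⁺ bv bw , trans (recipSum-++ a v w) (cong₂ _⊕_ ev ew)

  module Group (a N V : ℕ) (zf : ZeroFree a N) (c : F) (j u : ℕ) (u>0 : 0 < u) (cu : ι u ⊗ c ≡ ι (a + j)) where

    positions : ∀ {k} → ℕ → Vec (Entry 1 V) k → Vec ℕ k
    positions s []            = []
    positions s ((_ , t) ∷ w) = j + (s + toℕ t) * u ∷ positions (s + V) w

    denominator : ∀ s → ι (a + (j + s * u)) ≡ ι u ⊗ (c ⊕ ι s)
    denominator s = begin
      ι (a + (j + s * u))          ≡⟨ cong ι (sym (+-assoc a j _)) ⟩
      ι (a + j + s * u)            ≡⟨ ι-+ (a + j) _ ⟩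
      ι (a + j) ⊕ ι (s * u)        ≡⟨ cong₂ _⊕_ (sym cu) (ι-* s u) ⟩
      ι u ⊗ c ⊕ ι s ⊗ ι u          ≡⟨ S.solve 3 (λ u c s → u S.:* c S.:+ s S.:* u S.:= u S.:* (c S.:+ s)) refl (ι u) c (ι s) ⟩
      ι u ⊗ (c ⊕ ι s) ∎
      where open ≡-Reasoning

    position< : ∀ {k} s (t : Fin V) → j + (s + suc k * V) * u ≤ N → j + (s + toℕ t) * u < N
    position< {k} s t fit = <-≤-trans (+-monoʳ-< j (*-monoˡ-< u {{>-nonZero u>0}} (+-monoʳ-< s (<-≤-trans (toℕ<n t) (m≤m+n V (k * V)))))) fit

    fit-next : ∀ {k} s → j + (s + suc k * V) * u ≤ N → j + (s + V + k * V) * u ≤ N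
    fit-next {k} s = subst (λ z → j + z * u ≤ N) (sym (+-assoc s V (k * V)))

    positions-bounded : ∀ {k} s (w : Vec (Entry 1 V) k) → j + (s + k * V) * u ≤ N → VAll.All (_< N) (positions s w)
    positions-bounded s [] _ = []
    positions-bounded {suc k} s ((_ , t) ∷ w) fit = position< {k} s t fit ∷ positions-bounded (s + V) w (fit-next {k} s fit)

    recipSum-positions : ∀ {k} s (w : Vec (Entry 1 V) k) → j + (s + k * V) * u ≤ N → recipSum a (positions s w) ≡ inv (ι u) ⊗ fracSum (terms s w) c
    recipSum-positions s [] _ = sym (⊗-zeroʳ _)
    recipSum-positions {suc k} s ((zero , t) ∷ w) fit = trans
      (cong₂ _⊕_ (trans (cong inv (denominator (s + toℕ t))) (inv-⊗ ιu≢0 c+v≢0)) (recipSum-positions (s + V) w (fit-next {k} s fit)))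
      (S.solve 3 (λ i k f → i S.:* k S.:+ i S.:* f S.:= i S.:* (S.con (ℤ.+ 1) S.:* k S.:+ f)) refl (inv (ι u)) (inv (c ⊕ ι (s + toℕ t))) (fracSum (terms (s + V) w) c))
      where
      nonzero : ι u ⊗ (c ⊕ ι (s + toℕ t)) ≢ 0F
      nonzero e = zf _ (position< {k} s t fit) (trans (denominator (s + toℕ t)) e)
      ιu≢0 : ι u ≢ 0F
      ιu≢0 e = nonzero (trans (cong (_⊗ (c ⊕ ι (s + toℕ t))) e) (⊗-zeroˡ _))
      c+v≢0 : c ⊕ ι (s + toℕ t) ≢ 0F
      c+v≢0 e = nonzero (trans (cong (ι u ⊗_) e) (⊗-zeroʳ _))

    group : ∀ {k} (w : Vec (Entry 1 V) k) → j + k * V * u ≤ N → Reciprocals a N k (inv (ι u) ⊗ fracSum (terms 0 w) c)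
    group w fit = positions 0 w , positions-bounded 0 w fit , recipSum-positions 0 w fit

  -- A: sums of four reciprocals along the progressions given by one good ratio; target = A + (four more) + A.
  module Cover (a N V : ℕ) (zf : ZeroFree a N) (4V≤p : 4 * V ≤ p) (p≤V⁴ : p ≤ V ^ 4)
               (n₂ U₂ : ℕ) (n₂<p : n₂ < p) (U₂<p : U₂ < p) (fit₂ : n₂ + 4 * V * U₂ ≤ N)
               (c₁ : F) (j₁ u₁ : ℕ) (u₁>0 : 0 < u₁) (ιu₁≢0 : ι u₁ ≢ 0F) (cu₁ : ι u₁ ⊗ c₁ ≡ ι (a + j₁)) (fit₁ : j₁ + 4 * V * u₁ ≤ N) where

    module E = Energy p p-prime 1 V 4 1<p 4V≤p
    open Images p p-prime 1 V 4 1<p 4V≤p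
    open Hits a n₂ n₂<p

    V⁴≡ : length (words 1 V 4) ≡ V ^ 4
    V⁴≡ = trans (length-words 1 V 4) (cong (_^ 4) (*-identityˡ V))

    p≤#W : p ≤ E.#W
    p≤#W = ≤-trans p≤V⁴ (≤-reflexive (sym V⁴≡))

    -- 17 = 1 + 4·4, the 1 from the diagonal because p ≤ `#W`.
    energy≤ : ∑ elems E.energy ≤ 17 * (E.#W * E.#W)
    energy≤ = begin
      ∑ elems E.energy                      ≡⟨ ∑-cong elems (λ c → sym (*-identityˡ _)) ⟩
      ∑ elems (λ c → 1 * E.energy c)        ≤⟨ E.energy-total (λ _ → 1) (λ _ → ≤-refl) ⟩
      E.#W * (∑ elems (λ _ → 1) + 16 * E.#W) ≤⟨ *-monoʳ-≤ E.#W (+-monoˡ-≤ (16 * E.#W) (≤-trans (≤-reflexive (trans (∑F-const 1) (*-identityʳ p))) p≤#W)) ⟩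
      E.#W * (E.#W + 16 * E.#W)             ≡⟨ collect E.#W ⟩
      17 * (E.#W * E.#W) ∎
      where
      open ≤-Reasoning
      collect : ∀ w → w * (w + 16 * w) ≡ 17 * (w * w)
      collect = solve-∀

    -- Multiplying x = (b + b′)/u₁ + v/(u+1) by u + 1 dilates the set A by this factor. Different u
    -- give different dilations, so the bad pairs met on the way are among those counted by `bad`.
    slope : ℕ → F
    slope u = ι (suc u) ⊗ inv (ι u₁)

    slope-injective : ∀ i j → i < U₂ → j < U₂ → slope i ≡ slope j → i ≡ j
    slope-injective i j i< j< e = suc-injective (ι-inj (≤-<-trans i< U₂<p) (≤-<-trans j< U₂<p)
      (⊗-cancelˡ (inv-≢0 ιu₁≢0) (trans (⊗-comm _ _) (trans e (⊗-comm _ _)))))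

    module _ (x : F) where
      module Var = Variance E.W E.value (InImage? c₁) 17 energy≤ (<-≤-trans (<-trans (s≤s z≤n) 1<p) p≤#W) (ι u₁ ⊗ x)

      open Var using (β; bad; Bad?; Solution; solution)

      -- At least `U₂ * n₂` pairs (u, c) hit the interval, while fewer are bad; hence some pair hits
      -- and is not bad. Pairs are counted here, so coinciding ratios for different u do no harm.
      exists : 0 < β → 17 * (p * p * p) < β * β * (U₂ * n₂) → ∃ λ u → u < U₂ × ∃ λ c → Hit c u × Solution (slope u) c
      exists β>0 big = pick (∑-rng-find U₂ (<-≤-trans (≤-<-trans bad≥ bad<) hits≥))
        where
        bad≥ : ∑ (rng U₂) (λ u → ∑ elems (λ c → ⟦ Bad? (slope u) c ⟧)) ≤ bad
        bad≥ = ∑-reindex _≟F_ {elems} elems-enum (rng U₂) slope (∑-rng-injective _≟F_ U₂ slope slope-injective) (λ u → ∑ elems (λ c → ⟦ Bad? u c ⟧))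
        bad< : bad < U₂ * n₂
        bad< = *-cancelˡ-< (β * β) bad (U₂ * n₂) (≤-<-trans (Var.few-bad β>0) big)
        hits≥ : U₂ * n₂ ≤ ∑ (rng U₂) (λ u → ∑ elems (λ c → ⟦ Hit? c u ⟧))
        hits≥ = ≤-trans (≤-reflexive (sym (∑-rng-const U₂ n₂))) (∑-rng-mono U₂ λ u u<U → N≤hits u (≤-<-trans u<U U₂<p))
        pick : (∃ λ u → u < U₂ × ∑ elems (λ c → ⟦ Bad? (slope u) c ⟧) < ∑ elems (λ c → ⟦ Hit? c u ⟧)) → ∃ λ u → u < U₂ × ∃ λ c → Hit c u × Solution (slope u) c
        pick (u , u<U , lt) = at (∑-find elems lt)
          where
          at : (∃ λ c → ⟦ Bad? (slope u) c ⟧ < ⟦ Hit? c u ⟧) → ∃ λ u → u < U₂ × ∃ λ c → Hit c u × Solution (slope u) c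
          at (c , lt) = u , u<U , c , ⟦⟧>0 (Hit? c u) (≤-<-trans z≤n lt) ,
            Var.not-bad (slope u) c (⊗-≢0 (ι≢0 (s≤s z≤n) (≤-<-trans u<U U₂<p)) (inv-≢0 ιu₁≢0))
              (λ b → <⇒≱ lt (≤-trans (⟦⟧≤1 (Hit? c u)) (≤-reflexive (sym (⟦⟧-true (Bad? (slope u) c) b)))))

      cover : 0 < β → 17 * (p * p * p) < β * β * (U₂ * n₂) → Reciprocals a N 12 x
      cover β>0 big = build (exists β>0 big)
        where
        build : (∃ λ u → u < U₂ × ∃ λ c → Hit c u × Solution (slope u) c) → Reciprocals a N 12 x
        build (u , u<U , c , hit , solution b b′ w Bb Bb′ eq) = assemble (image-word c₁ b Bb) (image-word c₁ b′ Bb′)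
          where
          module G₁ = Group a N V zf c₁ j₁ u₁ u₁>0 cu₁
          module G₂ = Group a N V zf c _ (suc u) (s≤s z≤n) (hit-eq c u)
          v : F
          v = fracSum (terms 0 w) c
          fit′ : rep (ι (suc u) ⊗ c ⊝ ι a) + 4 * V * suc u ≤ N
          fit′ = ≤-trans (+-mono-≤ (<⇒≤ hit) (*-monoʳ-≤ (4 * V) u<U)) fit₂
          i₁ i₂ : F
          i₁ = inv (ι u₁)
          i₂ = inv (ι (suc u))
          total : (i₁ ⊗ b ⊕ i₁ ⊗ b′) ⊕ i₂ ⊗ v ≡ x
          total = begin
            (i₁ ⊗ b ⊕ i₁ ⊗ b′) ⊕ i₂ ⊗ v
              ≡⟨ cong (λ z → (i₁ ⊗ b ⊕ i₁ ⊗ b′) ⊕ i₂ ⊗ z) value-w ⟩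
            (i₁ ⊗ b ⊕ i₁ ⊗ b′) ⊕ i₂ ⊗ (ι (suc u) ⊗ i₁ ⊗ (ι u₁ ⊗ x ⊝ b′ ⊝ b))
              ≡⟨ S.solve 7 (λ i₁ i₂ u u₁ b b′ x → (i₁ S.:* b S.:+ i₁ S.:* b′) S.:+ i₂ S.:* (u S.:* i₁ S.:* (u₁ S.:* x S.:- b′ S.:- b))
                     S.:= i₁ S.:* b S.:+ i₁ S.:* b′ S.:+ (u S.:* i₂) S.:* ((u₁ S.:* i₁) S.:* x S.:- i₁ S.:* b′ S.:- i₁ S.:* b)) refl i₁ i₂ (ι (suc u)) (ι u₁) b b′ x ⟩
            i₁ ⊗ b ⊕ i₁ ⊗ b′ ⊕ (ι (suc u) ⊗ i₂) ⊗ ((ι u₁ ⊗ i₁) ⊗ x ⊝ i₁ ⊗ b′ ⊝ i₁ ⊗ b)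
              ≡⟨ cong₂ (λ y z → i₁ ⊗ b ⊕ i₁ ⊗ b′ ⊕ y ⊗ (z ⊗ x ⊝ i₁ ⊗ b′ ⊝ i₁ ⊗ b)) (inv-right (ι≢0 (s≤s z≤n) (≤-<-trans u<U U₂<p))) (inv-right ιu₁≢0) ⟩
            i₁ ⊗ b ⊕ i₁ ⊗ b′ ⊕ 1F ⊗ (1F ⊗ x ⊝ i₁ ⊗ b′ ⊝ i₁ ⊗ b)
              ≡⟨ S.solve 4 (λ i₁ b b′ x → i₁ S.:* b S.:+ i₁ S.:* b′ S.:+ S.con (ℤ.+ 1) S.:* (S.con (ℤ.+ 1) S.:* x S.:- i₁ S.:* b′ S.:- i₁ S.:* b) S.:= x) refl i₁ b b′ x ⟩
            x ∎
            where
            open ≡-Reasoning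
            value-w : v ≡ ι (suc u) ⊗ i₁ ⊗ (ι u₁ ⊗ x ⊝ b′ ⊝ b)
            value-w = begin
              v                                                   ≡⟨ S.solve 2 (λ e v → v S.:= (e S.:+ v) S.:- e) refl (slope u ⊗ b) v ⟩
              (slope u ⊗ b ⊕ v) ⊝ slope u ⊗ b                     ≡⟨ cong (_⊝ slope u ⊗ b) (sym eq) ⟩
              slope u ⊗ (ι u₁ ⊗ x ⊝ b′) ⊝ slope u ⊗ b             ≡⟨ S.solve 4 (λ s y b b′ → s S.:* (y S.:- b′) S.:- s S.:* b S.:= s S.:* (y S.:- b′ S.:- b)) refl (slope u) (ι u₁ ⊗ x) b b′ ⟩
              slope u ⊗ (ι u₁ ⊗ x ⊝ b′ ⊝ b) ∎
          assemble : (∃ λ w → b ≡ value c₁ w) → (∃ λ w → b′ ≡ value c₁ w) → Reciprocals a N 12 x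
          assemble (w₁ , e₁) (w₂ , e₂) = subst (Reciprocals a N 12) (trans (cong₂ (λ y z → (i₁ ⊗ y ⊕ i₁ ⊗ z) ⊕ i₂ ⊗ v) (sym e₁) (sym e₂)) total)
            (reciprocals-⊕ (reciprocals-⊕ (G₁.group w₁ fit₁) (G₁.group w₂ fit₁)) (G₂.group w fit′))

  -- The two sets of parameters serve different purposes. For A many distinct ratios are wanted,
  -- which are guaranteed only while `2 * (U₁ * n₁)` is at most p; for B only the number of pairs
  -- counts, so `U₂` may be as large as the length of the interval permits.
  large-range : ∀ a N V n₁ U₁ n₂ U₂ X₀ → ZeroFree a N → 4 * V ≤ p → p ≤ V ^ 4 →
                0 < U₁ → U₁ ≤ n₁ → n₁ + 4 * V * U₁ ≤ N → 2 * (U₁ * n₁) ≤ p → 21 * X₀ ≤ U₁ * n₁ →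
                n₂ < p → U₂ < p → n₂ + 4 * V * U₂ ≤ N →
                17 * (17 * (17 * (p * p * p))) < X₀ * X₀ * (U₂ * n₂) → ∀ x → Reciprocals a N 12 x
  large-range a N V n₁ U₁ n₂ U₂ X₀ zf 4V≤p p≤V⁴ U₁>0 U₁≤n₁ fit₁ 2Un≤p 21X₀≤ n₂<p U₂<p fit₂ big x =
    choose (large-image Ratio? ratios refl ratios>0 (<-≤-trans (<-trans (s≤s z≤n) 1<p) p≤#W))
    where
    open ≤-Reasoning
    n₁>0 : 0 < n₁
    n₁>0 = <-≤-trans U₁>0 U₁≤n₁
    U₁<p : U₁ < p
    U₁<p = <-≤-trans (m<m+n U₁ {U₁ + 0} (≤-trans U₁>0 (m≤m+n U₁ 0))) (≤-trans (*-monoʳ-≤ 2 (m≤m*n U₁ n₁ {{>-nonZero n₁>0}})) 2Un≤p)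
    open RatioSet a n₁ U₁ U₁≤n₁ U₁>0 2Un≤p U₁<p
    open Images p p-prime 1 V 4 1<p 4V≤p
    ratios>0 : 0 < ratios
    ratios>0 = *-cancelˡ-< 21 0 ratios (<-≤-trans (*-mono-≤ U₁>0 n₁>0) ratios-bound)
    X₀≤ratios : X₀ ≤ ratios
    X₀≤ratios = *-cancelˡ-≤ 21 (≤-trans 21X₀≤ ratios-bound)
    ratios≤p : ratios ≤ p
    ratios≤p = ≤-trans (∑-mono elems λ c → ⟦⟧≤1 (Ratio? c)) (≤-reflexive (trans (∑F-const 1) (*-identityʳ p)))
    p≤#W : p ≤ #W
    p≤#W = ≤-trans p≤V⁴ (≤-reflexive (sym (trans #W≡ (cong (_^ 4) (*-identityˡ V)))))
    choose : (∃ λ c → 1 ≤ ν c × (ratios * #W ≤ image c * (ratios + 4 * 4 * #W))) → Reciprocals a N 12 x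
    choose (c , νc , large) = use (∑-rng-witness U₁ (Hit? c) νc)
      where
      β = image c
      ratios≤17β : ratios ≤ 17 * β
      ratios≤17β = *-cancelʳ-≤ ratios (17 * β) #W {{>-nonZero (<-≤-trans (<-trans (s≤s z≤n) 1<p) p≤#W)}} (begin
        ratios * #W                  ≤⟨ large ⟩
        β * (ratios + 4 * 4 * #W)    ≤⟨ *-monoʳ-≤ β (+-monoˡ-≤ (4 * 4 * #W) (≤-trans ratios≤p p≤#W)) ⟩
        β * (#W + 4 * 4 * #W)        ≡⟨ collect β #W ⟩
        17 * β * #W ∎)
        where
        collect : ∀ b w → b * (w + 4 * 4 * w) ≡ 17 * b * w
        collect = solve-∀
      β>0 : 0 < β
      β>0 = *-cancelˡ-< 17 0 β (<-≤-trans ratios>0 ratios≤17β)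
      enough : 17 * (p * p * p) < β * β * (U₂ * n₂)
      enough = *-cancelˡ-< (17 * 17) (17 * (p * p * p)) (β * β * (U₂ * n₂)) (begin-strict
        17 * 17 * (17 * (p * p * p))          ≡⟨ *-assoc 17 17 (17 * (p * p * p)) ⟩
        17 * (17 * (17 * (p * p * p)))        <⟨ big ⟩
        X₀ * X₀ * (U₂ * n₂)                   ≤⟨ *-monoˡ-≤ (U₂ * n₂) (*-mono-≤ (≤-trans X₀≤ratios ratios≤17β) (≤-trans X₀≤ratios ratios≤17β)) ⟩
        17 * β * (17 * β) * (U₂ * n₂)         ≡⟨ collect β (U₂ * n₂) ⟩
        17 * 17 * (β * β * (U₂ * n₂)) ∎)
        where
        collect : ∀ b n → 17 * b * (17 * b) * n ≡ 17 * 17 * (b * b * n)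
        collect = solve-∀
      use : (∃ λ u → u < U₁ × Hit c u) → Reciprocals a N 12 x
      use (u , u<U , hit) = Cover.cover a N V zf 4V≤p p≤V⁴ n₂ U₂ n₂<p U₂<p fit₂ c _ (suc u) (s≤s z≤n)
        (ι≢0 (s≤s z≤n) (≤-<-trans u<U U₁<p)) (hit-eq c u) (≤-trans (+-mono-≤ (<⇒≤ hit) (*-monoʳ-≤ (4 * V) u<U)) fit₁) x β>0 enough

-- Coprimality without prime factorisation, and a small integer coprime to d.

coprime-*ʳ : ∀ {u m n} → Coprime u m → Coprime u n → Coprime u (m * n)
coprime-*ʳ um un {e} (e∣u , e∣mn) = un (e∣u , coprime-divisor (λ (f∣e , f∣m) → um (∣-trans f∣e e∣u , f∣m)) e∣mn)

coprime-∣ʳ : ∀ {u m n} → m ∣ n → Coprime u n → Coprime u m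
coprime-∣ʳ m∣n un (e∣u , e∣m) = un (e∣u , ∣-trans e∣m m∣n)

coprime-1+* : ∀ d k → Coprime (1 + d * k) d
coprime-1+* d k {e} (e∣ , e∣d) = ∣1⇒≡1 (∣m+n∣m⇒∣n (subst (e ∣_) (+-comm 1 (d * k)) e∣) (∣m⇒∣m*n k e∣d))

coprime-^ˡ : ∀ {q d} e → Coprime q d → Coprime (q ^ e) d
coprime-^ˡ zero    c (e∣1 , _) = ∣1⇒≡1 e∣1
coprime-^ˡ {q} (suc e) c = Cop.sym (coprime-*ʳ (Cop.sym c) (Cop.sym (coprime-^ˡ e c)))

-- B collects the prime powers of d at primes not dividing a; `⊥d` says, without mentioning primes,
-- that every prime of d divides a or B.
record CoprimePart (a d : ℕ) : Set where
  constructor coprimePart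
  field
    B : ℕ
    B∣d : B ∣ d
    a⊥B : Coprime a B
    ⊥d : ∀ {u} → Coprime u a → Coprime u B → Coprime u d

-- Dividing d by gcd(a, d) removes only primes of a; repeating this until the gcd is 1 leaves B.
coprime-part : ∀ a d → 0 < d → CoprimePart a d
coprime-part a = <-rec (λ d → 0 < d → CoprimePart a d) λ d rec d>0 → go d rec d>0
  where
  go : ∀ d → (∀ {e} → e < d → 0 < e → CoprimePart a e) → 0 < d → CoprimePart a d
  go d rec d>0 with gcd a d in eq | gcd[m,n]∣m a d | gcd[m,n]∣n a d
  ... | zero          | _   | _ = contradiction eq (gcd[m,n]≢0 a d (inj₂ (>⇒≢ d>0)))
  ... | suc zero      | _   | _ = coprimePart d ∣-refl (gcd≡1⇒coprime eq) λ _ ud → ud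
  ... | g@(suc (suc _)) | g∣a | divides d′ d≡ = lift (rec d′<d d′>0)
    where
    d′>0 : 0 < d′
    d′>0 = n≢0⇒n>0 λ { refl → >⇒≢ d>0 d≡ }
    d′<d : d′ < d
    d′<d = <-≤-trans (m<m*n d′ g {{>-nonZero d′>0}} (s≤s (s≤s z≤n))) (≤-reflexive (sym d≡))
    lift : CoprimePart a d′ → CoprimePart a d
    lift (coprimePart B B∣d′ a⊥B ⊥d′) = coprimePart B (∣-trans B∣d′ (divides g (trans d≡ (*-comm d′ g)))) a⊥B
      λ ua uB → subst (Coprime _) (sym d≡) (coprime-*ʳ (⊥d′ ua uB) (coprime-∣ʳ g∣a ua))

coprime-+* : ∀ {r d B} → Coprime r d → Coprime r B → Coprime (r + d * B) r
coprime-+* {r} rd rB {e} (e∣ , e∣r) = coprime-*ʳ rd rB (e∣r , ∣m+n∣m⇒∣n e∣ e∣r)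

-- The shift is the part B of L coprime to r. A prime of L divides exactly one of r and B; as r is
-- coprime to d, it divides exactly one of r and dB, hence not their sum.
coprime-shift : ∀ {r d} L → 0 < L → Coprime r d → ∃ λ h → h ≤ L × Coprime (r + d * h) L
coprime-shift {r} {d} L L>0 rd with coprime-part r L L>0
... | coprimePart B B∣L r⊥B ⊥L = B , ∣⇒≤ {{>-nonZero L>0}} B∣L ,
      ⊥L (coprime-+* rd r⊥B) λ {e} (e∣ , e∣B) → r⊥B (∣m+n∣m⇒∣n (subst (e ∣_) (+-comm r (d * B)) e∣) (∣n⇒∣m*n d e∣B) , e∣B)

floor-search : (f : ℕ → ℕ) (q n : ℕ) → f 0 ≤ q → q < f n → ∃ λ T → f T ≤ q × q < f (suc T)
floor-search f q zero    f0≤ q<   = contradiction q< (≤⇒≯ f0≤)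
floor-search f q (suc n) f0≤ q<   with f n ≤? q
... | yes fn≤ = n , fn≤ , q<
... | no fn>  = floor-search f q n f0≤ (≰⇒> fn>)

least-coprime : ∀ d → 0 < d → ∃ λ q → 2 ≤ q × Coprime q d × (∀ w → 2 ≤ w → w < q → ¬ Coprime w d)
-- d + 1 is coprime to d, so a search from 2 needs at most d - 1 steps.
least-coprime d d>0 = ascend (d ∸ 1) 2 ≤-refl (λ w 2≤w w<2 _ → <⇒≱ w<2 2≤w) (subst (λ z → Coprime z d) (d+1 d d>0) (coprime-1+* d 1))
  where
  d+1 : ∀ d → 0 < d → 1 + d * 1 ≡ 2 + (d ∸ 1)
  d+1 (suc d) _ = cong (2 +_) (*-identityʳ d)
  ascend : ∀ fuel q → 2 ≤ q → (∀ w → 2 ≤ w → w < q → ¬ Coprime w d) → Coprime (q + fuel) d →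
           ∃ λ q → 2 ≤ q × Coprime q d × (∀ w → 2 ≤ w → w < q → ¬ Coprime w d)
  ascend zero q 2≤q none c = q , 2≤q , subst (λ z → Coprime z d) (+-identityʳ q) c , none
  ascend (suc fuel) q 2≤q none c with coprime? q d
  ... | yes cq = q , 2≤q , cq , none
  ... | no ¬cq = ascend fuel (suc q) (m≤n⇒m≤1+n 2≤q) none′ (subst (λ z → Coprime z d) (+-suc q fuel) c)
    where
    none′ : ∀ w → 2 ≤ w → w < suc q → ¬ Coprime w d
    none′ w 2≤w w<1+q with w ≟ q
    ... | yes refl = ¬cq
    ... | no w≢q   = none w 2≤w (≤∧≢⇒< (m<1+n⇒m≤n w<1+q) w≢q)

module _ {d q : ℕ} (d>0 : 0 < d) (least : ∀ w → 2 ≤ w → w < q → ¬ Coprime w d) where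

  private
    instance
      d-nonZero : NonZero d
      d-nonZero = >-nonZero d>0

  -- If a ∣ d then gcd(a+1,d) ≥ 2 is coprime to a, so a gcd(a+1,d) ∣ d.
  divisor-between : ∀ T → T < q → 0 < T → ∃ λ a → a ∣ d × T ≤ a × a ≤ T * T
  divisor-between T T<q T>0 = climb T 1 (1∣ d) ≤-refl (≤-trans T>0 (m≤m*n T T {{>-nonZero T>0}})) (m≤n+m T 1)
    where
    climb : ∀ fuel a → a ∣ d → 0 < a → a ≤ T * T → T ≤ a + fuel → ∃ λ a → a ∣ d × T ≤ a × a ≤ T * T
    climb zero       a a∣d a>0 a≤ T≤ = a , a∣d , ≤-trans T≤ (≤-reflexive (+-identityʳ a)) , a≤
    climb (suc fuel) a a∣d a>0 a≤ T≤ with T ≤? a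
    ... | yes T≤a = a , a∣d , T≤a , a≤
    ... | no T≰a  = climb fuel (a * g) ag∣d (*-mono-≤ a>0 (<⇒≤ 1<g)) ag≤ (≤-trans T≤ (≤-trans (≤-reflexive (+-suc a fuel)) (+-monoˡ-≤ fuel (m<m*n a g {{>-nonZero a>0}} 1<g))))
      where
      g = gcd (suc a) d
      a<T : a < T
      a<T = ≰⇒> T≰a
      g≢0 : g ≢ 0
      g≢0 = gcd[m,n]≢0 (suc a) d (inj₁ λ ())
      1<g : 1 < g
      1<g = ≤∧≢⇒< (n≢0⇒n>0 g≢0) λ e → least (suc a) (s≤s a>0) (≤-<-trans a<T T<q) (gcd≡1⇒coprime (sym e))
      a⊥g : Coprime a g
      a⊥g {e} (e∣a , e∣g) = ∣1⇒≡1 (∣m+n∣m⇒∣n (subst (e ∣_) (+-comm 1 a) (∣-trans e∣g (gcd[m,n]∣m (suc a) d))) e∣a)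
      ag∣d : a * g ∣ d
      ag∣d = case a∣d of λ { (divides k d≡) →
        subst (a * g ∣_) (trans (*-comm a k) (sym d≡)) (*-monoʳ-∣ a (coprime-divisor (Cop.sym a⊥g) (subst (g ∣_) (trans d≡ (*-comm k a)) (gcd[m,n]∣n (suc a) d)))) }
      ag≤ : a * g ≤ T * T
      ag≤ = *-mono-≤ (<⇒≤ a<T) (≤-trans (∣⇒≤ (gcd[m,n]∣m (suc a) d)) a<T)

  -- With B the part of d coprime to a, every prime of d divides exactly one of a and B. So a + B is
  -- coprime to d and cannot lie below the least such integer.
  product≤ : ∀ a → a ∣ d → 0 < a → ∃ λ B → a * B ≤ d × q ≤ a + B
  product≤ a a∣d@(divides k d≡) a>0 with coprime-part a d d>0
  ... | coprimePart B B∣d a⊥B ⊥d = B , ∣⇒≤ aB∣d , ≮⇒≥ λ a+B<q → least (a + B) 2≤ a+B<q coprime-sum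
    where
    aB∣d : a * B ∣ d
    aB∣d = subst (a * B ∣_) (trans (*-comm a k) (sym d≡)) (*-monoʳ-∣ a (coprime-divisor (Cop.sym a⊥B) (subst (B ∣_) (trans d≡ (*-comm k a)) B∣d)))
    B>0 : 0 < B
    B>0 = n≢0⇒n>0 λ { refl → >⇒≢ d>0 (trans d≡ (trans (cong (_* a) (k≡0 k a>0 (∣⇒≤0 aB∣d))) refl)) }
      where
      ∣⇒≤0 : a * 0 ∣ d → d ≡ 0
      ∣⇒≤0 (divides l e) = trans e (trans (cong (l *_) (*-zeroʳ a)) (*-zeroʳ l))
      k≡0 : ∀ k → 0 < a → d ≡ 0 → k ≡ 0
      k≡0 k _ d≡0 = contradiction d≡0 (>⇒≢ d>0)
    2≤ : 2 ≤ a + B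
    2≤ = +-mono-≤ a>0 B>0
    coprime-sum : Coprime (a + B) d
    coprime-sum = ⊥d (λ {e} (e∣ , e∣a) → a⊥B (e∣a , ∣m+n∣m⇒∣n e∣ e∣a))
                     (λ {e} (e∣ , e∣B) → a⊥B (∣m+n∣m⇒∣n (subst (e ∣_) (+-comm a B) e∣) e∣B , e∣B))

-- Take a divisor a of d between T and T² with T of order √q. As 2a ≤ q ≤ a + B, also B ≥ q/2, so
-- Tq/2 ≤ aB ≤ d; squaring and using q ≤ 12T² gives q³ ≤ 48d².
small-coprime : ∀ d → 0 < d → ∃ λ q → 2 ≤ q × Coprime q d × q * q * q ≤ 48 * (d * d)
small-coprime d d>0 with least-coprime d d>0
... | q , 2≤q , q⊥d , least = q , 2≤q , q⊥d , cube (4 ≤? q)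
  where
  open ≤-Reasoning
  1≤dd : 1 ≤ d * d
  1≤dd = *-mono-≤ d>0 d>0
  f : ℕ → ℕ
  -- With T = T′ + 1, the inequalities f T′ ≤ q < f (T′ + 1) give 2T(T+1) ≤ q ≤ 12T²: the lower
  -- bound yields 2a ≤ q, the upper one the final estimate.
  f T = 2 * (suc T * suc (suc T))
  cube : Dec (4 ≤ q) → q * q * q ≤ 48 * (d * d)
  cube (no q<4) = ≤-trans (*-mono-≤ (*-mono-≤ q≤3 q≤3) q≤3) (≤-trans (m≤m+n 27 21) (*-monoʳ-≤ 48 1≤dd))
    where
    q≤3 : q ≤ 3
    q≤3 = m<1+n⇒m≤n (≰⇒> q<4)
  cube (yes 4≤q) = case floor-search f q q 4≤q q<fq of λ { (T′ , f≤ , q<) → with-T T′ f≤ q< }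
    where
    q<fq : q < f q
    q<fq = ≤-trans (s≤s (n≤1+n q)) (≤-trans (m≤n*m (suc (suc q)) (suc q)) (m≤n*m (suc q * suc (suc q)) 2))
    with-T : ∀ T′ → f T′ ≤ q → q < f (suc T′) → q * q * q ≤ 48 * (d * d)
    with-T T′ f≤ q< = from-divisor (divisor-between d>0 least T (<-≤-trans T<f f≤) (s≤s z≤n))
      where
      T = suc T′
      T<f : T < f T′
      T<f = ≤-trans (m≤n*m (suc T) T) (m≤n*m (T * suc T) 2)
      q≤12T² : q ≤ 12 * (T * T)
      q≤12T² = ≤-trans (<⇒≤ q<) (≤-trans (m≤m+n _ _) (≤-reflexive (identity T′)))
        where
        identity : ∀ t → 2 * (suc (suc t) * suc (suc (suc t))) + (10 * (t * t) + 14 * t) ≡ 12 * (suc t * suc t)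
        identity = solve-∀
      from-divisor : (∃ λ a → a ∣ d × T ≤ a × a ≤ T * T) → q * q * q ≤ 48 * (d * d)
      from-divisor (a , a∣d , T≤a , a≤) = bound (product≤ d>0 least a a∣d (<-≤-trans (s≤s z≤n) T≤a))
        where
        bound : (∃ λ B → a * B ≤ d × q ≤ a + B) → q * q * q ≤ 48 * (d * d)
        bound (B , aB≤d , q≤a+B) = begin
          q * q * q                           ≡⟨ *-assoc q q q ⟩
          q * (q * q)                         ≤⟨ *-monoˡ-≤ (q * q) q≤12T² ⟩
          12 * (T * T) * (q * q)              ≡⟨ regroup T q ⟩
          12 * (T * q * (T * q))              ≤⟨ *-monoʳ-≤ 12 (*-mono-≤ Tq≤ Tq≤) ⟩
          12 * (2 * d * (2 * d))              ≡⟨ regroup′ d ⟩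
          48 * (d * d) ∎
          where
          regroup : ∀ T q → 12 * (T * T) * (q * q) ≡ 12 * (T * q * (T * q))
          regroup = solve-∀
          regroup′ : ∀ d → 12 * (2 * d * (2 * d)) ≡ 48 * (d * d)
          regroup′ = solve-∀
          2a≤q : 2 * a ≤ q
          2a≤q = ≤-trans (*-monoʳ-≤ 2 (≤-trans a≤ (*-monoʳ-≤ T (n≤1+n T)))) f≤
          q≤2B : q ≤ 2 * B
          q≤2B = +-cancelˡ-≤ (2 * a) q (2 * B) (≤-trans (+-monoˡ-≤ q 2a≤q) (≤-trans (≤-reflexive (cong (q +_) (sym (+-identityʳ q)))) (≤-trans (*-monoʳ-≤ 2 q≤a+B) (≤-reflexive (*-distribˡ-+ 2 a B)))))
          Tq≤ : T * q ≤ 2 * d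
          Tq≤ = ≤-trans (*-mono-≤ T≤a q≤2B) (≤-trans (≤-reflexive (exchange a B)) (*-monoʳ-≤ 2 aB≤d))
            where
            exchange : ∀ a B → a * (2 * B) ≡ 2 * (a * B)
            exchange = solve-∀

-- The least power of q that is ≥ X is at most max(q, X²).
power-between : ∀ q X H → 2 ≤ q → q ≤ H → X * X ≤ H → ∃ λ e → X ≤ q ^ e × q ^ e ≤ H
power-between q X H 2≤q q≤H X²≤H with X ≤? 1
... | yes X≤1 = 0 , X≤1 , ≤-trans (<⇒≤ 2≤q) q≤H
... | no X>1 with floor-search (q ^_) X X (<⇒≤ (≰⇒> X>1)) (X<q^X X)
  where
  X<q^X : ∀ X → X < q ^ X
  X<q^X zero    = s≤s z≤n
  X<q^X (suc X) = ≤-trans (s≤s (X<q^X X)) (≤-trans (m≤n+m (suc (q ^ X)) (q ^ X ∸ 1)) (≤-trans (≤-reflexive (double (q ^ X) (≤-<-trans z≤n (X<q^X X)))) (*-monoˡ-≤ (q ^ X) 2≤q)))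
    where
    double : ∀ n → 0 < n → n ∸ 1 + suc n ≡ 2 * n
    double (suc n) _ = trans (+-suc n (suc n)) (cong suc (cong (n +_) (cong suc (sym (+-identityʳ n)))))
... | T , q^T≤X , X<q^T+1 with X ≤? q
...   | yes X≤q = 1 , ≤-trans X≤q (≤-reflexive (sym (*-identityʳ q))) , ≤-trans (≤-reflexive (*-identityʳ q)) q≤H
...   | no X>q  = suc T , <⇒≤ X<q^T+1 , ≤-trans (*-mono-≤ (<⇒≤ (≰⇒> X>q)) q^T≤X) X²≤H

-- Residues and one step of the Chinese remainder theorem.

residue-split : ∀ n m Y .{{_ : NonZero Y}} → m ≤ n → m % Y ≡ n % Y → ∃ λ k → n ≡ m + Y * k
residue-split n m Y m≤n e = n / Y ∸ m / Y , (begin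
  n                                            ≡⟨ m≡m%n+[m/n]*n n Y ⟩
  n % Y + n / Y * Y                            ≡⟨ cong₂ (λ a b → a + b * Y) (sym e) (sym (m+[n∸m]≡n (/-monoˡ-≤ Y m≤n))) ⟩
  m % Y + (m / Y + (n / Y ∸ m / Y)) * Y        ≡⟨ regroup (m % Y) (m / Y) (n / Y ∸ m / Y) Y ⟩
  m % Y + m / Y * Y + Y * (n / Y ∸ m / Y)      ≡⟨ cong (_+ Y * (n / Y ∸ m / Y)) (sym (m≡m%n+[m/n]*n m Y)) ⟩
  m + Y * (n / Y ∸ m / Y) ∎)
  where
  open ≡-Reasoning
  regroup : ∀ r a b Y → r + (a + b) * Y ≡ r + a * Y + Y * b
  regroup = solve-∀

%-*-congˡ : ∀ {m n} o Y .{{_ : NonZero Y}} → m % Y ≡ n % Y → (o * m) % Y ≡ (o * n) % Y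
%-*-congˡ {m} {n} o Y e = trans (%-distribˡ-* o m Y) (trans (cong (λ z → (o % Y * z) % Y) e) (sym (%-distribˡ-* o n Y)))

inverse-mod : ∀ {m Y} .{{_ : NonZero Y}} → Coprime m Y → ∃ λ x → (x * m) % Y ≡ 1 % Y
inverse-mod {m} {Y} c with coprime-Bézout c
... | Bézout.+- x y e = x , trans (cong (_% Y) (sym e)) ([m+kn]%n≡m%n 1 y Y)
... | Bézout.-+ x y e = pred Y * x , (begin
  (pred Y * x * m) % Y                  ≡⟨ sym ([m+n]%n≡m%n (pred Y * x * m) Y) ⟩
  (pred Y * x * m + Y) % Y              ≡⟨ cong (λ z → (pred Y * x * m + z) % Y) (sym (suc-pred Y)) ⟩
  (pred Y * x * m + suc (pred Y)) % Y   ≡⟨ cong (_% Y) (regroup (pred Y) x m) ⟩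
  (1 + pred Y * (1 + x * m)) % Y        ≡⟨ cong (λ z → (1 + pred Y * z) % Y) e ⟩
  (1 + pred Y * (y * Y)) % Y            ≡⟨ cong (λ z → (1 + z) % Y) (sym (*-assoc (pred Y) y Y)) ⟩
  (1 + pred Y * y * Y) % Y              ≡⟨ [m+kn]%n≡m%n 1 (pred Y * y) Y ⟩
  1 % Y ∎)
  where
  open ≡-Reasoning
  regroup : ∀ w x m → w * x * m + suc w ≡ 1 + w * (1 + x * m)
  regroup = solve-∀

-- k is n/m modulo Y; the lower bound on n keeps the quotient n′ nonnegative.
crt-step : ∀ {m Y} → 0 < Y → Coprime m Y → ∀ n → Y * m ≤ n → ∃ λ k → ∃ λ n′ → k < Y × n ≡ k * m + Y * n′
crt-step {m} {Y} Y>0 c n Ym≤n = from-inverse (inverse-mod c)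
  where
  instance
    Y-nonZero : NonZero Y
    Y-nonZero = >-nonZero Y>0
  from-inverse : (∃ λ x → (x * m) % Y ≡ 1 % Y) → ∃ λ k → ∃ λ n′ → k < Y × n ≡ k * m + Y * n′
  from-inverse (x , e) = k , proj₁ split , k<Y , proj₂ split
    where
    k = (n * x) % Y
    k<Y : k < Y
    k<Y = m%n<n (n * x) Y
    residue : (k * m) % Y ≡ n % Y
    residue = begin
      (k * m) % Y           ≡⟨ cong (_% Y) (*-comm k m) ⟩
      (m * k) % Y           ≡⟨ %-*-congˡ m Y (m%n%n≡m%n (n * x) Y) ⟩
      (m * (n * x)) % Y     ≡⟨ cong (_% Y) (regroup m n x) ⟩
      (n * (x * m)) % Y     ≡⟨ %-*-congˡ n Y e ⟩
      (n * 1) % Y           ≡⟨ cong (_% Y) (*-identityʳ n) ⟩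
      n % Y ∎
      where
      open ≡-Reasoning
      regroup : ∀ m n x → m * (n * x) ≡ n * (x * m)
      regroup = solve-∀
    split = residue-split n (k * m) Y (≤-trans (*-monoˡ-≤ m (<⇒≤ k<Y)) Ym≤n) residue

same-quotient : ∀ m n E .{{_ : NonZero E}} → m / E ≡ n / E → m ∸ n < E
same-quotient m n E e = ≤-<-trans (≤-reflexive (begin
  m ∸ n                                        ≡⟨ cong₂ _∸_ (m≡m%n+[m/n]*n m E) (m≡m%n+[m/n]*n n E) ⟩
  (m % E + m / E * E) ∸ (n % E + n / E * E)    ≡⟨ cong (λ q → (m % E + q * E) ∸ (n % E + n / E * E)) e ⟩
  (m % E + n / E * E) ∸ (n % E + n / E * E)    ≡⟨ cong₂ _∸_ (+-comm (m % E) _) (+-comm (n % E) _) ⟩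
  (n / E * E + m % E) ∸ (n / E * E + n % E)    ≡⟨ [m+n]∸[m+o]≡n∸o (n / E * E) (m % E) (n % E) ⟩
  m % E ∸ n % E ∎)) (≤-<-trans (m∸n≤m (m % E) (n % E)) (m%n<n m E))
  where open ≡-Reasoning

-- Dirichlet approximation, and sums of fractions with coprime denominators.

module Direct (p : ℕ) (p-prime : Prime p) (A : ℕ) where
  open PrimeField p p-prime
  open Intervals p p-prime
  open Representations p p-prime A

  record Approximation (b : F) (D : ℕ) : Set where
    constructor approximation
    field
      d ρ : ℕ
      d>0 : 0 < d
      d≤D : d ≤ D
      ρD≤p : ρ * D ≤ p
      d⊥ρ : Coprime d ρ
      close : ι d ⊗ b ≡ ι ρ ⊎ ι d ⊗ b ≡ ⊖ ι ρ

  reduce : ∀ {b D} d ρ → 0 < d → d ≤ D → D < p → ρ * D ≤ p → ι d ⊗ b ≡ ι ρ ⊎ ι d ⊗ b ≡ ⊖ ι ρ → Approximation b D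
  reduce {b} {D} d ρ d>0 d≤D D<p ρD≤p close = by (gcd[m,n]∣m d ρ) (gcd[m,n]∣n d ρ)
    where
    g = gcd d ρ
    g≢0 : g ≢ 0
    g≢0 = gcd[m,n]≢0 d ρ (inj₁ (>⇒≢ d>0))
    g>0 : 0 < g
    g>0 = n≢0⇒n>0 g≢0
    by : g ∣ d → g ∣ ρ → Approximation b D
    by (divides d′ d≡) (divides ρ′ ρ≡) = approximation d′ ρ′ d′>0 (≤-trans d′≤d d≤D)
        (≤-trans (*-monoˡ-≤ D (≤-trans (m≤m*n ρ′ g {{>-nonZero g>0}}) (≤-reflexive (sym ρ≡)))) ρD≤p) coprime (divide close)
      where
      d′>0 : 0 < d′
      d′>0 = n≢0⇒n>0 λ e → >⇒≢ d>0 (trans d≡ (cong (_* g) e))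
      d′≤d : d′ ≤ d
      d′≤d = ≤-trans (m≤m*n d′ g {{>-nonZero g>0}}) (≤-reflexive (sym d≡))
      coprime : Coprime d′ ρ′
      coprime {e} (e∣d′ , e∣ρ′) = ∣1⇒≡1 (case gcd-greatest (subst (e * g ∣_) (sym d≡) (*-mono-∣ e∣d′)) (subst (e * g ∣_) (sym ρ≡) (*-mono-∣ e∣ρ′)) of λ { (divides k eq) →
        divides k (*-cancelʳ-≡ 1 (k * e) g {{>-nonZero g>0}} (trans (*-identityˡ g) (trans eq (sym (*-assoc k e g))))) })
        where
        *-mono-∣ : ∀ {x} → e ∣ x → e * g ∣ x * g
        *-mono-∣ (divides k refl) = divides k (*-assoc k e g)
      ιg≢0 : ι g ≢ 0F
      ιg≢0 = ι≢0 g>0 (≤-<-trans (≤-trans (∣⇒≤ {{>-nonZero d>0}} (gcd[m,n]∣m d ρ)) d≤D) D<p)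
      ιd : ι d ≡ ι g ⊗ ι d′
      ιd = trans (cong ι (trans d≡ (*-comm d′ g))) (ι-* g d′)
      ιρ : ι ρ ≡ ι g ⊗ ι ρ′
      ιρ = trans (cong ι (trans ρ≡ (*-comm ρ′ g))) (ι-* g ρ′)
      divide : ι d ⊗ b ≡ ι ρ ⊎ ι d ⊗ b ≡ ⊖ ι ρ → ι d′ ⊗ b ≡ ι ρ′ ⊎ ι d′ ⊗ b ≡ ⊖ ι ρ′
      divide (inj₁ e) = inj₁ (⊗-cancelˡ ιg≢0 (trans (sym (⊗-assoc _ _ _)) (trans (cong (_⊗ b) (sym ιd)) (trans e ιρ))))
      divide (inj₂ e) = inj₂ (⊗-cancelˡ ιg≢0 (trans (sym (⊗-assoc _ _ _)) (trans (cong (_⊗ b) (sym ιd)) (trans e (trans (cong ⊖_ ιρ)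
        (S.solve 2 (λ g r → S.:- (g S.:* r) S.:= g S.:* (S.:- r)) refl (ι g) (ι ρ′)))))))

  -- Pigeonhole on D + 1 multiples of b in D boxes. `reduce` then cancels the gcd, since the
  -- pairwise coprimality of the denominators will rest on that of d and ρ.
  dirichlet : ∀ b D → 0 < D → D < p → Approximation b D
  dirichlet b D D>0 D<p = from-collision (pigeonhole (n<1+n D) box)
    where
    instance
      D-nonZero : NonZero D
      D-nonZero = >-nonZero D>0
    E = suc (p / D)
    r : ℕ → ℕ
    r i = rep (ι i ⊗ b)
    p≤DE : p ≤ D * E
    p≤DE = ≤-trans (≤-reflexive (m≡m%n+[m/n]*n p D)) (≤-trans (+-monoˡ-≤ (p / D * D) (<⇒≤ (m%n<n p D))) (≤-reflexive (*-comm (suc (p / D)) D)))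
    box : Fin (suc D) → Fin D
    box i = fromℕ< (m<n*o⇒m/o<n {r (toℕ i)} {D} {E} (<-≤-trans (rep<p _) p≤DE))
    from-collision : (∃ λ i → ∃ λ j → toℕ i < toℕ j × box i ≡ box j) → Approximation b D
    from-collision (i , j , i<j , e) = reduce d (proj₁ sign) (m<n⇒0<n∸m i<j) (≤-trans (m∸n≤m _ (toℕ i)) (m<1+n⇒m≤n (toℕ<n j))) D<p
        (≤-trans (*-monoˡ-≤ D (proj₁ (proj₂ sign))) (m/n*n≤m p D)) (proj₂ (proj₂ sign))
      where
      d = toℕ j ∸ toℕ i
      quotients : r (toℕ i) / E ≡ r (toℕ j) / E
      quotients = fromℕ<-injective _ _ _ _ e
      db : ι d ⊗ b ≡ ι (r (toℕ j)) ⊝ ι (r (toℕ i))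
      db = begin
        ι d ⊗ b                                          ≡⟨ S.solve 3 (λ d i b → d S.:* b S.:= (i S.:+ d) S.:* b S.:- i S.:* b) refl (ι d) (ι (toℕ i)) b ⟩
        (ι (toℕ i) ⊕ ι d) ⊗ b ⊝ ι (toℕ i) ⊗ b            ≡⟨ cong (λ z → z ⊗ b ⊝ ι (toℕ i) ⊗ b) (trans (sym (ι-+ _ _)) (cong ι (m+[n∸m]≡n (<⇒≤ i<j)))) ⟩
        ι (toℕ j) ⊗ b ⊝ ι (toℕ i) ⊗ b                    ≡⟨ cong₂ _⊝_ (sym (ι-rep _)) (sym (ι-rep _)) ⟩
        ι (r (toℕ j)) ⊝ ι (r (toℕ i)) ∎
        where open ≡-Reasoning
      sign : ∃ λ ρ → ρ ≤ p / D × (ι d ⊗ b ≡ ι ρ ⊎ ι d ⊗ b ≡ ⊖ ι ρ)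
      sign with ≤-total (r (toℕ i)) (r (toℕ j))
      ... | inj₁ le = r (toℕ j) ∸ r (toℕ i) , m<1+n⇒m≤n (same-quotient (r (toℕ j)) (r (toℕ i)) E (sym quotients)) ,
            inj₁ (trans db (trans (cong (_⊝ ι (r (toℕ i))) (trans (cong ι (sym (m+[n∸m]≡n le))) (ι-+ _ _)))
              (S.solve 2 (λ i s → (i S.:+ s) S.:- i S.:= s) refl _ _)))
      ... | inj₂ le = r (toℕ i) ∸ r (toℕ j) , m<1+n⇒m≤n (same-quotient (r (toℕ i)) (r (toℕ j)) E quotients) ,
            inj₂ (trans db (trans (cong (ι (r (toℕ j)) ⊝_) (trans (cong ι (sym (m+[n∸m]≡n le))) (ι-+ _ _)))
              (S.solve 2 (λ j s → j S.:- (j S.:+ s) S.:= S.:- s) refl _ _)))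

  -- Every integer n in a long interval is Π Y times Σ kᵢ/Yᵢ with 0 ≤ kᵢ < M, by the Chinese remainder theorem.
  module Cover (M a N : ℕ) (Y pos : ℕ → ℕ) (σ : F) (pos<N : ∀ i → i ≤ 11 → pos i < N)
               (Y>0 : ∀ i → 0 < Y i) (Y≤M : ∀ i → i ≤ 11 → Y i ≤ M) (ιY≢0 : ∀ i → i ≤ 11 → ι (Y i) ≢ 0F)
               (pairwise : ∀ i j → i < j → j ≤ 11 → Coprime (Y i) (Y j))
               (inverse : ∀ i → i ≤ 11 → inv (ι (a + pos i)) ≡ σ ⊗ inv (ι (Y i))) where

    -- Y 0 is left out of `tailProduct`: the numerator over Y 0 is not a residue modulo Y 0 but the
    -- remaining quotient, free to run up to M.
    tailProduct product : ℕ → ℕ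
    tailProduct zero    = 1
    tailProduct (suc k) = Y (suc k) * tailProduct k
    product zero    = Y 0
    product (suc k) = Y (suc k) * product k

    recips : ℕ → F
    recips zero    = inv (ι (a + pos 0))
    recips (suc k) = inv (ι (a + pos (suc k))) ⊕ recips k

    product≡ : ∀ k → product k ≡ Y 0 * tailProduct k
    product≡ zero    = sym (*-identityʳ (Y 0))
    product≡ (suc k) = trans (cong (Y (suc k) *_) (product≡ k)) (exchange (Y (suc k)) (Y 0) (tailProduct k))
      where
      exchange : ∀ a b c → a * (b * c) ≡ b * (a * c)
      exchange = solve-∀

    product-coprime : ∀ k j → k < j → j ≤ 11 → Coprime (product k) (Y j)
    product-coprime zero    j k<j j≤ = pairwise 0 j k<j j≤
    product-coprime (suc k) j k<j j≤ = Cop.sym (coprime-*ʳ (Cop.sym (pairwise (suc k) j k<j j≤)) (Cop.sym (product-coprime k j (<-trans (n<1+n k) k<j) j≤)))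

    ιproduct≢0 : ∀ k → k ≤ 11 → ι (product k) ≢ 0F
    ιproduct≢0 zero    k≤ = ιY≢0 0 k≤
    ιproduct≢0 (suc k) k≤ e = ⊗-≢0 (ιY≢0 (suc k) k≤) (ιproduct≢0 k (<⇒≤ k≤)) (trans (sym (ι-* _ _)) e)

    -- Each `crt-step` splits off the residue over the last denominator and uses up one full product
    -- at the lower end, hence the bound `k * product k`. The quotient left at the end is the
    -- numerator over Y 0.
    cover : ∀ k n → k ≤ 11 → k * product k ≤ n → n < M * tailProduct k →
            Represented M a N (suc k) (σ ⊗ (ι n ⊗ inv (ι (product k))) ⊕ ι A ⊗ recips k)
    cover zero n k≤ _ n< = (n , pos 0) ∷ [] , (<-≤-trans n< (≤-reflexive (*-identityʳ M)) , pos<N 0 k≤) ∷ [] ,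
      trans (⊕-identityʳ _) (trans (trans (cong (_⊗ i₀) (ι-+ A n)) (S.solve 3 (λ A n i → (A S.:+ n) S.:* i S.:= n S.:* i S.:+ A S.:* i) refl (ι A) (ι n) i₀))
        (cong (_⊕ ι A ⊗ i₀) (trans (cong (ι n ⊗_) (inverse 0 k≤)) (S.solve 3 (λ n s i → n S.:* (s S.:* i) S.:= s S.:* (n S.:* i)) refl (ι n) σ (inv (ι (Y 0)))))))
      where
      i₀ : F
      i₀ = inv (ι (a + pos 0))
    cover (suc k) n k≤ n≥ n< = from-step (crt-step (Y>0 (suc k)) (product-coprime k (suc k) ≤-refl k≤) n (≤-trans (m≤m+n _ _) n≥))
      where
      y = Y (suc k)
      Π = product k
      instance
        y-nonZero : NonZero y
        y-nonZero = >-nonZero (Y>0 (suc k))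
      from-step : (∃ λ κ → ∃ λ n′ → κ < y × n ≡ κ * Π + y * n′) → Represented M a N (suc (suc k)) (σ ⊗ (ι n ⊗ inv (ι (product (suc k)))) ⊕ ι A ⊗ recips (suc k))
      from-step (κ , n′ , κ<y , n≡) = extend (cover k n′ (<⇒≤ k≤) n′≥ n′<)
        where
        n′≥ : k * Π ≤ n′
        n′≥ = *-cancelˡ-≤ y (+-cancelˡ-≤ (κ * Π) (y * (k * Π)) (y * n′) (≤-trans (+-monoˡ-≤ (y * (k * Π)) (*-monoˡ-≤ Π (<⇒≤ κ<y)))
          (≤-trans (≤-reflexive (regroup k y Π)) (≤-trans n≥ (≤-reflexive n≡)))))
          where
          regroup : ∀ k y Π → y * Π + y * (k * Π) ≡ suc k * (y * Π)
          regroup = solve-∀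
        n′< : n′ < M * tailProduct k
        n′< = *-cancelˡ-< y n′ (M * tailProduct k) (≤-<-trans (≤-trans (m≤n+m (y * n′) (κ * Π)) (≤-reflexive (sym n≡))) (<-≤-trans n< (≤-reflexive (exchange M y (tailProduct k)))))
          where
          exchange : ∀ M y t → M * (y * t) ≡ y * (M * t)
          exchange = solve-∀
        extend : Represented M a N (suc k) (σ ⊗ (ι n′ ⊗ inv (ι Π)) ⊕ ι A ⊗ recips k) → Represented M a N (suc (suc k)) (σ ⊗ (ι n ⊗ inv (ι (y * Π))) ⊕ ι A ⊗ recips (suc k))
        extend (v , bv , ev) = (κ , pos (suc k)) ∷ v , (<-≤-trans κ<y (Y≤M (suc k) k≤) , pos<N (suc k) k≤) ∷ bv , (begin
          ι (A + κ) ⊗ i′ ⊕ quotSum a v                                     ≡⟨ cong₂ (λ z q → z ⊗ i′ ⊕ q) (ι-+ A κ) ev ⟩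
          (ι A ⊕ ι κ) ⊗ i′ ⊕ (σ ⊗ (ι n′ ⊗ iΠ) ⊕ ι A ⊗ recips k)            ≡⟨ S.solve 5 (λ A κ i z r → (A S.:+ κ) S.:* i S.:+ (z S.:+ A S.:* r) S.:= (κ S.:* i S.:+ z) S.:+ A S.:* (i S.:+ r)) refl (ι A) (ι κ) i′ (σ ⊗ (ι n′ ⊗ iΠ)) (recips k) ⟩
          (ι κ ⊗ i′ ⊕ σ ⊗ (ι n′ ⊗ iΠ)) ⊕ ι A ⊗ (i′ ⊕ recips k)             ≡⟨ cong (_⊕ ι A ⊗ (i′ ⊕ recips k)) main ⟩
          σ ⊗ (ι n ⊗ inv (ι (y * Π))) ⊕ ι A ⊗ (i′ ⊕ recips k) ∎)
          where
          open ≡-Reasoning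
          iy iΠ i′ : F
          iy = inv (ι y)
          iΠ = inv (ι Π)
          i′ = inv (ι (a + pos (suc k)))
          main : ι κ ⊗ i′ ⊕ σ ⊗ (ι n′ ⊗ iΠ) ≡ σ ⊗ (ι n ⊗ inv (ι (y * Π)))
          main = begin
            ι κ ⊗ i′ ⊕ σ ⊗ (ι n′ ⊗ iΠ)                                     ≡⟨ cong (λ i → ι κ ⊗ i ⊕ σ ⊗ (ι n′ ⊗ iΠ)) (inverse (suc k) k≤) ⟩
            ι κ ⊗ (σ ⊗ iy) ⊕ σ ⊗ (ι n′ ⊗ iΠ)                                 ≡⟨ S.solve 5 (λ κ σ iy n iΠ → κ S.:* (σ S.:* iy) S.:+ σ S.:* (n S.:* iΠ) S.:= σ S.:* (κ S.:* (S.con (ℤ.+ 1) S.:* iy) S.:+ n S.:* (S.con (ℤ.+ 1) S.:* iΠ))) refl (ι κ) σ iy (ι n′) iΠ ⟩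
            σ ⊗ (ι κ ⊗ (1F ⊗ iy) ⊕ ι n′ ⊗ (1F ⊗ iΠ))                         ≡⟨ cong₂ (λ e f → σ ⊗ (ι κ ⊗ (e ⊗ iy) ⊕ ι n′ ⊗ (f ⊗ iΠ))) (sym (inv-right (ιproduct≢0 k (<⇒≤ k≤)))) (sym (inv-right (ιY≢0 (suc k) k≤))) ⟩
            σ ⊗ (ι κ ⊗ (ι Π ⊗ iΠ ⊗ iy) ⊕ ι n′ ⊗ (ι y ⊗ iy ⊗ iΠ))             ≡⟨ S.solve 7 (λ σ κ Π iΠ iy n y → σ S.:* (κ S.:* (Π S.:* iΠ S.:* iy) S.:+ n S.:* (y S.:* iy S.:* iΠ)) S.:= σ S.:* ((κ S.:* Π S.:+ y S.:* n) S.:* (iy S.:* iΠ))) refl σ (ι κ) (ι Π) iΠ iy (ι n′) (ι y) ⟩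
            σ ⊗ ((ι κ ⊗ ι Π ⊕ ι y ⊗ ι n′) ⊗ (iy ⊗ iΠ))                       ≡⟨ cong₂ (λ e f → σ ⊗ (e ⊗ f)) (trans (cong₂ _⊕_ (sym (ι-* κ Π)) (sym (ι-* y n′))) (trans (sym (ι-+ (κ * Π) (y * n′))) (cong ι (sym n≡))))
                                                                                    (trans (sym (inv-⊗ (ιY≢0 (suc k) k≤) (ιproduct≢0 k (<⇒≤ k≤)))) (cong inv (sym (ι-* y Π)))) ⟩
            σ ⊗ (ι n ⊗ inv (ι (y * Π))) ∎

    cover-all : σ ≢ 0F → ∀ k → k ≤ 11 → k * product k + p ≤ M * tailProduct k → ∀ x → Represented M a N (suc k) x
    cover-all σ≢0 k k≤ room x = subst (Represented M a N (suc k)) value (cover k (k * product k + s) k≤ (m≤m+n _ s)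
      (<-≤-trans (+-monoʳ-< (k * product k) (rep<p t)) room))
      where
      Π = product k
      r = ι A ⊗ recips k
      t = inv σ ⊗ (x ⊝ r) ⊗ ι Π ⊝ ι (k * product k)
      s = rep t
      value : σ ⊗ (ι (k * product k + s) ⊗ inv (ι Π)) ⊕ r ≡ x
      value = begin
        σ ⊗ (ι (k * product k + s) ⊗ inv (ι Π)) ⊕ r                           ≡⟨ cong (λ z → σ ⊗ (z ⊗ inv (ι Π)) ⊕ r) (trans (ι-+ (k * product k) s) (cong (ι (k * product k) ⊕_) (ι-rep t))) ⟩
        σ ⊗ ((ι (k * product k) ⊕ t) ⊗ inv (ι Π)) ⊕ r                         ≡⟨ S.solve 7 (λ σ c i x Π j r → σ S.:* ((c S.:+ (i S.:* (x S.:- r) S.:* Π S.:- c)) S.:* j) S.:+ r S.:= (σ S.:* i) S.:* (Π S.:* j) S.:* (x S.:- r) S.:+ r) refl σ (ι (k * product k)) (inv σ) x (ι Π) (inv (ι Π)) r ⟩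
        (σ ⊗ inv σ) ⊗ (ι Π ⊗ inv (ι Π)) ⊗ (x ⊝ r) ⊕ r                         ≡⟨ cong₂ (λ e f → e ⊗ f ⊗ (x ⊝ r) ⊕ r) (inv-right σ≢0) (inv-right (ιproduct≢0 k k≤)) ⟩
        1F ⊗ 1F ⊗ (x ⊝ r) ⊕ r                                                 ≡⟨ S.solve 2 (λ x r → S.con (ℤ.+ 1) S.:* S.con (ℤ.+ 1) S.:* (x S.:- r) S.:+ r S.:= x) refl x r ⟩
        x ∎
        where open ≡-Reasoning

-- An integer coprime to d in a prescribed range.

coprime-above : ∀ d X → 0 < d → ∃ λ u → X ≤ u × u ≤ 1 + (X + d) × Coprime u d
coprime-above d X d>0 = 1 + d * suc (X / d) , X≤ , s≤s ≤X+d , coprime-1+* d (suc (X / d))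
  where
  instance
    d-nonZero : NonZero d
    d-nonZero = >-nonZero d>0
  expand : ∀ d q → d * suc q ≡ q * d + d
  expand = solve-∀
  ≤X+d : d * suc (X / d) ≤ X + d
  ≤X+d = ≤-trans (≤-reflexive (expand d (X / d))) (+-monoˡ-≤ d (m/n*n≤m X d))
  X≤ : X ≤ 1 + d * suc (X / d)
  X≤ = m≤n⇒m≤1+n (begin
    X                      ≡⟨ trans (m≡m%n+[m/n]*n X d) (+-comm (X % d) _) ⟩
    X / d * d + X % d      ≤⟨ +-monoʳ-≤ (X / d * d) (<⇒≤ (m%n<n X d)) ⟩
    X / d * d + d          ≡⟨ sym (expand d (X / d)) ⟩
    d * suc (X / d) ∎)
    where open ≤-Reasoning

-- When 2d ≤ H the range contains an integer that is 1 modulo d. For larger d a power of the small q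
-- coprime to d is used; it lands in the range because consecutive powers differ only by the factor
-- q.
coprime-multiplier : ∀ d X H → 0 < d → 2 * suc X ≤ H → (H < 2 * d → 48 * (d * d) ≤ H * H * H × X * X ≤ H) →
                     ∃ λ u → X ≤ u × u ≤ H × Coprime u d
coprime-multiplier d X H d>0 2X≤H hard with 2 * d ≤? H
... | yes 2d≤H = from (coprime-above d X d>0)
  where
  open ≤-Reasoning
  expand : ∀ X d → 2 * (1 + (X + d)) ≡ 2 * suc X + 2 * d
  expand = solve-∀
  from : (∃ λ u → X ≤ u × u ≤ 1 + (X + d) × Coprime u d) → ∃ λ u → X ≤ u × u ≤ H × Coprime u d
  from (u , X≤u , u≤ , c) = u , X≤u , ≤-trans u≤ (*-cancelˡ-≤ 2 (begin
    2 * (1 + (X + d))     ≡⟨ expand X d ⟩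
    2 * suc X + 2 * d     ≤⟨ +-mono-≤ 2X≤H 2d≤H ⟩
    H + H                 ≡⟨ cong (H +_) (sym (+-identityʳ H)) ⟩
    2 * H ∎)) , λ {e} → c {e}
... | no 2d>H = from (small-coprime d d>0)
  where
  from : (∃ λ q → 2 ≤ q × Coprime q d × q * q * q ≤ 48 * (d * d)) → ∃ λ u → X ≤ u × u ≤ H × Coprime u d
  from (q , 2≤q , q⊥d , q³≤) = power (power-between q X H 2≤q q≤H (proj₂ (hard (≰⇒> 2d>H))))
    where
    q≤H : q ≤ H
    q≤H = ≮⇒≥ λ H<q → <⇒≱ (*-mono-< (*-mono-< H<q H<q) H<q) (≤-trans q³≤ (proj₁ (hard (≰⇒> 2d>H))))
    power : (∃ λ e → X ≤ q ^ e × q ^ e ≤ H) → ∃ λ u → X ≤ u × u ≤ H × Coprime u d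
    power (e , X≤ , ≤H) = q ^ e , X≤ , ≤H , λ {f} → coprime-^ˡ e (λ {g} → q⊥d {g}) {f}

-- First range: pairwise coprime denominators r + d L i.

module DirectRange (p : ℕ) (p-prime : Prime p) (A L : ℕ) (L>0 : 0 < L) (L-multiple : ∀ k → 0 < k → k ≤ 11 → k ∣ L) where
  open PrimeField p p-prime
  open Intervals p p-prime
  open Representations p p-prime A
  open Direct p p-prime A

  -- The denominators y in J satisfy d y = u Y with integers Y of size about ρ/u. Passing from ρ to
  -- ρ/u is the purpose of u; for ρ already small, u = 1.
  module Finish (M a N : ℕ) (zf : ZeroFree a N) (M≤p : M ≤ p) (N≤p : N ≤ p)
                (e h d ρ u Q R : ℕ) (e+h<N : e + h < N) (d>0 : 0 < d) (d⊥ρ : Coprime d ρ) (u⊥d : Coprime u d) (u>0 : 0 < u)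
                (db : ι d ⊗ ι (a + e) ≡ ι ρ) (fit : u * (13 * L) ≤ h) (ρ≤uQ : ρ ≤ u * Q) (Ru≤ρ : R * u ≤ ρ)
                (M-large : 22 * (Q + 13 * (d * L)) ≤ M) (p-small : 2 * p ≤ M * R ^ 11) where
    open ≤-Reasoning
    p>0 : 0 < p
    p>0 = <-trans (s≤s z≤n) 1<p

    R>0 : 0 < R
    R>0 = n≢0⇒n>0 λ e → <⇒≱ p>0 (*-cancelˡ-≤ 2 (≤-trans p-small (≤-reflexive (trans (cong (λ z → M * z ^ 11) e) (*-zeroʳ M)))))

    record Start : Set where
      constructor start-at
      field
        j₁ r₀ : ℕ
        j₁<u : j₁ < u
        ur₀≡ : u * r₀ ≡ ρ + d * j₁

    begin-at : Start
    -- Modulo u, `ρ * pred u` is -ρ, so k d is -ρ and u divides ρ + d k. Adding `u * d` leaves the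
    -- residue unchanged and meets the lower bound that `crt-step` asks for.
    begin-at = from-crt (crt-step u>0 (Cop.sym u⊥d) (ρ * pred u + u * d) (m≤n+m (u * d) (ρ * pred u)))
      where
      from-crt : (∃ λ k → ∃ λ n′ → k < u × ρ * pred u + u * d ≡ k * d + u * n′) → Start
      from-crt (k , n′ , k<u , eq) = start-at k (ρ + d ∸ n′) k<u (+-cancelʳ-≡ (u * n′) _ _ (begin-equality
        u * (ρ + d ∸ n′) + u * n′       ≡⟨ sym (*-distribˡ-+ u (ρ + d ∸ n′) n′) ⟩
        u * (ρ + d ∸ n′ + n′)           ≡⟨ cong (u *_) (m∸n+n≡m n′≤) ⟩
        u * (ρ + d)                     ≡⟨ total ⟩
        ρ + d * k + u * n′ ∎))
        where
        total : u * (ρ + d) ≡ ρ + d * k + u * n′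
        total = begin-equality
          u * (ρ + d)                         ≡⟨ cong (_* (ρ + d)) (sym (suc-pred u {{>-nonZero u>0}})) ⟩
          suc (pred u) * (ρ + d)              ≡⟨ regroup (pred u) ρ d ⟩
          ρ + (ρ * pred u + suc (pred u) * d) ≡⟨ cong (λ z → ρ + (ρ * pred u + z * d)) (suc-pred u {{>-nonZero u>0}}) ⟩
          ρ + (ρ * pred u + u * d)            ≡⟨ cong (ρ +_) eq ⟩
          ρ + (k * d + u * n′)                ≡⟨ trans (sym (+-assoc ρ _ _)) (cong (λ z → ρ + z + u * n′) (*-comm k d)) ⟩
          ρ + d * k + u * n′ ∎
          where
          regroup : ∀ w ρ d → suc w * (ρ + d) ≡ ρ + (ρ * w + suc w * d)
          regroup = solve-∀
        n′≤ : n′ ≤ ρ + d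
        n′≤ = *-cancelˡ-≤ u {{>-nonZero u>0}} (≤-trans (m≤n+m (u * n′) (ρ + d * k)) (≤-reflexive (sym total)))

    module Run (j₁ r₀ : ℕ) (j₁<u : j₁ < u) (ur₀≡ : u * r₀ ≡ ρ + d * j₁) (h′ : ℕ) (h′≤L : h′ ≤ L) (r⊥L : Coprime (r₀ + d * h′) L) where
      r : ℕ
      r = r₀ + d * h′
      Y pos : ℕ → ℕ
      Y i = r + d * L * i
      pos i = e + (j₁ + u * h′ + i * (L * u))

      r₀⊥d : Coprime r₀ d
      r₀⊥d {f} (f∣r₀ , f∣d) = d⊥ρ (f∣d , ∣m+n∣m⇒∣n (subst (f ∣_) (trans ur₀≡ (+-comm ρ (d * j₁))) (∣n⇒∣m*n u f∣r₀)) (∣m⇒∣m*n j₁ f∣d))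

      r⊥dL : Coprime r (d * L)
      r⊥dL = coprime-*ʳ (λ {f} (f∣r , f∣d) → r₀⊥d (∣m+n∣m⇒∣n (subst (f ∣_) (+-comm r₀ (d * h′)) f∣r) (∣m⇒∣m*n h′ f∣d) , f∣d)) r⊥L

      Y⊥dL : ∀ i → Coprime (Y i) (d * L)
      Y⊥dL i {f} (f∣Y , f∣dL) = r⊥dL (∣m+n∣m⇒∣n (subst (f ∣_) (+-comm r (d * L * i)) f∣Y) (∣m⇒∣m*n i f∣dL) , f∣dL)

      -- A common factor divides dL(j - i) and is coprime to dL, so it divides j - i, which divides
      -- L; hence it is 1.
      pairwise : ∀ i j → i < j → j ≤ 11 → Coprime (Y i) (Y j)
      pairwise i j i<j j≤ {f} (f∣Yi , f∣Yj) = Y⊥dL i (f∣Yi , ∣n⇒∣m*n d (∣-trans f∣j-i (L-multiple (j ∸ i) (m<n⇒0<n∸m i<j) (≤-trans (m∸n≤m j i) j≤))))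
        where
        Yj≡ : Y j ≡ Y i + d * L * (j ∸ i)
        Yj≡ = trans (cong (λ z → r + d * L * z) (sym (m+[n∸m]≡n (<⇒≤ i<j)))) (regroup r (d * L) i (j ∸ i))
          where
          regroup : ∀ r D i s → r + D * (i + s) ≡ r + D * i + D * s
          regroup = solve-∀
        f∣j-i : f ∣ j ∸ i
        f∣j-i = coprime-divisor {n = d * L} (λ (g∣f , g∣dL) → Y⊥dL i (∣-trans g∣f f∣Yi , g∣dL)) (∣m+n∣m⇒∣n (subst (f ∣_) Yj≡ f∣Yj) f∣Yi)

      R≤r₀ : R ≤ r₀
      R≤r₀ = *-cancelˡ-≤ u {{>-nonZero u>0}} (begin
        u * R           ≡⟨ *-comm u R ⟩
        R * u           ≤⟨ Ru≤ρ ⟩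
        ρ               ≤⟨ m≤m+n ρ (d * j₁) ⟩
        ρ + d * j₁      ≡⟨ sym ur₀≡ ⟩
        u * r₀ ∎)

      R≤Y : ∀ i → R ≤ Y i
      R≤Y i = ≤-trans R≤r₀ (≤-trans (m≤m+n r₀ (d * h′)) (m≤m+n r (d * L * i)))

      r₀≤ : r₀ ≤ Q + d
      r₀≤ = *-cancelˡ-≤ u {{>-nonZero u>0}} (begin
        u * r₀          ≡⟨ ur₀≡ ⟩
        ρ + d * j₁      ≤⟨ +-mono-≤ ρ≤uQ (*-monoʳ-≤ d (<⇒≤ j₁<u)) ⟩
        u * Q + d * u   ≡⟨ cong (u * Q +_) (*-comm d u) ⟩
        u * Q + u * d   ≡⟨ sym (*-distribˡ-+ u Q d) ⟩
        u * (Q + d) ∎)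

      -- 13 = 1 + 1 + 11: the excess of r₀ over Q, the shift h′ ≤ L, and the index i ≤ 11.
      Y≤ : ∀ i → i ≤ 11 → Y i ≤ Q + 13 * (d * L)
      Y≤ i i≤ = begin
        r₀ + d * h′ + d * L * i             ≤⟨ +-mono-≤ (+-mono-≤ r₀≤ (*-monoʳ-≤ d h′≤L)) (*-monoʳ-≤ (d * L) i≤) ⟩
        Q + d + d * L + d * L * 11          ≤⟨ +-monoˡ-≤ (d * L * 11) (+-monoˡ-≤ (d * L) (+-monoʳ-≤ Q (m≤m*n d L {{>-nonZero L>0}}))) ⟩
        Q + d * L + d * L + d * L * 11      ≡⟨ collect Q (d * L) ⟩
        Q + 13 * (d * L) ∎
        where
        collect : ∀ Q D → Q + D + D + D * 11 ≡ Q + 13 * D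
        collect = solve-∀

      22Y≤M : ∀ i → i ≤ 11 → 22 * Y i ≤ M
      22Y≤M i i≤ = ≤-trans (*-monoʳ-≤ 22 (Y≤ i i≤)) M-large

      Y>0 : ∀ i → 0 < Y i
      Y>0 i = <-≤-trans R>0 (R≤Y i)

      Y<p : ∀ i → i ≤ 11 → Y i < p
      Y<p i i≤ = <-≤-trans (m<m+n (Y i) {21 * Y i} (≤-trans (Y>0 i) (m≤n*m (Y i) 21))) (≤-trans (22Y≤M i i≤) M≤p)

      d<p : d < p
      d<p = <-≤-trans (<-≤-trans (m<m+n d {d + 0} (≤-trans d>0 (m≤m+n d 0))) (≤-trans (*-mono-≤ (s≤s (s≤s (z≤n {20}))) (≤-trans (m≤m*n d L {{>-nonZero L>0}}) (≤-trans (m≤n*m (d * L) 13) (m≤n+m _ Q)))) M-large)) M≤p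

      u≤h : u ≤ h
      u≤h = ≤-trans (m≤m*n u (13 * L) {{>-nonZero (≤-trans L>0 (m≤n*m L 13))}}) fit

      u<p : u < p
      u<p = <-≤-trans (≤-<-trans (≤-trans u≤h (m≤n+m h e)) e+h<N) N≤p

      pos<N : ∀ i → i ≤ 11 → pos i < N
      pos<N i i≤ = ≤-<-trans (+-monoʳ-≤ e (begin
        j₁ + u * h′ + i * (L * u)       ≤⟨ +-mono-≤ (+-mono-≤ (<⇒≤ j₁<u) (*-monoʳ-≤ u h′≤L)) (*-monoˡ-≤ (L * u) i≤) ⟩
        u + u * L + 11 * (L * u)        ≤⟨ +-monoˡ-≤ (11 * (L * u)) (+-monoˡ-≤ (u * L) (m≤m*n u L {{>-nonZero L>0}})) ⟩
        u * L + u * L + 11 * (L * u)    ≡⟨ collect u L ⟩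
        u * (13 * L)                    ≤⟨ fit ⟩
        h ∎)) e+h<N
        where
        collect : ∀ u L → u * L + u * L + 11 * (L * u) ≡ u * (13 * L)
        collect = solve-∀

      ιd≢0 : ι d ≢ 0F
      ιd≢0 = ι≢0 d>0 d<p
      ιu≢0 : ι u ≢ 0F
      ιu≢0 = ι≢0 u>0 u<p
      ιY≢0 : ∀ i → i ≤ 11 → ι (Y i) ≢ 0F
      ιY≢0 i i≤ = ι≢0 (Y>0 i) (Y<p i i≤)

      module ≡R = ≡-Reasoning

      σ : F
      σ = ι d ⊗ inv (ι u)

      dy : ∀ i → ι d ⊗ ι (a + pos i) ≡ ι u ⊗ ι (Y i)
      dy i = ≡R.begin
        ι d ⊗ ι (a + pos i)                          ≡R.≡⟨ cong (λ z → ι d ⊗ ι z) (sym (+-assoc a e s)) ⟩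
        ι d ⊗ ι (a + e + s)                          ≡R.≡⟨ trans (cong (ι d ⊗_) (ι-+ (a + e) s)) (⊗-distribˡ-⊕ (ι d) _ _) ⟩
        ι d ⊗ ι (a + e) ⊕ ι d ⊗ ι s                  ≡R.≡⟨ cong₂ _⊕_ db (sym (ι-* d s)) ⟩
        ι ρ ⊕ ι (d * s)                              ≡R.≡⟨ sym (ι-+ ρ (d * s)) ⟩
        ι (ρ + d * s)                                ≡R.≡⟨ cong ι (begin-equality
          ρ + d * s                                    ≡⟨ regroup ρ d j₁ u h′ i L ⟩
          ρ + d * j₁ + u * (d * h′ + d * L * i)        ≡⟨ cong (_+ u * (d * h′ + d * L * i)) (sym ur₀≡) ⟩
          u * r₀ + u * (d * h′ + d * L * i)            ≡⟨ trans (sym (*-distribˡ-+ u r₀ _)) (cong (u *_) (sym (+-assoc r₀ _ _))) ⟩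
          u * Y i ∎) ⟩
        ι (u * Y i)                                  ≡R.≡⟨ ι-* u (Y i) ⟩
        ι u ⊗ ι (Y i) ≡R.∎
        where
        s = j₁ + u * h′ + i * (L * u)
        regroup : ∀ ρ d j u h i L → ρ + d * (j + u * h + i * (L * u)) ≡ ρ + d * j + u * (d * h + d * L * i)
        regroup = solve-∀

      inverse : ∀ i → i ≤ 11 → inv (ι (a + pos i)) ≡ σ ⊗ inv (ι (Y i))
      inverse i i≤ = sym (inv-unique (zf (pos i) (pos<N i i≤)) (≡R.begin
        y ⊗ (ι d ⊗ inv (ι u) ⊗ inv (ι (Y i)))                ≡R.≡⟨ S.solve 4 (λ y d iu iY → y S.:* (d S.:* iu S.:* iY) S.:= (d S.:* y) S.:* (iu S.:* iY)) refl y (ι d) (inv (ι u)) (inv (ι (Y i))) ⟩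
        (ι d ⊗ y) ⊗ (inv (ι u) ⊗ inv (ι (Y i)))              ≡R.≡⟨ cong (_⊗ (inv (ι u) ⊗ inv (ι (Y i)))) (dy i) ⟩
        (ι u ⊗ ι (Y i)) ⊗ (inv (ι u) ⊗ inv (ι (Y i)))        ≡R.≡⟨ S.solve 4 (λ u Y iu iY → (u S.:* Y) S.:* (iu S.:* iY) S.:= (u S.:* iu) S.:* (Y S.:* iY)) refl (ι u) (ι (Y i)) (inv (ι u)) (inv (ι (Y i))) ⟩
        (ι u ⊗ inv (ι u)) ⊗ (ι (Y i) ⊗ inv (ι (Y i)))        ≡R.≡⟨ cong₂ _⊗_ (inv-right ιu≢0) (inv-right (ιY≢0 i i≤)) ⟩
        1F ⊗ 1F                                              ≡R.≡⟨ ⊗-identityˡ 1F ⟩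
        1F ≡R.∎))
        where
        y : F
        y = ι (a + pos i)

      module C = Cover M a N Y pos σ pos<N Y>0 (λ i i≤ → ≤-trans (m≤n*m (Y i) 22) (22Y≤M i i≤)) ιY≢0 pairwise inverse

      tail≥ : ∀ k → R ^ k ≤ C.tailProduct k
      tail≥ zero    = ≤-refl
      tail≥ (suc k) = *-mono-≤ (R≤Y (suc k)) (tail≥ k)

      -- As 22 Y 0 ≤ M, the 11 products lost at the lower end take at most half of the interval;
      -- `p-small` fits p into the other half.
      room : 11 * C.product 11 + p ≤ M * C.tailProduct 11
      room = *-cancelˡ-≤ 2 (begin
        2 * (11 * C.product 11 + p)                       ≡⟨ cong (λ z → 2 * (11 * z + p)) (C.product≡ 11) ⟩
        2 * (11 * (Y 0 * t) + p)                          ≡⟨ regroup (Y 0) t p ⟩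
        22 * Y 0 * t + 2 * p                              ≤⟨ +-mono-≤ (*-monoˡ-≤ t (22Y≤M 0 z≤n)) (≤-trans p-small (*-monoʳ-≤ M (tail≥ 11))) ⟩
        M * t + M * t                                     ≡⟨ cong (M * t +_) (sym (+-identityʳ (M * t))) ⟩
        2 * (M * t) ∎)
        where
        t = C.tailProduct 11
        regroup : ∀ y t p → 2 * (11 * (y * t) + p) ≡ 22 * y * t + 2 * p
        regroup = solve-∀

      filled : ∀ x → Represented M a N 12 x
      filled = C.cover-all (⊗-≢0 ιd≢0 (inv-≢0 ιu≢0)) 11 ≤-refl room

    finish : ∀ x → Represented M a N 12 x
    finish = from-start begin-at
      where
      from-start : Start → ∀ x → Represented M a N 12 x
      from-start (start-at j₁ r₀ j₁<u ur₀≡) = from-shift (coprime-shift {r₀} {d} L L>0 r₀⊥d)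
        where
        r₀⊥d : Coprime r₀ d
        r₀⊥d {f} (f∣r₀ , f∣d) = d⊥ρ (f∣d , ∣m+n∣m⇒∣n (subst (f ∣_) (trans ur₀≡ (+-comm ρ (d * j₁))) (∣n⇒∣m*n u f∣r₀)) (∣m⇒∣m*n j₁ f∣d))
        from-shift : (∃ λ h′ → h′ ≤ L × Coprime (r₀ + d * h′) L) → ∀ x → Represented M a N 12 x
        from-shift (h′ , h′≤L , r⊥L) = Run.filled j₁ r₀ j₁<u ur₀≡ h′ h′≤L r⊥L

-- First range: small and large remainders, reflection.

module DirectCases (p : ℕ) (p-prime : Prime p) (A L : ℕ) (L>0 : 0 < L) (L-multiple : ∀ k → 0 < k → k ≤ 11 → k ∣ L)
                   (M N h Q R₀ R₁ H X : ℕ) (M≤p : M ≤ p) (N≤p : N ≤ p) (2h<N : h + h < N) (Q>0 : 0 < Q)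
                   (Q-small : 22 * ((3 + 13 * L) * Q) ≤ M) (R₀≤Q : R₀ ≤ Q) (R₀-fits : suc R₀ + 13 * L ≤ h) (p-small₀ : 2 * p ≤ M * R₀ ^ 11)
                   (H-fits : H * (13 * L) ≤ h)
                   -- A remainder ρ with ρQ ≤ p exceeds Q only if Q² < p, so these bounds are
                   -- required in that case alone.
                   (hard : Q * Q < p → R₁ * H ≤ Q × 2 * p ≤ M * R₁ ^ 11 × p < X * (Q * Q) × 2 * suc X ≤ H ×
                           48 * (p * p) ≤ H * H * H * (h * Q * (h * Q)) × (H * (h * Q) < 2 * p → X * X ≤ H)) where
  open PrimeField p p-prime
  open Intervals p p-prime
  open Representations p p-prime A
  open Direct p p-prime A
  open DirectRange p p-prime A L L>0 L-multiple

  module Anchored (a : ℕ) (zf : ZeroFree a N) where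

    -- Here u = 1. Advancing by about R₀/d places lifts the remainder to at least R₀, so that the
    -- product of the denominators is large enough, while it stays below 3Q.
    small-remainder : ∀ e d ρ → e + h < N → 0 < d → d ≤ Q → Coprime d ρ → ι d ⊗ ι (a + e) ≡ ι ρ → ρ ≤ Q → ∀ x → Represented M a N 12 x
    small-remainder e d ρ e+h<N d>0 d≤Q d⊥ρ db ρ≤Q =
      Finish.finish M a N zf M≤p N≤p (e + j) (h ∸ j) d (ρ + d * j) 1 (ρ + d * j) R₀ fits d>0 d⊥ρ′ (λ {f} → Cop.1-coprimeTo d {f}) (s≤s z≤n) db′
        room (≤-reflexive (sym (*-identityˡ _))) R₀≤ρ′ M-large p-small₀
      where
      open ≤-Reasoning
      instance
        d-nonZero : NonZero d
        d-nonZero = >-nonZero d>0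
      j = suc (R₀ / d)
      j≤ : j ≤ suc R₀
      j≤ = s≤s (m/n≤m R₀ d)
      j≤h : j ≤ h
      j≤h = ≤-trans j≤ (≤-trans (m≤m+n (suc R₀) _) R₀-fits)
      dj≡ : d * j ≡ R₀ / d * d + d
      dj≡ = trans (*-suc d (R₀ / d)) (trans (+-comm d _) (cong (_+ d) (*-comm d (R₀ / d))))
      dj≤ : d * j ≤ R₀ + d
      dj≤ = ≤-trans (≤-reflexive dj≡) (+-monoˡ-≤ d (m/n*n≤m R₀ d))
      R₀≤dj : R₀ ≤ d * j
      R₀≤dj = ≤-trans (≤-reflexive (trans (m≡m%n+[m/n]*n R₀ d) (+-comm (R₀ % d) _))) (≤-trans (+-monoʳ-≤ (R₀ / d * d) (<⇒≤ (m%n<n R₀ d))) (≤-reflexive (sym dj≡)))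
      fits : e + j + (h ∸ j) < N
      fits = ≤-<-trans (≤-reflexive (trans (+-assoc e j _) (cong (e +_) (m+[n∸m]≡n j≤h)))) e+h<N
      d⊥ρ′ : Coprime d (ρ + d * j)
      d⊥ρ′ {f} (f∣d , f∣ρ′) = d⊥ρ (f∣d , ∣m+n∣m⇒∣n (subst (f ∣_) (+-comm ρ (d * j)) f∣ρ′) (∣m⇒∣m*n j f∣d))
      db′ : ι d ⊗ ι (a + (e + j)) ≡ ι (ρ + d * j)
      db′ = trans (cong (λ z → ι d ⊗ ι z) (sym (+-assoc a e j))) (trans (cong (ι d ⊗_) (ι-+ (a + e) j)) (trans (⊗-distribˡ-⊕ (ι d) _ _)
        (trans (cong₂ _⊕_ db (sym (ι-* d j))) (sym (ι-+ ρ (d * j))))))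
      room : 1 * (13 * L) ≤ h ∸ j
      room = ≤-trans (≤-reflexive (*-identityˡ _)) (m+n≤o⇒m≤o∸n (13 * L) (≤-trans (≤-trans (+-monoʳ-≤ (13 * L) j≤) (≤-reflexive (+-comm (13 * L) (suc R₀)))) R₀-fits))
      R₀≤ρ′ : R₀ * 1 ≤ ρ + d * j
      R₀≤ρ′ = ≤-trans (≤-reflexive (*-identityʳ R₀)) (≤-trans R₀≤dj (m≤n+m _ ρ))
      M-large : 22 * (ρ + d * j + 13 * (d * L)) ≤ M
      M-large = begin
        22 * (ρ + d * j + 13 * (d * L))        ≤⟨ *-monoʳ-≤ 22 (+-mono-≤ (+-mono-≤ ρ≤Q (≤-trans dj≤ (+-mono-≤ R₀≤Q d≤Q))) (*-monoʳ-≤ 13 (*-monoˡ-≤ L d≤Q))) ⟩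
        22 * (Q + (Q + Q) + 13 * (Q * L))      ≡⟨ collect Q L ⟩
        22 * ((3 + 13 * L) * Q)                ≤⟨ Q-small ⟩
        M ∎
        where
        collect : ∀ Q L → 22 * (Q + (Q + Q) + 13 * (Q * L)) ≡ 22 * ((3 + 13 * L) * Q)
        collect = solve-∀

    -- ρ may be as large as p/Q. As p < XQ², division by some u ≥ X brings it down to Q; u ≤ H keeps
    -- it above R₁ and the steps within J.
    large-remainder : ∀ e d ρ → e + h < N → 0 < d → d ≤ Q → ρ * Q ≤ p → Coprime d ρ → ι d ⊗ ι (a + e) ≡ ι ρ → Q < ρ → d * h < ρ → ∀ x → Represented M a N 12 x
    large-remainder e d ρ e+h<N d>0 d≤Q ρQ≤p d⊥ρ db Q<ρ dh<ρ = split (hard (<-≤-trans (*-monoˡ-< Q {{>-nonZero Q>0}} Q<ρ) ρQ≤p))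
      where
      open ≤-Reasoning
      split : R₁ * H ≤ Q × 2 * p ≤ M * R₁ ^ 11 × p < X * (Q * Q) × 2 * suc X ≤ H ×
              48 * (p * p) ≤ H * H * H * (h * Q * (h * Q)) × (H * (h * Q) < 2 * p → X * X ≤ H) → ∀ x → Represented M a N 12 x
      split (R₁H≤Q , p-small₁ , p<XQ² , 2X≤H , cube , square) = with-u (coprime-multiplier d X H d>0 2X≤H difficult)
        where
        hQ = h * Q
        dhQ≤p : d * hQ ≤ p
        dhQ≤p = ≤-trans (≤-reflexive (sym (*-assoc d h Q))) (≤-trans (*-monoˡ-≤ Q (<⇒≤ dh<ρ)) ρQ≤p)
        hQ>0 : 0 < hQ
        hQ>0 = *-mono-≤ (≤-trans (s≤s z≤n) (≤-trans (m≤m+n (suc R₀) _) R₀-fits)) Q>0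
        difficult : H < 2 * d → 48 * (d * d) ≤ H * H * H × X * X ≤ H
        difficult H<2d = *-cancelʳ-≤ (48 * (d * d)) (H * H * H) (hQ * hQ) {{>-nonZero (*-mono-≤ hQ>0 hQ>0)}} (begin
            48 * (d * d) * (hQ * hQ)         ≡⟨ regroup d hQ ⟩
            48 * (d * hQ * (d * hQ))         ≤⟨ *-monoʳ-≤ 48 (*-mono-≤ dhQ≤p dhQ≤p) ⟩
            48 * (p * p)                     ≤⟨ cube ⟩
            H * H * H * (hQ * hQ) ∎) ,
          square (begin-strict
            H * hQ                           <⟨ *-monoˡ-< hQ {{>-nonZero hQ>0}} H<2d ⟩
            2 * d * hQ                       ≡⟨ *-assoc 2 d hQ ⟩
            2 * (d * hQ)                     ≤⟨ *-monoʳ-≤ 2 dhQ≤p ⟩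
            2 * p ∎)
          where
          regroup : ∀ d y → 48 * (d * d) * (y * y) ≡ 48 * (d * y * (d * y))
          regroup = solve-∀
        ρ<XQ : ρ < X * Q
        ρ<XQ = *-cancelʳ-< Q ρ (X * Q) (≤-<-trans ρQ≤p (<-≤-trans p<XQ² (≤-reflexive (sym (*-assoc X Q Q)))))
        M-large : 22 * (Q + 13 * (d * L)) ≤ M
        M-large = ≤-trans (*-monoʳ-≤ 22 (begin
          Q + 13 * (d * L)         ≤⟨ +-mono-≤ (m≤n*m Q 3) (*-monoʳ-≤ 13 (*-monoˡ-≤ L d≤Q)) ⟩
          3 * Q + 13 * (Q * L)     ≡⟨ collect Q L ⟩
          (3 + 13 * L) * Q ∎)) Q-small
          where
          collect : ∀ Q L → 3 * Q + 13 * (Q * L) ≡ (3 + 13 * L) * Q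
          collect = solve-∀
        with-u : (∃ λ u → X ≤ u × u ≤ H × Coprime u d) → ∀ x → Represented M a N 12 x
        with-u (u , X≤u , u≤H , u⊥d) = Finish.finish M a N zf M≤p N≤p e h d ρ u Q R₁ e+h<N d>0 (λ {f} → d⊥ρ {f}) (λ {f} → u⊥d {f})
          u>0 db (≤-trans (*-monoˡ-≤ (13 * L) u≤H) H-fits) (≤-trans (<⇒≤ ρ<XQ) (*-monoˡ-≤ Q X≤u))
          (≤-trans (*-monoʳ-≤ R₁ u≤H) (≤-trans R₁H≤Q (<⇒≤ Q<ρ))) M-large p-small₁
          where
          u>0 : 0 < u
          u>0 = <-≤-trans (n≢0⇒n>0 λ X≡0 → n≮0 (<-≤-trans p<XQ² (≤-reflexive (cong (_* (Q * Q)) X≡0)))) X≤u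

    -- If ρ ≤ dh, going back ρ/d ≤ h ≤ c places replaces ρ by its residue modulo d, which is small.
    -- Otherwise dh < ρ ≤ p/Q bounds d by p/(hQ), which the search for u relies on.
    anchored : ∀ c d ρ → h ≤ c → c + h < N → 0 < d → d ≤ Q → ρ * Q ≤ p → Coprime d ρ → ι d ⊗ ι (a + c) ≡ ι ρ → ∀ x → Represented M a N 12 x
    anchored c d ρ h≤c c+h<N d>0 d≤Q ρQ≤p d⊥ρ db = by (ρ ≤? d * h) (ρ ≤? Q)
      where
      by : Dec (ρ ≤ d * h) → Dec (ρ ≤ Q) → ∀ x → Represented M a N 12 x
      by (no ρ>dh) (yes ρ≤Q) = small-remainder c d ρ c+h<N d>0 d≤Q (λ {f} → d⊥ρ {f}) db ρ≤Q
      by (no ρ>dh) (no ρ>Q)  = large-remainder c d ρ c+h<N d>0 d≤Q ρQ≤p (λ {f} → d⊥ρ {f}) db (≰⇒> ρ>Q) (≰⇒> ρ>dh)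
      by (yes ρ≤dh) _        = small-remainder (c ∸ s) d (ρ % d) (≤-<-trans (+-monoˡ-≤ h (m∸n≤m c s)) c+h<N) d>0 d≤Q d⊥ρ′ db′ (≤-trans (<⇒≤ (m%n<n ρ d)) d≤Q)
        where
        instance
          d-nonZero : NonZero d
          d-nonZero = >-nonZero d>0
        s = ρ / d
        s≤c : s ≤ c
        s≤c = ≤-trans (*-cancelˡ-≤ d (≤-trans (≤-reflexive (*-comm d s)) (≤-trans (m/n*n≤m ρ d) ρ≤dh))) h≤c
        d⊥ρ′ : Coprime d (ρ % d)
        d⊥ρ′ {f} (f∣d , f∣ρ′) = d⊥ρ (f∣d , subst (f ∣_) (sym (m≡m%n+[m/n]*n ρ d)) (∣m∣n⇒∣m+n f∣ρ′ (∣n⇒∣m*n s f∣d)))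
        db′ : ι d ⊗ ι (a + (c ∸ s)) ≡ ι (ρ % d)
        db′ = begin
          ι d ⊗ ι (a + (c ∸ s))                              ≡⟨ S.solve 3 (λ d y s → d S.:* y S.:= d S.:* (y S.:+ s) S.:- s S.:* d) refl (ι d) _ (ι s) ⟩
          ι d ⊗ (ι (a + (c ∸ s)) ⊕ ι s) ⊝ ι s ⊗ ι d          ≡⟨ cong₂ (λ y z → ι d ⊗ y ⊝ z) (trans (sym (ι-+ (a + (c ∸ s)) s)) (cong ι (trans (+-assoc a _ s) (cong (a +_) (m∸n+n≡m s≤c))))) (sym (ι-* s d)) ⟩
          ι d ⊗ ι (a + c) ⊝ ι (s * d)                        ≡⟨ cong (_⊝ ι (s * d)) (trans db (trans (cong ι (m≡m%n+[m/n]*n ρ d)) (ι-+ (ρ % d) (s * d)))) ⟩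
          (ι (ρ % d) ⊕ ι (s * d)) ⊝ ι (s * d)                ≡⟨ S.solve 2 (λ r t → (r S.:+ t) S.:- t S.:= r) refl (ι (ρ % d)) (ι (s * d)) ⟩
          ι (ρ % d) ∎
          where open ≡-Reasoning

  -- For d y = -ρ the interval J is replaced by -J, which turns the sign around; all sums change
  -- sign, so the target is negated as well.
  module Reflection (a : ℕ) (zf : ZeroFree a N) where
    a′ : ℕ
    a′ = rep (⊖ ι (a + pred N))

    reflected : ∀ j → j < N → ι (a′ + j) ≡ ⊖ ι (a + (pred N ∸ j))
    reflected j j<N = begin
      ι (a′ + j)                                            ≡⟨ trans (ι-+ a′ j) (cong (_⊕ ι j) (ι-rep _)) ⟩
      ⊖ ι (a + pred N) ⊕ ι j                                ≡⟨ cong (λ z → ⊖ z ⊕ ι j) (trans (cong ι (trans (cong (a +_) (sym (m∸n+n≡m (<⇒≤pred j<N)))) (sym (+-assoc a _ j)))) (ι-+ (a + (pred N ∸ j)) j)) ⟩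
      ⊖ (ι (a + (pred N ∸ j)) ⊕ ι j) ⊕ ι j                  ≡⟨ S.solve 2 (λ y j → S.:- (y S.:+ j) S.:+ j S.:= S.:- y) refl (ι (a + (pred N ∸ j))) (ι j) ⟩
      ⊖ ι (a + (pred N ∸ j)) ∎
      where open ≡-Reasoning

    ⊖≢0 : ∀ {y} → y ≢ 0F → ⊖ y ≢ 0F
    ⊖≢0 {y} y≢0 e = y≢0 (trans (S.solve 1 (λ y → y S.:= S.:- (S.:- y)) refl y) (trans (cong ⊖_ e) (S.solve 0 (S.:- S.con (ℤ.+ 0) S.:= S.con (ℤ.+ 0)) refl)))

    inv-⊖ : ∀ {y} → y ≢ 0F → inv (⊖ y) ≡ ⊖ inv y
    inv-⊖ {y} y≢0 = sym (inv-unique (⊖≢0 y≢0) (trans (S.solve 2 (λ y i → S.:- y S.:* (S.:- i) S.:= y S.:* i) refl y (inv y)) (inv-right y≢0)))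

    reflected<N : ∀ j → j < N → pred N ∸ j < N
    reflected<N j j<N = ≤-<-trans (m∸n≤m (pred N) j) (≤-reflexive (suc-pred N {{>-nonZero (≤-<-trans z≤n j<N)}}))

    zf′ : ZeroFree a′ N
    zf′ j j<N e = ⊖≢0 (zf (pred N ∸ j) (reflected<N j j<N)) (trans (sym (reflected j j<N)) e)

    unreflect : ∀ {n x} → Represented M a′ N n x → Represented M a N n (⊖ x)
    unreflect (v , bv , refl) = Vec.map flip v , bounds v bv , value v bv
      where
      flip : ℕ × ℕ → ℕ × ℕ
      flip (k , j) = k , pred N ∸ j
      bounds : ∀ {n} (v : Vec (ℕ × ℕ) n) → VAll.All (λ (k , j) → k < M × j < N) v → VAll.All (λ (k , j) → k < M × j < N) (Vec.map flip v)
      bounds [] [] = []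
      bounds ((k , j) ∷ v) ((k< , j<) ∷ bv) = (k< , reflected<N j j<) ∷ bounds v bv
      value : ∀ {n} (v : Vec (ℕ × ℕ) n) → VAll.All (λ (k , j) → k < M × j < N) v → quotSum a (Vec.map flip v) ≡ ⊖ quotSum a′ v
      value [] [] = sym (S.solve 0 (S.:- S.con (ℤ.+ 0) S.:= S.con (ℤ.+ 0)) refl)
      value ((k , j) ∷ v) ((k< , j<) ∷ bv) = begin
        ι (A + k) ⊗ inv y ⊕ quotSum a (Vec.map flip v)    ≡⟨ cong (ι (A + k) ⊗ inv y ⊕_) (value v bv) ⟩
        ι (A + k) ⊗ inv y ⊕ ⊖ quotSum a′ v                ≡⟨ S.solve 3 (λ k i q → k S.:* i S.:+ S.:- q S.:= S.:- (k S.:* (S.:- i) S.:+ q)) refl (ι (A + k)) (inv y) (quotSum a′ v) ⟩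
        ⊖ (ι (A + k) ⊗ (⊖ inv y) ⊕ quotSum a′ v)          ≡⟨ cong (λ z → ⊖ (ι (A + k) ⊗ z ⊕ quotSum a′ v)) (trans (sym (inv-⊖ (zf _ (reflected<N j j<)))) (cong inv (sym (reflected j j<)))) ⟩
        ⊖ (ι (A + k) ⊗ inv (ι (a′ + j)) ⊕ quotSum a′ v) ∎
        where
        open ≡-Reasoning
        y : F
        y = ι (a + (pred N ∸ j))

  direct-range : ∀ a → ZeroFree a N → ∀ x → Represented M a N 12 x
  -- The approximated element is h places from the start and more than h from the end, so there is
  -- room on both sides, before and after reflection.
  direct-range a zf x = from (dirichlet (ι (a + h)) Q Q>0 Q<p)
    where
    Q<p : Q < p
    Q<p = <-≤-trans (<-≤-trans (m<m+n Q {Q + 0} (≤-trans Q>0 (m≤m+n Q 0))) (≤-trans (*-mono-≤ (s≤s (s≤s (z≤n {20}))) (m≤n*m Q (3 + 13 * L))) Q-small)) M≤p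
    open Reflection a zf
    h<N : h < N
    h<N = ≤-<-trans (m≤m+n h h) 2h<N
    h≤pred : h + h ≤ pred N
    h≤pred = <⇒≤pred 2h<N
    from : Approximation (ι (a + h)) Q → Represented M a N 12 x
    from (approximation d ρ d>0 d≤Q ρQ≤p d⊥ρ (inj₁ db)) = Anchored.anchored a zf h d ρ ≤-refl 2h<N d>0 d≤Q ρQ≤p (λ {f} → d⊥ρ {f}) db x
    from (approximation d ρ d>0 d≤Q ρQ≤p d⊥ρ (inj₂ db)) = subst (Represented M a N 12) (S.solve 1 (λ x → S.:- (S.:- x) S.:= x) refl x)
      (unreflect (Anchored.anchored a′ zf′ (pred N ∸ h) d ρ (m+n≤o⇒m≤o∸n h h≤pred)
        (≤-<-trans (≤-reflexive (m∸n+n≡m (<⇒≤pred h<N))) (≤-reflexive (suc-pred N {{>-nonZero (≤-<-trans z≤n h<N)}}))) d>0 d≤Q ρQ≤p (λ {f} → d⊥ρ {f}) db′ (⊖ x)))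
      where
      centre : ι (a′ + (pred N ∸ h)) ≡ ⊖ ι (a + h)
      centre = trans (reflected (pred N ∸ h) (reflected<N h h<N)) (cong (λ z → ⊖ ι (a + z)) (m∸[m∸n]≡n (<⇒≤pred h<N)))
      db′ : ι d ⊗ ι (a′ + (pred N ∸ h)) ≡ ι ρ
      db′ = trans (cong (ι d ⊗_) centre) (trans (S.solve 2 (λ d y → d S.:* (S.:- y) S.:= S.:- (d S.:* y)) refl (ι d) (ι (a + h)))
        (trans (cong ⊖_ db) (S.solve 1 (λ r → S.:- (S.:- r) S.:= r) refl (ι ρ))))

-- Monomial inequalities lᵢ ≤ rᵢ in positive quantities K = x₀, x₁, … with K ≥ 2 are contradictory as soon as
-- Π lᵢ^kᵢ = K^t Π rᵢ^kᵢ for some t ≥ 1; the exponents kᵢ are supplied as a certificate.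
data Mon (n : ℕ) : Set where
  `_   : Fin n → Mon n
  _·_  : Mon n → Mon n → Mon n
  _^′_ : Mon n → ℕ → Mon n
  ε    : Mon n

infix  9 `_
infixl 7 _·_
infixr 8 _^′_

module _ {n : ℕ} (env : Vec ℕ n) where

  ⟪_⟫ : Mon n → ℕ
  ⟪ ` i ⟫    = Vec.lookup env i
  ⟪ a · b ⟫  = ⟪ a ⟫ * ⟪ b ⟫
  ⟪ a ^′ k ⟫ = ⟪ a ⟫ ^ k
  ⟪ ε ⟫      = 1

powers : ∀ {n} → Vec ℕ n → Vec ℕ n → ℕ
powers []        []       = 1
powers (x ∷ env) (e ∷ es) = x ^ e * powers env es

exponents : ∀ {n} → Mon n → Vec ℕ n
exponents {n} (` i) = Vec.replicate n 0 Vec.[ i ]≔ 1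
exponents (a · b)   = zipWith _+_ (exponents a) (exponents b)
exponents (a ^′ k)  = Vec.map (_* k) (exponents a)
exponents {n} ε     = Vec.replicate n 0

powers-0 : ∀ {n} (env : Vec ℕ n) → powers env (Vec.replicate n 0) ≡ 1
powers-0 []        = refl
powers-0 (x ∷ env) = trans (*-identityˡ _) (powers-0 env)

powers-+ : ∀ {n} (env es fs : Vec ℕ n) → powers env (zipWith _+_ es fs) ≡ powers env es * powers env fs
powers-+ []        []       []       = refl
powers-+ (x ∷ env) (e ∷ es) (f ∷ fs) rewrite powers-+ env es fs | ^-distribˡ-+-* x e f = exchange (x ^ e) (x ^ f) (powers env es) (powers env fs)
  where
  exchange : ∀ a b c d → a * b * (c * d) ≡ a * c * (b * d)
  exchange = solve-∀

powers-* : ∀ {n} (env es : Vec ℕ n) k → powers env (Vec.map (_* k) es) ≡ powers env es ^ k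
powers-* []        []       k = sym (^-zeroˡ k)
powers-* (x ∷ env) (e ∷ es) k rewrite powers-* env es k | sym (^-*-assoc x e k) = sym (^-distribʳ (x ^ e) (powers env es) k)

powers-single : ∀ {n} (env : Vec ℕ n) i → powers env (Vec.replicate n 0 Vec.[ i ]≔ 1) ≡ Vec.lookup env i
powers-single (x ∷ env) zero    = trans (cong₂ _*_ (*-identityʳ x) (powers-0 env)) (*-identityʳ x)
powers-single (x ∷ env) (suc i) = trans (*-identityˡ _) (powers-single env i)

powers-exponents : ∀ {n} (env : Vec ℕ n) (a : Mon n) → powers env (exponents a) ≡ ⟪ env ⟫ a
powers-exponents env (` i)    = powers-single env i
powers-exponents env (a · b)  = trans (powers-+ env (exponents a) (exponents b)) (cong₂ _*_ (powers-exponents env a) (powers-exponents env b))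
powers-exponents env (a ^′ k) = trans (powers-* env (exponents a) k) (cong (_^ k) (powers-exponents env a))
powers-exponents env ε        = powers-0 env

powers>0 : ∀ {n} {env : Vec ℕ n} → VAll.All (0 <_) env → ∀ es → 0 < powers env es
powers>0 []         []       = s≤s z≤n
powers>0 (x>0 ∷ q) (e ∷ es) = *-mono-≤ (m^n>0 _ {{>-nonZero x>0}} e) (powers>0 q es)

record Fact {n} (env : Vec ℕ n) : Set where
  constructor fact
  field
    l r : Mon n
    holds : ⟪ env ⟫ l ≤ ⟪ env ⟫ r

combinedˡ combinedʳ : ∀ {n} {env : Vec ℕ n} → List (ℕ × Fact env) → Vec ℕ n
combinedˡ {n} [] = Vec.replicate n 0
combinedˡ ((k , fact l r _) ∷ fs) = zipWith _+_ (Vec.map (_* k) (exponents l)) (combinedˡ fs)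
combinedʳ {n} [] = Vec.replicate n 0
combinedʳ ((k , fact l r _) ∷ fs) = zipWith _+_ (Vec.map (_* k) (exponents r)) (combinedʳ fs)

combined-≤ : ∀ {n} {env : Vec ℕ n} (fs : List (ℕ × Fact env)) → powers env (combinedˡ fs) ≤ powers env (combinedʳ fs)
combined-≤ [] = ≤-refl
combined-≤ {env = env} ((k , fact l r holds) ∷ fs) = begin
  powers env (zipWith _+_ (Vec.map (_* k) (exponents l)) (combinedˡ fs))          ≡⟨ expand l (combinedˡ fs) ⟩
  ⟪ env ⟫ l ^ k * powers env (combinedˡ fs)                                       ≤⟨ *-mono-≤ (^-monoˡ-≤ k holds) (combined-≤ fs) ⟩
  ⟪ env ⟫ r ^ k * powers env (combinedʳ fs)                                       ≡⟨ sym (expand r (combinedʳ fs)) ⟩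
  powers env (zipWith _+_ (Vec.map (_* k) (exponents r)) (combinedʳ fs)) ∎
  where
  open ≤-Reasoning
  expand : ∀ a es → powers env (zipWith _+_ (Vec.map (_* k) (exponents a)) es) ≡ ⟪ env ⟫ a ^ k * powers env es
  expand a es = trans (powers-+ env (Vec.map (_* k) (exponents a)) es) (cong (_* powers env es) (trans (powers-* env (exponents a) k) (cong (_^ k) (powers-exponents env a))))

-- The products of powers are compared by exponent vectors alone, so the hypothesis is a closed
-- computation and each use ends in `refl`. The first number supplied is t, one less than the
-- surplus exponent of K. Variable 0 is K, and variable i + 1 is entry i of `env`.
certificate : ∀ {n} {K : ℕ} {env : Vec ℕ n} → 2 ≤ K → VAll.All (0 <_) env → ∀ t (fs : List (ℕ × Fact (K ∷ env))) →
              combinedˡ fs ≡ zipWith _+_ (suc t ∷ Vec.replicate n 0) (combinedʳ fs) → ⊥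
certificate {n} {K} {env} 2≤K env>0 t fs e = <⇒≱ larger (≤-trans (≤-reflexive (sym eq)) (combined-≤ fs))
  where
  K>0 : 0 < K
  K>0 = <⇒≤ 2≤K
  q = powers (K ∷ env) (combinedʳ fs)
  eq : powers (K ∷ env) (combinedˡ fs) ≡ K ^ suc t * 1 * q
  eq = trans (cong (powers (K ∷ env)) e) (trans (powers-+ (K ∷ env) (suc t ∷ Vec.replicate n 0) (combinedʳ fs)) (cong (λ z → K ^ suc t * z * q) (powers-0 env)))
  larger : q < K ^ suc t * 1 * q
  larger = <-≤-trans (m<m+n q {q + 0} (≤-trans (powers>0 (K>0 ∷ env>0) (combinedʳ fs)) (m≤m+n q 0)))
    (*-monoˡ-≤ q (≤-trans 2≤K (≤-trans (m≤m*n K (K ^ t) {{>-nonZero (m^n>0 K {{>-nonZero K>0}} t)}}) (≤-reflexive (sym (*-identityʳ (K ^ suc t)))))))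

-- The absolute constants, and divisions with loss bounded by powers of K.

abstract
  -- L is lcm(1,...,11). K = 2^23 is the first power of two above 22(3 + 13L) = 7927986; being a
  -- single base for all losses, it reduces every estimate to a comparison of monomials.
  K L : ℕ
  K = 8388608
  L = 27720

  4913≤K : 4913 ≤ K
  4913≤K = ≤ᵇ⇒≤ 4913 K tt

  L>0 : 0 < L
  L>0 = s≤s z≤n

  22[3+13L]≤K : 22 * (3 + 13 * L) ≤ K
  22[3+13L]≤K = ≤ᵇ⇒≤ (22 * (3 + 13 * L)) K tt

  suc[13L]≤K : suc (13 * L) ≤ K
  suc[13L]≤K = ≤ᵇ⇒≤ (suc (13 * L)) K tt

  L-multiple : ∀ k → 0 < k → k ≤ 11 → k ∣ L
  L-multiple 1  _ _ = divides 27720 refl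
  L-multiple 2  _ _ = divides 13860 refl
  L-multiple 3  _ _ = divides 9240 refl
  L-multiple 4  _ _ = divides 6930 refl
  L-multiple 5  _ _ = divides 5544 refl
  L-multiple 6  _ _ = divides 4620 refl
  L-multiple 7  _ _ = divides 3960 refl
  L-multiple 8  _ _ = divides 3465 refl
  L-multiple 9  _ _ = divides 3080 refl
  L-multiple 10 _ _ = divides 2772 refl
  L-multiple 11 _ _ = divides 2520 refl
  L-multiple (suc (suc (suc (suc (suc (suc (suc (suc (suc (suc (suc (suc _)))))))))))) _ (s≤s (s≤s (s≤s (s≤s (s≤s (s≤s (s≤s (s≤s (s≤s (s≤s (s≤s ())))))))))))

below-K : ∀ c {rest} → c + rest ≡ 4913 → c ≤ K
below-K c e = ≤-trans (≤-trans (m≤m+n c _) (≤-reflexive e)) 4913≤K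

2≤K : 2 ≤ K
2≤K = below-K 2 refl

K>0 : 0 < K
K>0 = <⇒≤ 2≤K

instance
  K-nonZero : NonZero K
  K-nonZero = >-nonZero K>0

floor-upper : ∀ m d .{{_ : NonZero d}} → m < suc (m / d) * d
floor-upper m d = ≤-<-trans (≤-reflexive (m≡m%n+[m/n]*n m d)) (+-monoˡ-< (m / d * d) (m%n<n m d))

-- A floor that is at least 1 loses at most a factor 2, recorded as K to keep the inequality
-- monomial.
floor-lower : ∀ m d .{{_ : NonZero d}} → d ≤ m → m ≤ K * (d * (m / d))
floor-lower m d d≤m = begin
  m                          ≤⟨ <⇒≤ (floor-upper m d) ⟩
  suc q * d                  ≤⟨ *-monoˡ-≤ d (+-monoˡ-≤ q (m≥n⇒m/n>0 d≤m)) ⟩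
  (q + q) * d                ≡⟨ double q d ⟩
  2 * (d * q)                ≤⟨ *-monoˡ-≤ (d * q) 2≤K ⟩
  K * (d * q) ∎
  where
  open ≤-Reasoning
  q = m / d
  double : ∀ q d → (q + q) * d ≡ 2 * (d * q)
  double = solve-∀

-- Choice of parameters in the three ranges.

module Numbers (p M N : ℕ) (p>0 : 0 < p) (M>0 : 0 < M) (N>0 : 0 < N) (M≤p : M ≤ p) (N≤p : N ≤ p)
               (size : p ^ 15 * K ^ 221 ≤ M ^ 20 * (K * N) ^ 21) (N-large : p ^ 5 ≤ (K * N) ^ 119) (p-large : K ^ 1000 ≤ p) where

  K⁶≤N : K ^ 6 ≤ N
  K⁶≤N = ≮⇒≥ λ N< → certificate {env = p ∷ M ∷ N ∷ []} 2≤K (p>0 ∷ M>0 ∷ N>0 ∷ []) 4166 ((1 , fact ((` # 1 ^′ 5)) (((` # 0 · ` # 3) ^′ 119)) (N-large)) ∷ (5 , fact ((` # 0 ^′ 1000)) (` # 1) (p-large)) ∷ (119 , fact (` # 3) ((` # 0 ^′ 6)) (<⇒≤ N<)) ∷ []) refl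

  module ShortDenominators (D : N ^ 47 ≤ p ^ 15) where
    N≤M : N ≤ M
    N≤M = ≮⇒≥ λ M<N → certificate {env = p ∷ M ∷ N ∷ []} 2≤K (p>0 ∷ M>0 ∷ N>0 ∷ []) 99399 ((47 , fact (((` # 1 ^′ 15) · (` # 0 ^′ 221))) (((` # 2 ^′ 20) · ((` # 0 · ` # 3) ^′ 21))) (size)) ∷ (41 , fact ((` # 3 ^′ 47)) ((` # 1 ^′ 15)) (D)) ∷ (940 , fact (` # 2) (` # 3) (<⇒≤ M<N)) ∷ (90 , fact ((` # 0 ^′ 1000)) (` # 1) (p-large)) ∷ []) refl

    K⁶≤M : K ^ 6 ≤ M
    K⁶≤M = ≤-trans K⁶≤N N≤M

    -- Up to powers of K, Q is M, and R₀, h, H are N; below, R₁ is M/N and X is p/M². Their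
    -- different constants provide the room for progressions, shifts and products.
    Q R₀ h H : ℕ
    Q = M / K
    R₀ = N / K
    h = R₀ + R₀
    H = R₀ / K

    K≤K⁶ : K ≤ K ^ 6
    K≤K⁶ = m≤m*n K (K ^ 5) {{>-nonZero (m^n>0 K 5)}}

    Q-floor : M ≤ K * (K * Q)
    Q-floor = floor-lower M K (≤-trans K≤K⁶ K⁶≤M)
    R₀-floor : N ≤ K * (K * R₀)
    R₀-floor = floor-lower N K (≤-trans K≤K⁶ K⁶≤N)
    Q>0 : 0 < Q
    Q>0 = m≥n⇒m/n>0 (≤-trans K≤K⁶ K⁶≤M)
    R₀>0 : 0 < R₀
    R₀>0 = m≥n⇒m/n>0 (≤-trans K≤K⁶ K⁶≤N)
    K≤R₀ : K ≤ R₀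
    K≤R₀ = ≮⇒≥ λ lt → certificate {env = p ∷ M ∷ N ∷ R₀ ∷ []} 2≤K (p>0 ∷ M>0 ∷ N>0 ∷ R₀>0 ∷ []) 2 ((1 , fact (` # 3) ((` # 0 · (` # 0 · ` # 4))) (R₀-floor)) ∷ (1 , fact ((` # 0 ^′ 6)) (` # 3) (K⁶≤N)) ∷ (1 , fact (` # 4) (` # 0) (<⇒≤ lt)) ∷ []) refl
    H>0 : 0 < H
    H>0 = m≥n⇒m/n>0 K≤R₀
    H-floor : R₀ ≤ K * (K * H)
    H-floor = floor-lower R₀ K K≤R₀
    HK≤R₀ : H * K ≤ R₀
    HK≤R₀ = m/n*n≤m R₀ K
    R₀K≤N : R₀ * K ≤ N
    R₀K≤N = m/n*n≤m N K
    R₀≤Q : R₀ ≤ Q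
    R₀≤Q = /-monoˡ-≤ K N≤M
    H≤Q : H ≤ Q
    H≤Q = ≤-trans (m/n≤m R₀ K) R₀≤Q
    h>0 : 0 < h
    h>0 = ≤-trans R₀>0 (m≤m+n R₀ R₀)

    instance
      H-nonZero : NonZero H
      H-nonZero = >-nonZero H>0
      Q²-nonZero : NonZero (Q * Q)
      Q²-nonZero = >-nonZero (*-mono-≤ Q>0 Q>0)

    R₁ X : ℕ
    R₁ = Q / H
    X = suc (p / (Q * Q))

    2h<N : h + h < N
    2h<N = <-≤-trans (≤-<-trans (≤-reflexive (four R₀)) (m<m+n (4 * R₀) R₀>0)) (≤-trans (≤-reflexive (five R₀)) (≤-trans (*-monoʳ-≤ R₀ (below-K 5 refl)) R₀K≤N))
      where
      four : ∀ r → r + r + (r + r) ≡ 4 * r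
      four = solve-∀
      five : ∀ r → 4 * r + r ≡ r * 5
      five = solve-∀
    Q-small : 22 * ((3 + 13 * L) * Q) ≤ M
    Q-small = ≤-trans (≤-reflexive (sym (*-assoc 22 (3 + 13 * L) Q))) (≤-trans (*-monoˡ-≤ Q 22[3+13L]≤K) (≤-trans (≤-reflexive (*-comm K Q)) (m/n*n≤m M K)))
    R₀-fits : suc R₀ + 13 * L ≤ h
    R₀-fits = ≤-trans (≤-reflexive (sym (+-suc R₀ (13 * L)))) (+-monoʳ-≤ R₀ (≤-trans suc[13L]≤K K≤R₀))
    H-fits : H * (13 * L) ≤ h
    H-fits = ≤-trans (*-monoʳ-≤ H (≤-trans (n≤1+n _) suc[13L]≤K)) (≤-trans HK≤R₀ (m≤m+n R₀ R₀))
    p-small₀ : 2 * p ≤ M * R₀ ^ 11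
    p-small₀ = ≮⇒≥ λ lt → certificate {env = p ∷ M ∷ N ∷ R₀ ∷ []} 2≤K (p>0 ∷ M>0 ∷ N>0 ∷ R₀>0 ∷ []) 345378 ((119 , fact (((` # 1 ^′ 15) · (` # 0 ^′ 221))) (((` # 2 ^′ 20) · ((` # 0 · ` # 3) ^′ 21))) (size)) ∷ (199 , fact ((` # 1 ^′ 5)) (((` # 0 · ` # 3) ^′ 119)) (N-large)) ∷ (400 , fact ((` # 0 ^′ 1000)) (` # 1) (p-large)) ∷ (26180 , fact (` # 3) ((` # 0 · (` # 0 · ` # 4))) (R₀-floor)) ∷ (2380 , fact ((` # 2 · (` # 4 ^′ 11))) ((` # 0 · ` # 1)) (≤-trans (<⇒≤ lt) (*-monoˡ-≤ p 2≤K))) ∷ []) refl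

    module Hard (Q²<p : Q * Q < p) where
      R₁-floor : Q ≤ K * (H * R₁)
      R₁-floor = floor-lower Q H H≤Q
      R₁>0 : 0 < R₁
      R₁>0 = m≥n⇒m/n>0 H≤Q
      R₁H≤Q : R₁ * H ≤ Q
      R₁H≤Q = m/n*n≤m Q H
      p<XQ² : p < X * (Q * Q)
      p<XQ² = floor-upper p (Q * Q)
      XQ²≤ : X * (Q * Q) ≤ K * p
      XQ²≤ = ≤-trans (+-mono-≤ (<⇒≤ Q²<p) (m/n*n≤m p (Q * Q))) (≤-trans (≤-reflexive (cong (p +_) (sym (+-identityʳ p)))) (*-monoˡ-≤ p 2≤K))
      Q²≤p : Q * Q ≤ p
      Q²≤p = <⇒≤ Q²<p
      X>0 : 0 < X
      X>0 = s≤s z≤n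
      R₀≤h : R₀ ≤ h
      R₀≤h = m≤m+n R₀ R₀

      -- Up to constants M (M/N)^11 ≥ p, which bounds N from above; this is one use of `D`.
      p-small₁ : 2 * p ≤ M * R₁ ^ 11
      p-small₁ = ≮⇒≥ λ lt → certificate {env = p ∷ M ∷ N ∷ Q ∷ R₀ ∷ h ∷ H ∷ R₁ ∷ X ∷ []} 2≤K (p>0 ∷ M>0 ∷ N>0 ∷ Q>0 ∷ R₀>0 ∷ h>0 ∷ H>0 ∷ R₁>0 ∷ X>0 ∷ []) 135379 ((141 , fact (((` # 1 ^′ 15) · (` # 0 ^′ 221))) (((` # 2 ^′ 20) · ((` # 0 · ` # 3) ^′ 21))) (size)) ∷ (118 , fact ((` # 3 ^′ 47)) ((` # 1 ^′ 15)) (D)) ∷ (110 , fact ((` # 0 ^′ 1000)) (` # 1) (p-large)) ∷ (2585 , fact (` # 2) ((` # 0 · (` # 0 · ` # 4))) (Q-floor)) ∷ (2585 , fact (` # 4) ((` # 0 · (` # 7 · ` # 8))) (R₁-floor)) ∷ (2585 , fact ((` # 7 · ` # 0)) (` # 5) (HK≤R₀)) ∷ (2585 , fact ((` # 5 · ` # 0)) (` # 3) (R₀K≤N)) ∷ (235 , fact ((` # 2 · (` # 8 ^′ 11))) ((` # 0 · ` # 1)) (≤-trans (<⇒≤ lt) (*-monoˡ-≤ p 2≤K))) ∷ []) refl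

      2[1+X]≤H : 2 * suc X ≤ H
      2[1+X]≤H = ≮⇒≥ λ lt → let H≤KX = ≤-trans (<⇒≤ lt) (≤-trans (*-monoʳ-≤ 2 (+-monoˡ-≤ X X>0)) (≤-trans (≤-reflexive (four X)) (*-monoˡ-≤ X (below-K 4 refl)))) in
        certificate {env = p ∷ M ∷ N ∷ Q ∷ R₀ ∷ h ∷ H ∷ R₁ ∷ X ∷ []} 2≤K (p>0 ∷ M>0 ∷ N>0 ∷ Q>0 ∷ R₀>0 ∷ h>0 ∷ H>0 ∷ R₁>0 ∷ X>0 ∷ []) 74699 ((47 , fact (((` # 1 ^′ 15) · (` # 0 ^′ 221))) (((` # 2 ^′ 20) · ((` # 0 · ` # 3) ^′ 21))) (size)) ∷ (11 , fact ((` # 3 ^′ 47)) ((` # 1 ^′ 15)) (D)) ∷ (70 , fact ((` # 0 ^′ 1000)) (` # 1) (p-large)) ∷ (940 , fact (` # 2) ((` # 0 · (` # 0 · ` # 4))) (Q-floor)) ∷ (470 , fact (` # 3) ((` # 0 · (` # 0 · ` # 5))) (R₀-floor)) ∷ (470 , fact (` # 5) ((` # 0 · (` # 0 · ` # 7))) (H-floor)) ∷ (470 , fact ((` # 9 · (` # 4 · ` # 4))) ((` # 0 · ` # 1)) (XQ²≤)) ∷ (470 , fact (` # 7) ((` # 0 · ` # 9)) (H≤KX)) ∷ []) refl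
        where
        four : ∀ x → 2 * (x + x) ≡ 4 * x
        four = solve-∀

      -- Up to constants N^5 M² ≥ p². Since M² is below p up to constants, `size` forces N to be at
      -- least about p^(5/21), which is more than enough.
      cube : 48 * (p * p) ≤ H * H * H * (h * Q * (h * Q))
      cube = ≮⇒≥ λ lt → certificate {env = p ∷ M ∷ N ∷ Q ∷ R₀ ∷ h ∷ H ∷ R₁ ∷ X ∷ []} 2≤K (p>0 ∷ M>0 ∷ N>0 ∷ Q>0 ∷ R₀>0 ∷ h>0 ∷ H>0 ∷ R₁>0 ∷ X>0 ∷ []) 4442 ((5 , fact (((` # 1 ^′ 15) · (` # 0 ^′ 221))) (((` # 2 ^′ 20) · ((` # 0 · ` # 3) ^′ 21))) (size)) ∷ (4 , fact ((` # 0 ^′ 1000)) (` # 1) (p-large)) ∷ (100 , fact (` # 2) ((` # 0 · (` # 0 · ` # 4))) (Q-floor)) ∷ (105 , fact (` # 3) ((` # 0 · (` # 0 · ` # 5))) (R₀-floor)) ∷ (63 , fact (` # 5) ((` # 0 · (` # 0 · ` # 7))) (H-floor)) ∷ (42 , fact (` # 5) (` # 6) (R₀≤h)) ∷ (29 , fact ((` # 4 · ` # 4)) (` # 1) (Q²≤p)) ∷ (21 , fact ((((` # 7 · ` # 7) · ` # 7) · ((` # 6 · ` # 4) · (` # 6 · ` # 4)))) ((` # 0 · (` # 1 · ` # 1))) (≤-trans (<⇒≤ lt) (*-monoˡ-≤ (p * p) (below-K 48 refl)))) ∷ []) refl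

      -- Up to constants p² ≤ M⁴ N. The premise, N² M below p up to constants, is what H < 2d leaves
      -- in the case of large d.
      square : H * (h * Q) < 2 * p → X * X ≤ H
      square lt′ = ≮⇒≥ λ lt → certificate {env = p ∷ M ∷ N ∷ Q ∷ R₀ ∷ h ∷ H ∷ R₁ ∷ X ∷ []} 2≤K (p>0 ∷ M>0 ∷ N>0 ∷ Q>0 ∷ R₀>0 ∷ h>0 ∷ H>0 ∷ R₁>0 ∷ X>0 ∷ []) 1319 ((11 , fact (((` # 1 ^′ 15) · (` # 0 ^′ 221))) (((` # 2 ^′ 20) · ((` # 0 · ` # 3) ^′ 21))) (size)) ∷ (3 , fact ((` # 3 ^′ 47)) ((` # 1 ^′ 15)) (D)) ∷ (220 , fact (` # 2) ((` # 0 · (` # 0 · ` # 4))) (Q-floor)) ∷ (90 , fact (` # 3) ((` # 0 · (` # 0 · ` # 5))) (R₀-floor)) ∷ (70 , fact (` # 5) ((` # 0 · (` # 0 · ` # 7))) (H-floor)) ∷ (20 , fact (` # 5) (` # 6) (R₀≤h)) ∷ (100 , fact ((` # 9 · (` # 4 · ` # 4))) ((` # 0 · ` # 1)) (XQ²≤)) ∷ (50 , fact (` # 7) ((` # 9 · ` # 9)) (<⇒≤ lt)) ∷ (20 , fact ((` # 7 · (` # 6 · ` # 4))) ((` # 0 · ` # 1)) (≤-trans (<⇒≤ lt′) (*-monoˡ-≤ p 2≤K))) ∷ []) refl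

    hard : Q * Q < p → R₁ * H ≤ Q × 2 * p ≤ M * R₁ ^ 11 × p < X * (Q * Q) × 2 * suc X ≤ H ×
           48 * (p * p) ≤ H * H * H * (h * Q * (h * Q)) × (H * (h * Q) < 2 * p → X * X ≤ H)
    hard Q²<p = R₁H≤Q , p-small₁ , p<XQ² , 2[1+X]≤H , cube , square
      where open Hard Q²<p

    represented : (p-prime : Prime p) → ∀ A a → Intervals.ZeroFree p p-prime a N → ∀ x → Representations.Represented p p-prime A M a N 12 x
    represented p-prime A = DirectCases.direct-range p p-prime A L L>0 L-multiple M N h Q R₀ R₁ H X M≤p N≤p 2h<N Q>0 Q-small R₀≤Q R₀-fits p-small₀ H-fits hard

  -- s is the length of J actually used: N while N² ≤ p, and ⌊√p⌋ beyond, where the ratios already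
  -- fill a positive proportion of F_p.
  module MediumDenominators (s : ℕ) (s≤N : s ≤ N) (s²≤p : s * s ≤ p) (K³≤s : K ^ 3 ≤ s)
                (enough : K ^ 79 * p ^ 12 ≤ M ^ 12 * s ^ 22) where
    K≤K³ : K ≤ K ^ 3
    K≤K³ = m≤m*n K (K ^ 2) {{>-nonZero (m^n>0 K 2)}}
    s>0 : 0 < s
    s>0 = <-≤-trans (m^n>0 K 3) K³≤s
    U X₀ : ℕ
    U = s / K
    X₀ = U * U / K
    UK≤s : U * K ≤ s
    UK≤s = m/n*n≤m s K
    U>0 : 0 < U
    U>0 = m≥n⇒m/n>0 (≤-trans K≤K³ K³≤s)
    U-floor : s ≤ K * (K * U)
    U-floor = floor-lower s K (≤-trans K≤K³ K³≤s)
    K≤U² : K ≤ U * U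
    K≤U² = ≮⇒≥ λ lt → certificate {env = s ∷ U ∷ []} 2≤K (s>0 ∷ U>0 ∷ []) 0 ((2 , fact (` # 1) ((` # 0 · (` # 0 · ` # 2))) (U-floor)) ∷ (2 , fact ((` # 0 ^′ 3)) (` # 1) (K³≤s)) ∷ (1 , fact ((` # 2 · ` # 2)) (` # 0) (<⇒≤ lt)) ∷ []) refl
    X₀-floor : U * U ≤ K * (K * X₀)
    X₀-floor = floor-lower (U * U) K K≤U²
    X₀>0 : 0 < X₀
    X₀>0 = m≥n⇒m/n>0 K≤U²
    fit : U + 12 * U ≤ N
    fit = ≤-trans (≤-trans (≤-reflexive (*-comm 13 U)) (*-monoʳ-≤ U (below-K 13 refl))) (≤-trans UK≤s s≤N)
    2U²≤p : 2 * (U * U) ≤ p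
    2U²≤p = ≤-trans (≤-reflexive (exchange U)) (≤-trans (*-mono-≤ (≤-trans (*-monoʳ-≤ U 2≤K) UK≤s) (m/n≤m s K)) s²≤p)
      where
      exchange : ∀ u → 2 * (u * u) ≡ u * 2 * u
      exchange = solve-∀
    21X₀≤U² : 21 * X₀ ≤ U * U
    21X₀≤U² = ≤-trans (*-monoˡ-≤ X₀ (below-K 21 refl)) (≤-trans (≤-reflexive (*-comm K X₀)) (m/n*n≤m (U * U) K))
    -- The exponent 79 in `enough` is spent here: 12 for 600 ≤ K, 44 and 22 for the floors U and X₀,
    -- and 1 for strictness.
    big : (2 * (300 * p)) ^ 12 < M ^ 12 * X₀ ^ 11
    big = ≰⇒> λ le → certificate {env = p ∷ M ∷ s ∷ U ∷ X₀ ∷ []} 2≤K (p>0 ∷ M>0 ∷ s>0 ∷ U>0 ∷ X₀>0 ∷ []) 0 ((1 , fact (((` # 0 ^′ 79) · (` # 1 ^′ 12))) (((` # 2 ^′ 12) · (` # 3 ^′ 22))) (enough)) ∷ (22 , fact (` # 3) ((` # 0 · (` # 0 · ` # 4))) (U-floor)) ∷ (11 , fact ((` # 4 · ` # 4)) ((` # 0 · (` # 0 · ` # 5))) (X₀-floor)) ∷ (1 , fact (((` # 2 ^′ 12) · (` # 5 ^′ 11))) (((` # 0 · ` # 1) ^′ 12)) (≤-trans le (^-monoˡ-≤ 12 (≤-trans (≤-reflexive (sym (*-assoc 2 300 p))) (*-monoˡ-≤ p (below-K 600 refl)))))) ∷ []) refl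

    represented : (p-prime : Prime p) → ∀ A a → Intervals.ZeroFree p p-prime a N → ∀ x → Representations.Represented p p-prime A M a N 12 x
    represented p-prime A a zf = Middle.middle-range p p-prime A M a N U U X₀ zf M≤p U>0 ≤-refl fit 2U²≤p 21X₀≤U² big

  module LongDenominators (M-small : M ^ 12 ≤ K ^ 91 * p) where
    n : ℕ
    n = N / K
    K≤N : K ≤ N
    K≤N = ≤-trans (m≤m*n K (K ^ 5) {{>-nonZero (m^n>0 K 5)}}) K⁶≤N
    n-floor : N ≤ K * (K * n)
    n-floor = floor-lower N K K≤N
    n>0 : 0 < n
    n>0 = m≥n⇒m/n>0 K≤N
    nK≤N : n * K ≤ N
    nK≤N = m/n*n≤m N K

    module WithRoot (V : ℕ) (V>0 : 0 < V) (p≤V⁴ : p ≤ V ^ 4) (V⁴≤ : V ^ 4 ≤ K * p) where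
      instance
        KN-nonZero : NonZero (K * N)
        KN-nonZero = >-nonZero (*-mono-≤ K>0 N>0)
        KV-nonZero : NonZero (K * V)
        KV-nonZero = >-nonZero (*-mono-≤ K>0 V>0)
      U₁ U₂ X₀ : ℕ
      -- With this U₁ the product `U₁ * n` is a positive proportion of p. U₂ is the largest step for
      -- which 4V of them fit, up to constants.
      U₁ = suc (p / (K * N))
      U₂ = N / (K * V)
      X₀ = U₁ * n / K
      U₁>0 : 0 < U₁
      U₁>0 = s≤s z≤n
      U₁-lower : p ≤ U₁ * (K * N)
      U₁-lower = <⇒≤ (floor-upper p (K * N))
      U₁-upper : U₁ * (K * N) ≤ K * (K * p)
      U₁-upper = begin
        K * N + p / (K * N) * (K * N)     ≤⟨ +-mono-≤ (*-monoʳ-≤ K N≤p) (m/n*n≤m p (K * N)) ⟩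
        K * p + p                         ≤⟨ +-monoʳ-≤ (K * p) (m≤n*m p K) ⟩
        K * p + K * p                     ≡⟨ cong (K * p +_) (sym (+-identityʳ (K * p))) ⟩
        2 * (K * p)                       ≤⟨ *-monoˡ-≤ (K * p) 2≤K ⟩
        K * (K * p) ∎
        where open ≤-Reasoning
      VU₁K≤N : V * U₁ * K ≤ N
      VU₁K≤N = ≮⇒≥ λ lt → certificate {env = p ∷ M ∷ N ∷ V ∷ n ∷ U₁ ∷ []} 2≤K (p>0 ∷ M>0 ∷ N>0 ∷ V>0 ∷ n>0 ∷ U₁>0 ∷ []) 5592 ((24 , fact (((` # 1 ^′ 15) · (` # 0 ^′ 221))) (((` # 2 ^′ 20) · ((` # 0 · ` # 3) ^′ 21))) (size)) ∷ (40 , fact ((` # 2 ^′ 12)) (((` # 0 ^′ 91) · ` # 1)) (M-small)) ∷ (63 , fact ((` # 4 ^′ 4)) ((` # 0 · ` # 1)) (V⁴≤)) ∷ (252 , fact ((` # 6 · (` # 0 · ` # 3))) ((` # 0 · (` # 0 · ` # 1))) (U₁-upper)) ∷ (252 , fact (` # 3) (((` # 4 · ` # 6) · ` # 0)) (<⇒≤ lt)) ∷ (5 , fact ((` # 0 ^′ 1000)) (` # 1) (p-large)) ∷ []) refl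
      U₁≤n : U₁ ≤ n
      U₁≤n = ≮⇒≥ λ lt → certificate {env = p ∷ M ∷ N ∷ V ∷ n ∷ U₁ ∷ []} 2≤K (p>0 ∷ M>0 ∷ N>0 ∷ V>0 ∷ n>0 ∷ U₁>0 ∷ []) 17100 ((6 , fact (((` # 1 ^′ 15) · (` # 0 ^′ 221))) (((` # 2 ^′ 20) · ((` # 0 · ` # 3) ^′ 21))) (size)) ∷ (10 , fact ((` # 2 ^′ 12)) (((` # 0 ^′ 91) · ` # 1)) (M-small)) ∷ (63 , fact (` # 3) ((` # 0 · (` # 0 · ` # 5))) (n-floor)) ∷ (63 , fact ((` # 6 · (` # 0 · ` # 3))) ((` # 0 · (` # 0 · ` # 1))) (U₁-upper)) ∷ (63 , fact (` # 5) (` # 6) (<⇒≤ lt)) ∷ (17 , fact ((` # 0 ^′ 1000)) (` # 1) (p-large)) ∷ []) refl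
      KV≤N : K * V ≤ N
      KV≤N = ≮⇒≥ λ lt → certificate {env = p ∷ M ∷ N ∷ V ∷ n ∷ U₁ ∷ []} 2≤K (p>0 ∷ M>0 ∷ N>0 ∷ V>0 ∷ n>0 ∷ U₁>0 ∷ []) 97264 ((12 , fact (((` # 1 ^′ 15) · (` # 0 ^′ 221))) (((` # 2 ^′ 20) · ((` # 0 · ` # 3) ^′ 21))) (size)) ∷ (20 , fact ((` # 2 ^′ 12)) (((` # 0 ^′ 91) · ` # 1)) (M-small)) ∷ (63 , fact ((` # 4 ^′ 4)) ((` # 0 · ` # 1)) (V⁴≤)) ∷ (252 , fact (` # 3) ((` # 0 · ` # 4)) (<⇒≤ lt)) ∷ (97 , fact ((` # 0 ^′ 1000)) (` # 1) (p-large)) ∷ []) refl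
      U₂-floor : N ≤ K * (K * V * U₂)
      U₂-floor = floor-lower N (K * V) KV≤N
      U₂>0 : 0 < U₂
      U₂>0 = m≥n⇒m/n>0 KV≤N
      K≤U₁n : K ≤ U₁ * n
      K≤U₁n = ≤-trans (≮⇒≥ λ lt → certificate {env = p ∷ M ∷ N ∷ V ∷ n ∷ U₁ ∷ []} 2≤K (p>0 ∷ M>0 ∷ N>0 ∷ V>0 ∷ n>0 ∷ U₁>0 ∷ []) 2 ((1 , fact ((` # 0 ^′ 6)) (` # 3) (K⁶≤N)) ∷ (1 , fact (` # 3) ((` # 0 · (` # 0 · ` # 5))) (n-floor)) ∷ (1 , fact (` # 5) (` # 0) (<⇒≤ lt)) ∷ []) refl) (m≤n*m n U₁)
      X₀-floor : U₁ * n ≤ K * (K * X₀)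
      X₀-floor = floor-lower (U₁ * n) K K≤U₁n
      X₀>0 : 0 < X₀
      X₀>0 = m≥n⇒m/n>0 K≤U₁n

      fits : ∀ U → V * U * K ≤ N → n + 4 * V * U ≤ N
      fits U VUK≤N = *-cancelʳ-≤ (n + 4 * V * U) N K (begin
        (n + 4 * V * U) * K               ≡⟨ expand n V U K ⟩
        n * K + 4 * (V * U * K)           ≤⟨ +-mono-≤ nK≤N (*-monoʳ-≤ 4 VUK≤N) ⟩
        N + 4 * N                         ≡⟨ *-comm 5 N ⟩
        N * 5                             ≤⟨ *-monoʳ-≤ N (below-K 5 refl) ⟩
        N * K ∎)
        where
        open ≤-Reasoning
        expand : ∀ n V U K → (n + 4 * V * U) * K ≡ n * K + 4 * (V * U * K)
        expand = solve-∀
      fit₂ : V * U₂ * K ≤ N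
      fit₂ = ≤-trans (≤-reflexive (rotate V U₂ K)) (m/n*n≤m N (K * V))
        where
        rotate : ∀ V U K → V * U * K ≡ U * (K * V)
        rotate = solve-∀
      4V≤p : 4 * V ≤ p
      4V≤p = ≤-trans (*-monoˡ-≤ V (below-K 4 refl)) (≤-trans KV≤N N≤p)
      2U₁n≤p : 2 * (U₁ * n) ≤ p
      2U₁n≤p = *-cancelʳ-≤ (2 * (U₁ * n)) p K (begin
        2 * (U₁ * n) * K                  ≡⟨ regroup U₁ n K ⟩
        2 * (U₁ * (n * K))                ≤⟨ *-monoʳ-≤ 2 (*-monoʳ-≤ U₁ nK≤N) ⟩
        2 * (N + w * N)                   ≡⟨ *-distribˡ-+ 2 N (w * N) ⟩
        2 * N + 2 * (w * N)               ≤⟨ +-mono-≤ (*-monoʳ-≤ 2 N≤p) (*-monoˡ-≤ (w * N) 2≤K) ⟩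
        2 * p + K * (w * N)               ≡⟨ cong (2 * p +_) (exchange K w N) ⟩
        2 * p + w * (K * N)               ≤⟨ +-monoʳ-≤ (2 * p) (m/n*n≤m p (K * N)) ⟩
        2 * p + p                         ≡⟨ triple p ⟩
        p * 3                             ≤⟨ *-monoʳ-≤ p (below-K 3 refl) ⟩
        p * K ∎)
        where
        open ≤-Reasoning
        w = p / (K * N)
        regroup : ∀ u n k → 2 * (u * n) * k ≡ 2 * (u * (n * k))
        regroup = solve-∀
        exchange : ∀ k w n → k * (w * n) ≡ w * (k * n)
        exchange = solve-∀
        triple : ∀ p → 2 * p + p ≡ p * 3
        triple = solve-∀
      21X₀≤ : 21 * X₀ ≤ U₁ * n
      21X₀≤ = ≤-trans (*-monoˡ-≤ X₀ (below-K 21 refl)) (≤-trans (≤-reflexive (*-comm K X₀)) (m/n*n≤m (U₁ * n) K))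
      n<p : n < p
      n<p = <-≤-trans (m/n<m N K {{>-nonZero N>0}} {{K-nonZero}} 2≤K) N≤p
      U₂<p : U₂ < p
      U₂<p = <-≤-trans (m/n<m N (K * V) {{>-nonZero N>0}} (≤-trans 2≤K (m≤m*n K V {{>-nonZero V>0}}))) N≤p
      -- Up to constants X₀ is p and `U₂ * n` is N²/p^(1/4), so N > p^(5/8) is required; `size` and
      -- M^12 ≤ p give N ≥ p^(40/63).
      big : 17 * (17 * (17 * (p * p * p))) < X₀ * X₀ * (U₂ * n)
      big = ≰⇒> λ le → let bound = ≤-trans le (≤-trans (≤-reflexive (cubes (p * p * p))) (*-monoˡ-≤ (p * p * p) 4913≤K)) in
        certificate {env = p ∷ M ∷ N ∷ V ∷ n ∷ U₁ ∷ U₂ ∷ X₀ ∷ []} 2≤K (p>0 ∷ M>0 ∷ N>0 ∷ V>0 ∷ n>0 ∷ U₁>0 ∷ U₂>0 ∷ X₀>0 ∷ []) 2316 ((24 , fact (((` # 1 ^′ 15) · (` # 0 ^′ 221))) (((` # 2 ^′ 20) · ((` # 0 · ` # 3) ^′ 21))) (size)) ∷ (40 , fact ((` # 2 ^′ 12)) (((` # 0 ^′ 91) · ` # 1)) (M-small)) ∷ (63 , fact ((` # 4 ^′ 4)) ((` # 0 · ` # 1)) (V⁴≤)) ∷ (756 , fact (` # 3) ((` # 0 · (` # 0 · ` # 5))) (n-floor)) ∷ (504 , fact (` # 1) ((` # 6 · (` # 0 · ` # 3))) (U₁-lower)) ∷ (252 , fact (` # 3) ((` # 0 · ((` # 0 ·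 ` # 4) · ` # 7))) (U₂-floor)) ∷ (504 , fact ((` # 6 · ` # 5)) ((` # 0 · (` # 0 · ` # 8))) (X₀-floor)) ∷ (252 , fact (((` # 8 · ` # 8) · (` # 7 · ` # 5))) ((` # 0 · ((` # 1 · ` # 1) · ` # 1))) (bound)) ∷ (5 , fact ((` # 0 ^′ 1000)) (` # 1) (p-large)) ∷ []) refl
        where
        cubes : ∀ c → 17 * (17 * (17 * c)) ≡ 4913 * c
        cubes c = trans (cong (17 *_) (sym (*-assoc 17 17 c))) (sym (*-assoc 17 289 c))

      reciprocals : (p-prime : Prime p) → ∀ a → Intervals.ZeroFree p p-prime a N → ∀ x → Large.Reciprocals p p-prime a N 12 x
      reciprocals p-prime a zf = Large.large-range p p-prime a N V n U₁ n U₂ X₀ zf 4V≤p p≤V⁴ U₁>0 U₁≤n (fits U₁ VU₁K≤N) 2U₁n≤p 21X₀≤ n<p U₂<p (fits U₂ fit₂) big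

  isqrt : p < N * N → ∃ λ s → s ≤ N × s * s ≤ p × p ≤ K * (s * s) × 0 < s
  isqrt p<N² = from (floor-search (λ s → s * s) p N z≤n p<N²)
    where
    from : (∃ λ s → s * s ≤ p × p < suc s * suc s) → ∃ λ s → s ≤ N × s * s ≤ p × p ≤ K * (s * s) × 0 < s
    from (zero  , _   , p<1) = contradiction (<-≤-trans p<1 p>0) (<-irrefl refl)
    from (suc s , s²≤ , p<)  = suc s , ≮⇒≥ (λ N<s → <⇒≱ (<-trans p<N² (*-mono-< N<s N<s)) s²≤) , s²≤ ,
      ≤-trans (<⇒≤ p<) (≤-trans (*-mono-≤ double double) (≤-trans (≤-reflexive (four (suc s))) (*-monoˡ-≤ (suc s * suc s) (below-K 4 refl)))) , s≤s z≤n
      where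
      double : suc (suc s) ≤ 2 * suc s
      double = s≤s (≤-trans (≤-reflexive (+-comm 1 s)) (+-monoʳ-≤ s (s≤s z≤n)))
      four : ∀ t → 2 * t * (2 * t) ≡ 4 * (t * t)
      four = solve-∀

  module Result (p-prime : Prime p) (A a : ℕ) (zf : Intervals.ZeroFree p p-prime a N) (k : ℕ) (k<M : k < M) where
    open PrimeField p p-prime
    open Representations p p-prime A

    constant-numerator : ∀ {n} (v : Vec ℕ n) → VAll.All (_< N) v → Σ (Vec (ℕ × ℕ) n) λ w → VAll.All (λ (k , j) → k < M × j < N) w × quotSum a w ≡ ι (A + k) ⊗ Large.recipSum p p-prime a v
    constant-numerator []      []         = [] , [] , sym (⊗-zeroʳ _)
    constant-numerator (j ∷ v) (j< ∷ bv) = prepend (constant-numerator v bv)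
      where
      prepend : (Σ (Vec (ℕ × ℕ) _) λ w → VAll.All (λ (k , j) → k < M × j < N) w × quotSum a w ≡ ι (A + k) ⊗ Large.recipSum p p-prime a v) → _
      prepend (w , bw , ew) = (k , j) ∷ w , (k<M , j<) ∷ bw , trans (cong (ι (A + k) ⊗ inv (ι (a + j)) ⊕_) ew) (sym (⊗-distribˡ-⊕ _ _ _))

    represented : ι (A + k) ≢ 0F → ∀ x → Represented M a N 12 x
    represented A+k≢0 x = short (N ^ 47 ≤? p ^ 15)
      where
      long : M ^ 12 ≤ K ^ 91 * p → CeilRoot 4 p → Represented M a N 12 x
      long M-small (ceilRoot V V>0 p≤V⁴ V⁴≤) = scale (LongDenominators.WithRoot.reciprocals M-small V V>0 p≤V⁴ (≤-trans V⁴≤ (*-monoˡ-≤ p (below-K 16 refl))) p-prime a zf (inv (ι (A + k)) ⊗ x))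
        where
        scale : Large.Reciprocals p p-prime a N 12 (inv (ι (A + k)) ⊗ x) → Represented M a N 12 x
        scale (v , bv , ev) = rescale (constant-numerator v bv)
          where
          rescale : (Σ (Vec (ℕ × ℕ) 12) λ w → VAll.All (λ (k , j) → k < M × j < N) w × quotSum a w ≡ ι (A + k) ⊗ Large.recipSum p p-prime a v) → Represented M a N 12 x
          rescale (w , bw , ew) = w , bw , trans ew (trans (cong (ι (A + k) ⊗_) ev) (trans (sym (⊗-assoc _ _ _)) (trans (cong (_⊗ x) (inv-right A+k≢0)) (⊗-identityˡ x))))
      medium : p ^ 15 ≤ N ^ 47 → K ^ 91 * p ≤ M ^ 12 → Dec (N * N ≤ p) → Represented M a N 12 x
      medium D′ M-large (yes N²≤p) = MediumDenominators.represented N ≤-refl N²≤p K³≤N enough p-prime A a zf x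
        where
        K³≤N : K ^ 3 ≤ N
        K³≤N = ≤-trans (^-monoʳ-≤ K {3} {6} (s≤s (s≤s (s≤s z≤n)))) K⁶≤N
        -- The threshold 15/47 is exact here: three copies of `size` and one of `D′` match five
        -- copies of the goal in p, M and N, and only powers of K remain.
        enough : K ^ 79 * p ^ 12 ≤ M ^ 12 * N ^ 22
        enough = ≮⇒≥ λ lt → certificate {env = p ∷ M ∷ N ∷ []} 2≤K (p>0 ∷ M>0 ∷ N>0 ∷ []) 204 ((3 , fact (((` # 1 ^′ 15) · (` # 0 ^′ 221))) (((` # 2 ^′ 20) · ((` # 0 · ` # 3) ^′ 21))) (size)) ∷ (1 , fact ((` # 1 ^′ 15)) ((` # 3 ^′ 47)) (D′)) ∷ (5 , fact (((` # 2 ^′ 12) · (` # 3 ^′ 22))) (((` # 0 ^′ 79) · (` # 1 ^′ 12))) (<⇒≤ lt)) ∷ []) refl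
      medium D′ M-large (no N²>p) = from (isqrt (≰⇒> N²>p))
        where
        from : (∃ λ s → s ≤ N × s * s ≤ p × p ≤ K * (s * s) × 0 < s) → Represented M a N 12 x
        from (s , s≤N , s²≤p , p≤Ks² , s>0) = MediumDenominators.represented s s≤N s²≤p K³≤s enough p-prime A a zf x
          where
          K³≤s : K ^ 3 ≤ s
          K³≤s = ≮⇒≥ λ lt → certificate {env = p ∷ M ∷ N ∷ s ∷ []} 2≤K (p>0 ∷ M>0 ∷ N>0 ∷ s>0 ∷ []) 992 ((1 , fact ((` # 0 ^′ 1000)) (` # 1) (p-large)) ∷ (1 , fact (` # 1) ((` # 0 · (` # 4 · ` # 4))) (p≤Ks²)) ∷ (2 , fact (` # 4) ((` # 0 ^′ 3)) (<⇒≤ lt)) ∷ []) refl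
          -- 91 = 79 + 11 + 1: replacing p^11 by s^22 costs K^11, and strictness one more K.
          enough : K ^ 79 * p ^ 12 ≤ M ^ 12 * s ^ 22
          enough = ≮⇒≥ λ lt → certificate {env = p ∷ M ∷ N ∷ s ∷ []} 2≤K (p>0 ∷ M>0 ∷ N>0 ∷ s>0 ∷ []) 0 ((1 , fact (((` # 0 ^′ 91) · ` # 1)) ((` # 2 ^′ 12)) (M-large)) ∷ (11 , fact (` # 1) ((` # 0 · (` # 4 · ` # 4))) (p≤Ks²)) ∷ (1 , fact (((` # 2 ^′ 12) · (` # 4 ^′ 22))) (((` # 0 ^′ 79) · (` # 1 ^′ 12))) (<⇒≤ lt)) ∷ []) refl
      not-short : p ^ 15 ≤ N ^ 47 → Dec (K ^ 91 * p ≤ M ^ 12) → Represented M a N 12 x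
      not-short D′ (yes M-large) = medium D′ M-large (N * N ≤? p)
      not-short D′ (no M<)       = long (<⇒≤ (≰⇒> M<)) (ceil-root 3 p p>0)
      short : Dec (N ^ 47 ≤ p ^ 15) → Represented M a N 12 x
      short (yes D) = ShortDenominators.represented D p-prime A a zf x
      short (no D′) = not-short (<⇒≤ (≰⇒> D′)) (K ^ 91 * p ≤? M ^ 12)

-- Removing zero from the intervals, and return to residues.

module Conclusion (p : ℕ) (p-prime : Prime p) where
  open PrimeField p p-prime
  open Intervals p p-prime

  -- If 0 occurs among the first n elements, the n elements following it are 1,...,n, all nonzero as
  -- n < p. The choice n = (N-1)/2 leaves room for 0 itself between the two halves.
  zero-free-half : ∀ a N → 0 < N → N ≤ p → ∃ λ o → o + (N ∸ 1) / 2 ≤ N × ZeroFree (a + o) ((N ∸ 1) / 2)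
  zero-free-half a N N>0 N≤p = by (anyUpTo? (λ j → ι (a + j) ≟F 0F) n)
    where
    n = (N ∸ 1) / 2
    2n<N : n + n < N
    2n<N = ≤-<-trans (≤-trans (≤-reflexive (double n)) (m/n*n≤m (N ∸ 1) 2)) (≤-reflexive (m+[n∸m]≡n N>0))
      where
      double : ∀ n → n + n ≡ n * 2
      double = solve-∀
    n<N : n < N
    n<N = ≤-<-trans (m≤m+n n n) 2n<N
    by : Dec (∃ λ j → j < n × ι (a + j) ≡ 0F) → ∃ λ o → o + n ≤ N × ZeroFree (a + o) n
    by (no none) = 0 , <⇒≤ n<N , λ j j<n e → none (j , j<n , trans (cong (λ z → ι (z + j)) (sym (+-identityʳ a))) e)
    by (yes (z , z<n , zero-at)) = suc z , ≤-trans (+-monoˡ-≤ n z<n) (<⇒≤ 2n<N) , λ j j<n e →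
      ι≢0 {suc j} (s≤s z≤n) (<-≤-trans (≤-<-trans j<n n<N) N≤p) (begin
        ι (suc j)                     ≡⟨ sym (⊕-identityˡ _) ⟩
        0F ⊕ ι (suc j)                ≡⟨ cong (_⊕ ι (suc j)) (sym zero-at) ⟩
        ι (a + z) ⊕ ι (suc j)         ≡⟨ sym (ι-+ (a + z) (suc j)) ⟩
        ι (a + z + suc j)             ≡⟨ cong ι (shift a z j) ⟩
        ι (a + suc z + j)             ≡⟨ e ⟩
        0F ∎)
      where
      open ≡-Reasoning
      shift : ∀ a z j → a + z + suc j ≡ a + suc z + j
      shift = solve-∀

  nonzero-numerator : ∀ a N → IsNonzeroInterval p a N → ∃ λ k → k < N × ι (a + k) ≢ 0F
  nonzero-numerator zero    N (_   , N≥1 , _ , ≢0) = 1 , ≤∧≢⇒< N≥1 (λ e → ≢0 (refl , sym e)) , 1≢0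
  nonzero-numerator (suc a) N (a<p , N≥1 , _ , _)  = 0 , N≥1 , ι≢0 (s≤s z≤n) (subst (_< p) (sym (+-identityʳ (suc a))) a<p)

  module _ (A M a o n N : ℕ) (o+n≤N : o + n ≤ N) (zf : ZeroFree (a + o) n) (lam : ℕ) (lam<p : lam < p) where
    open Representations p p-prime A

    ι-% : ∀ m → ι (m % p) ≡ ι m
    ι-% m = ι-≡ (m%n%n≡m%n m p)

    sum-quotSum : ∀ {n} (f : Fin n → ℕ) (v : Vec (ℕ × ℕ) n) →
                  (∀ i → ι (f i) ≡ ι (A + proj₁ (lookup v i)) ⊗ inv (ι (a + o + proj₂ (lookup v i)))) →
                  ι (sum (tabulate f)) ≡ quotSum (a + o) v
    sum-quotSum f []      h = refl
    sum-quotSum f (_ ∷ v) h = trans (ι-+ (f zero) _) (cong₂ _⊕_ (h zero) (sum-quotSum (f ∘ suc) v (h ∘ suc)))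

    fractions : Represented M (a + o) n 12 (ι lam) →
                ∃ λ (x : Fin 12 → ℕ) → ∃ λ (y : Fin 12 → ℕ) → ∃ λ (z : Fin 12 → ℕ) →
                ((i : Fin 12) → InInterval p A M (x i)) × ((i : Fin 12) → InInterval p a N (y i)) ×
                ((i : Fin 12) → y i ≢ 0) × ((i : Fin 12) → (y i * z i) % p ≡ 1 % p) × sum12 (λ i → x i * z i) % p ≡ lam
    fractions (v , bv , ev) = x , y , z , x-in , y-in , y≢0 , yz≡1 , total
      where
      k j : Fin 12 → ℕ
      k i = proj₁ (lookup v i)
      j i = proj₂ (lookup v i)
      bound : ∀ i → k i < M × j i < n
      bound i = VAllₚ.lookup⁺ bv i
      d : Fin 12 → F
      d i = ι (a + o + j i)
      d≢0 : ∀ i → d i ≢ 0F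
      d≢0 i = zf (j i) (proj₂ (bound i))
      x y z : Fin 12 → ℕ
      x i = (A + k i) % p
      y i = (a + (o + j i)) % p
      z i = rep (inv (d i))
      ιy : ∀ i → ι (y i) ≡ d i
      ιy i = trans (ι-% _) (cong ι (sym (+-assoc a o (j i))))
      x-in : ∀ i → InInterval p A M (x i)
      x-in i = m%n<n _ p , k i , proj₁ (bound i) , refl
      y-in : ∀ i → InInterval p a N (y i)
      y-in i = m%n<n _ p , o + j i , <-≤-trans (+-monoʳ-< o (proj₂ (bound i))) o+n≤N , refl
      y≢0 : ∀ i → y i ≢ 0
      y≢0 i e = d≢0 i (trans (sym (ιy i)) (cong ι e))
      yz≡1 : ∀ i → (y i * z i) % p ≡ 1 % p
      yz≡1 i = ι-≡⁻¹ (trans (ι-* (y i) (z i)) (trans (cong₂ _⊗_ (ιy i) (ι-rep _)) (inv-right (d≢0 i))))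
      term : ∀ i → ι (x i * z i) ≡ ι (A + k i) ⊗ inv (d i)
      term i = trans (ι-* (x i) (z i)) (cong₂ _⊗_ (ι-% _) (ι-rep _))
      total : sum12 (λ i → x i * z i) % p ≡ lam
      total = trans (ι-≡⁻¹ (trans (cong (ι ∘ sum) (map-tabulate id (λ i → x i * z i))) (trans (sum-quotSum (λ i → x i * z i) v term) ev))) (m<n⇒m%n≡m lam<p)

-- The ε pays for all constants: the surplus p^e outweighs K^(221b) once p is large. Of `K ^ 221`, a
-- factor `K ^ 21` is given back when |J| is replaced by K times the length of its zero-free half.
K-threshold : ∀ b e p M N′ → 0 < p → K ^ (221 * b) ≤ p → 0 < e → p ^ (15 * b + e) < (M ^ 20 * N′ ^ 21) ^ b → p ^ 15 * K ^ 221 < M ^ 20 * N′ ^ 21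
K-threshold b e p M N′ p>0 K≤p e>0 h = ^-cancel-< b (≤-<-trans (begin
  (p ^ 15 * K ^ 221) ^ b          ≡⟨ ^-distribʳ (p ^ 15) (K ^ 221) b ⟩
  (p ^ 15) ^ b * (K ^ 221) ^ b    ≡⟨ cong₂ _*_ (^-*-assoc p 15 b) (^-*-assoc K 221 b) ⟩
  p ^ (15 * b) * K ^ (221 * b)    ≤⟨ *-monoʳ-≤ (p ^ (15 * b)) (≤-trans K≤p (≤-trans (≤-reflexive (sym (*-identityʳ p))) (^-monoʳ-≤ p {{>-nonZero p>0}} e>0))) ⟩
  p ^ (15 * b) * p ^ e            ≡⟨ sym (^-distribˡ-+-* p (15 * b) e) ⟩
  p ^ (15 * b + e) ∎) h)
  where open ≤-Reasoning

half-size : ∀ N → 3 ≤ N → N ≤ 4 * ((N ∸ 1) / 2)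
half-size (suc (suc (suc N))) (s≤s (s≤s (s≤s _))) = begin
  3 + N                   ≤⟨ floor-upper (2 + N) 2 ⟩
  suc q * 2               ≤⟨ *-monoˡ-≤ 2 (+-monoˡ-≤ q (m≥n⇒m/n>0 {2 + N} {2} (s≤s (s≤s z≤n)))) ⟩
  (q + q) * 2             ≡⟨ double q ⟩
  4 * q ∎
  where
  open ≤-Reasoning
  q = (2 + N) / 2
  double : ∀ q → (q + q) * 2 ≡ 4 * q
  double = solve-∀

long-enough : ∀ p N → 0 < p → K ^ 1000 ≤ p → p ^ 5 < N ^ 119 → K ≤ N
long-enough p N p>0 K≤p h = ≮⇒≥ λ N<K → <⇒≱ h (begin
  N ^ 119      ≤⟨ ^-monoˡ-≤ 119 (<⇒≤ N<K) ⟩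
  K ^ 119      ≤⟨ ^-monoʳ-≤ K (m≤m+n 119 881) ⟩
  K ^ 1000     ≤⟨ K≤p ⟩
  p            ≤⟨ m≤m*n p (p ^ 4) {{>-nonZero (m^n>0 p {{>-nonZero p>0}} 4)}} ⟩
  p ^ 5 ∎)
  where open ≤-Reasoning

-- ε is the rational a/b, which may be taken below any real ε, and the two size conditions are
-- raised to the powers 119 and 20b to clear all fractional exponents. The z's are inverses of the
-- y's modulo p.
theorem2 : (a b : ℕ) → 0 < a → 0 < b →
    Σ ℕ λ p₀ → (p : ℕ) .{{_ : NonZero p}} → Prime p → p₀ < p →
    (aI NI aJ NJ : ℕ) → IsNonzeroInterval p aI NI → IsNonzeroInterval p aJ NJ →
    p ^ 5 < NJ ^ 119 →
    p ^ (15 * b + 20 * a) < (NI ^ 20 * NJ ^ 21) ^ b →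
    (lam : ℕ) → lam < p →
    ∃ λ (x : Fin 12 → ℕ) → ∃ λ (y : Fin 12 → ℕ) → ∃ λ (z : Fin 12 → ℕ) →
    ((i : Fin 12) → InInterval p aI NI (x i)) ×
    ((i : Fin 12) → InInterval p aJ NJ (y i)) ×
    ((i : Fin 12) → y i ≢ 0) ×
    ((i : Fin 12) → (y i * z i) % p ≡ 1 % p) ×
    sum12 (λ i → x i * z i) % p ≡ lam
-- `K ^ (221 * b)` is absorbed by the ε; `K ^ 1000` settles the certificates in which the exponents
-- of p leave a gap.
theorem2 a b a>0 b>0 = K ^ (221 * b + 1000) , λ p p-prime p₀<p aI NI aJ NJ hI hJ h₅ hε lam lam<p → solve p p-prime p₀<p aI NI aJ NJ hI hJ h₅ hε lam lam<p
  where
  solve : (p : ℕ) .{{_ : NonZero p}} → Prime p → K ^ (221 * b + 1000) < p →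
    (aI NI aJ NJ : ℕ) → IsNonzeroInterval p aI NI → IsNonzeroInterval p aJ NJ →
    p ^ 5 < NJ ^ 119 →
    p ^ (15 * b + 20 * a) < (NI ^ 20 * NJ ^ 21) ^ b →
    (lam : ℕ) → lam < p →
    ∃ λ (x : Fin 12 → ℕ) → ∃ λ (y : Fin 12 → ℕ) → ∃ λ (z : Fin 12 → ℕ) →
    ((i : Fin 12) → InInterval p aI NI (x i)) ×
    ((i : Fin 12) → InInterval p aJ NJ (y i)) ×
    ((i : Fin 12) → y i ≢ 0) ×
    ((i : Fin 12) → (y i * z i) % p ≡ 1 % p) ×
    sum12 (λ i → x i * z i) % p ≡ lam
  solve p p-prime p₀<p aI NI aJ NJ hI hJ h₅ hε lam lam<p = from (C.zero-free-half aJ NJ NJ≥1 NJ≤p) (C.nonzero-numerator aI NI hI)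
    where
    module C = Conclusion p p-prime
    module PF = PrimeField p p-prime
    p>0 : 0 < p
    p>0 = ≤-<-trans z≤n p₀<p
    NI≥1 : 1 ≤ NI
    NI≥1 = proj₁ (proj₂ hI)
    NI≤p : NI ≤ p
    NI≤p = proj₁ (proj₂ (proj₂ hI))
    NJ≥1 : 1 ≤ NJ
    NJ≥1 = proj₁ (proj₂ hJ)
    NJ≤p : NJ ≤ p
    NJ≤p = proj₁ (proj₂ (proj₂ hJ))
    p-large : K ^ 1000 ≤ p
    p-large = ≤-trans (^-monoʳ-≤ K (m≤n+m 1000 (221 * b))) (<⇒≤ p₀<p)
    K^221b≤p : K ^ (221 * b) ≤ p
    K^221b≤p = ≤-trans (^-monoʳ-≤ K (m≤m+n (221 * b) 1000)) (<⇒≤ p₀<p)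
    N = (NJ ∸ 1) / 2
    3≤NJ : 3 ≤ NJ
    3≤NJ = ≤-trans (below-K 3 refl) (long-enough p NJ p>0 p-large h₅)
    NJ≤KN : NJ ≤ K * N
    NJ≤KN = ≤-trans (half-size NJ 3≤NJ) (*-monoˡ-≤ N (below-K 4 refl))
    N>0 : 0 < N
    N>0 = n≢0⇒n>0 λ e → <⇒≱ NJ≥1 (≤-trans NJ≤KN (≤-reflexive (trans (cong (K *_) e) (*-zeroʳ K))))
    N≤p : N ≤ p
    N≤p = ≤-trans (m/n≤m (NJ ∸ 1) 2) (≤-trans (m∸n≤m NJ 1) NJ≤p)
    size : p ^ 15 * K ^ 221 ≤ NI ^ 20 * (K * N) ^ 21
    size = ≤-trans (<⇒≤ (K-threshold b (20 * a) p NI NJ p>0 K^221b≤p (≤-trans a>0 (m≤n*m a 20)) hε)) (*-monoʳ-≤ (NI ^ 20) (^-monoˡ-≤ 21 NJ≤KN))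
    N-large : p ^ 5 ≤ (K * N) ^ 119
    N-large = ≤-trans (<⇒≤ h₅) (^-monoˡ-≤ 119 NJ≤KN)
    from : (∃ λ o → o + N ≤ NJ × Intervals.ZeroFree p p-prime (aJ + o) N) → (∃ λ k → k < NI × PF.ι (aI + k) ≢ PF.0F) → _
    from (o , o+N≤NJ , zf) (k , k<NI , nonzero) = C.fractions aI NI aJ o N NJ o+N≤NJ zf lam lam<p
      (Numbers.Result.represented p NI N p>0 NI≥1 N>0 NI≤p N≤p size N-large p-large p-prime aI (aJ + o) zf k k<NI nonzero (PF.ι lam))
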